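{- Let $m,n,s,t$ be positive integers and $j,r$ non-negative integers with $r+s+t\equiv 1\pmod 2$ and $j\leqslant s+t$. Then \begin{align*} [m+n+1]\sum_{k=0}^m q^{j(k^2+k)-rk} [2k+1]^{r}A_{m,k}(q)^s A_{n,k}(q)^t &\equiv 0 \mod \frac{[2m]![2n]!}{[m+n]![m]![n]!}, \\ [m+n+1]\sum_{k=0}^m (-1)^kq^{{k\choose 2}+j(k^2+k)-(r-1)k} [2k+1]^{r}A_{m,k}(q)^s A_{n,k}(q)^t &\equiv 0 \mod \frac{[2m]![2n]!}{[m+n]![m]![n]!}. \end{align*}
   Context: For a non-negative integer $n$, $[n]=1+q+\cdots+q^{n-1}$ and $[n]!=[n][n-1]\cdots[1]$ (with $[0]!=1$). The $q$-binomial coefficient is ${n\brack k}=\prod_{i=1}^k\frac{1-q^{n-i+1}}{1-q^i}$ if $k\geqslant 0$ and ${n\brack k}=0$ if $k<0$. The $q$-ballot numbers are $A_{n,k}(q)={2n\brack n-k}-{2n\brack n-k-1}$, which for $0\leqslant k\leqslant n$ equals $q^{n-k}\frac{[2k+1]}{[2n+1]}{2n+1\brack n-k}$ (and is $0$ for $k>n$). The quotient $\frac{[2m]![2n]!}{[m+n]![m]![n]!}$ is a polynomial in $q$. For a polynomial $D$ in $q$ and Laurent polynomials $A,B$ in $q$, $A\equiv B \bmod D$ means that $(A-B)/D$ is a Laurent polynomial in $q$. -}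

module Defs where

open import Data.Nat as ℕ using (ℕ; zero; suc)
open import Data.Integer as ℤ using (ℤ; +_; -[1+_])
open import Data.List using (List; []; _∷_; replicate; _++_; map; foldr)
open import Data.List using (upTo)
open import Data.Product using (Σ; _×_; _,_)
open import Relation.Binary.PropositionalEquality using (_≡_)

-- Polynomials in q with integer coefficients, as coefficient lists
-- (lowest degree first).  Equality is semantic (coefficientwise), so
-- trailing zeros do not matter.

Poly : Set
Poly = List ℤ

infixl 6 _+P_
infixl 7 _*P_

_+P_ : Poly → Poly → Poly
[] +P ys = ys
(x ∷ xs) +P [] = x ∷ xs
(x ∷ xs) +P (y ∷ ys) = (x ℤ.+ y) ∷ (xs +P ys)

scaleP : ℤ → Poly → Poly
scaleP c = map (c ℤ.*_)

negP : Poly → Poly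
negP = scaleP (ℤ.- (+ 1))

shiftP : ℕ → Poly → Poly
shiftP n p = replicate n (+ 0) ++ p

_*P_ : Poly → Poly → Poly
[] *P ys = []
(x ∷ xs) *P ys = scaleP x ys +P shiftP 1 (xs *P ys)

oneP : Poly
oneP = + 1 ∷ []

coeffP : Poly → ℤ → ℤ
coeffP [] i = + 0
coeffP (x ∷ xs) (+ zero) = x
coeffP (x ∷ xs) (+ suc i) = coeffP xs (+ i)
coeffP (x ∷ xs) -[1+ i ] = + 0

-- Laurent polynomials: lp n P represents q^{-n} · P.

record LPoly : Set where
  constructor lp
  field
    negShift : ℕ
    body     : Poly
open LPoly public

infixl 6 _+L_ _-L_
infixl 7 _*L_
infix 4 _≈L_

⟦_⟧ : Poly → LPoly
⟦ p ⟧ = lp 0 p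

_+L_ : LPoly → LPoly → LPoly
lp a p +L lp b r = lp (a ℕ.+ b) (shiftP b p +P shiftP a r)

-L_ : LPoly → LPoly
-L lp a p = lp a (negP p)

_-L_ : LPoly → LPoly → LPoly
x -L y = x +L (-L y)

_*L_ : LPoly → LPoly → LPoly
lp a p *L lp b r = lp (a ℕ.+ b) (p *P r)

zeroL oneL : LPoly
zeroL = ⟦ [] ⟧
oneL = ⟦ oneP ⟧

qpow : ℤ → LPoly
qpow (+ n) = ⟦ shiftP n oneP ⟧
qpow -[1+ n ] = lp (suc n) oneP

_^L_ : LPoly → ℕ → LPoly
x ^L zero = oneL
x ^L suc r = x *L (x ^L r)

coeffL : LPoly → ℤ → ℤ
coeffL (lp a p) i = coeffP p (i ℤ.+ + a)

_≈L_ : LPoly → LPoly → Set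
A ≈L B = ∀ (i : ℤ) → coeffL A i ≡ coeffL B i

infix 4 _≡0mod_
_≡0mod_ : LPoly → LPoly → Set
A ≡0mod D = Σ LPoly (λ L → A ≈L (D *L L))

sumL : ℕ → (ℕ → LPoly) → LPoly
sumL m f = foldr (λ k acc → f k +L acc) zeroL (upTo (suc m))

qint : ℕ → LPoly
qint n = ⟦ replicate n (+ 1) ⟧

qfact : ℕ → LPoly
qfact zero = oneL
qfact (suc n) = qint (suc n) *L qfact n

-- Gaussian binomial for natural k, via q-Pascal:
-- [n+1 brack k+1] = [n brack k] + q^{k+1} [n brack k+1]
qbinℕ : ℕ → ℕ → Poly
qbinℕ zero zero = oneP
qbinℕ zero (suc k) = []
qbinℕ (suc n) zero = oneP
qbinℕ (suc n) (suc k) = qbinℕ n k +P shiftP (suc k) (qbinℕ n (suc k))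

qbin : ℕ → ℤ → LPoly
qbin n (+ k) = ⟦ qbinℕ n k ⟧
qbin n -[1+ k ] = zeroL

ballot : ℕ → ℕ → LPoly
ballot n k = qbin (2 ℕ.* n) (+ n ℤ.- + k)
          -L qbin (2 ℕ.* n) (+ n ℤ.- + k ℤ.- + 1)

-- the modulus [2m]![2n]! / ([m+n]![m]![n]!) is characterised as the
-- (unique) Laurent polynomial D with D·[m+n]![m]![n]! = [2m]![2n]!
IsModulus : ℕ → ℕ → LPoly → Set
IsModulus m n D =
  (D *L (qfact (m ℕ.+ n) *L qfact m *L qfact n)) ≈L (qfact (2 ℕ.* m) *L qfact (2 ℕ.* n))

term1 : (m n s t j r : ℕ) → ℕ → LPoly
term1 m n s t j r k =
  qpow (+ (j ℕ.* (k ℕ.* k ℕ.+ k)) ℤ.- + (r ℕ.* k))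
  *L (qint (2 ℕ.* k ℕ.+ 1) ^L r) *L (ballot m k ^L s) *L (ballot n k ^L t)

choose2 : ℕ → ℕ
choose2 zero = zero
choose2 (suc k) = k ℕ.+ choose2 k

term2 : (m n s t j r : ℕ) → ℕ → LPoly
term2 m n s t j r k =
  ((-L oneL) ^L k)
  *L qpow (+ choose2 k ℤ.+ + (j ℕ.* (k ℕ.* k ℕ.+ k)) ℤ.- (+ r ℤ.- + 1) ℤ.* + k)
  *L (qint (2 ℕ.* k ℕ.+ 1) ^L r) *L (ballot m k ^L s) *L (ballot n k ^L t)

{-# OPTIONS --safe #-}
module Submission where

-- Put l = m - x = n - y.  The kernels E(k) = [m+n+1]! / ([x]! [y]! [l-k]! [l+k+1]!), as functions
-- of k, span a lattice which the following functions of k multiply into itself: q^(k²+k), the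
-- square of S(k) = q^(-k) [2k+1], the square of a ballot number A_{m,k} or A_{n,k}, and S times a
-- ballot number.  This follows from one form of the q-Chu–Vandermonde identity: the product of
-- [2m+1 ; m-k] with a kernel is a combination of kernels, and the ballot numbers are reduced to it
-- by A² = T² - X X' κ and q^m S A = [2m+1] T - κ [m-k] X, where T = [2m+1 ; m-k], X = [2m ; m-k],
-- X' = [2m ; m-k-1] and κ = (1 + q^(m-k)) (1 + q^(m+k+1)).
--
-- Up to a constant, A_{m,k} A_{n,k} is S(k)² [m+n+1 ; m-k] [m+n+1 ; n-k], which is in the lattice
-- after removing S(k)².  As r + s + t is odd, the remaining factors except for one S can be grouped
-- into the functions above, so that everything reduces to the sums of S(k) E(k) and of
-- (-1)^k q^C(k,2) [2k+1] E(k).  Both telescope, and are divisible by [m+n+1] [m+n ; m].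

open import Defs
open import Algebra.Bundles using (AbelianGroup; CommutativeRing; RawRing)
open import Algebra.Properties.Group using (∙-cancelʳ)
open import Algebra.Solver.Ring.AlmostCommutativeRing
  using (fromCommutativeRing; _-Raw-AlmostCommutative⟶_)
open import Data.Bool using (Bool; true; false; not)
open import Data.Integer as ℤ using (ℤ; +_; -[1+_])
import Data.Integer.Properties as ℤ
import Data.Integer.Tactic.RingSolver as ℤSolver
open import Data.List using ([]; _∷_; replicate; foldr; applyUpTo)
open import Data.Maybe using (Maybe; map)
open import Data.Nat as ℕ using (ℕ; zero; suc; z≤n; s≤s; _∸_)
import Data.Nat.Properties as ℕ
open import Data.Nat.Tactic.RingSolver using (solve-∀)
open import Data.Product using (_×_; _,_; ∃)
open import Data.Sum using (_⊎_; inj₁; inj₂)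
open import Level using (0ℓ)
open import Relation.Binary.PropositionalEquality as ≡ using (_≡_)
open import Relation.Nullary.Decidable using (dec⇒maybe)

-- Integer coefficients for the ring solver over an arbitrary commutative ring

-- The choice of functions is governed by the reflection k -> -1-k. It exchanges m - k with m + k +
-- 1, hence fixes the kernels, q^(k²+k), T and κ; it swaps X with X' and changes the sign of S and
-- of every ballot number. All multipliers used are even under it: S and the ballot numbers occur in
-- pairs, X only as X X' or [m-k] X. This is also the origin of the parity condition. The pair
-- A_{m,k} A_{n,k} produces S²; one S becomes the odd weight of the plain sum, or is absorbed into
-- the alternating weight, and the other joins the r + (s - 1) + (t - 1) remaining odd factors,
-- which makes their number even.
--
-- No quotient is ever formed. A kernel is a product of three Gaussian binomials, so integrality is
-- built in, and an expansion is useful precisely when its coefficients do not depend on k.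
-- Factorials are only cancelled from equations.
--
-- Two multipliers do not come from Vandermonde: q^[k]-type functions, that is polynomials in q^(-k)
-- [k] [k+1], act by a first-order difference, and q^(k²+k) acts through a q-identity that counts
-- matrices by rank.

module IntegerCoefficients (R : CommutativeRing 0ℓ 0ℓ) where

  open CommutativeRing R
  open import Algebra.Properties.Ring ring
  open import Algebra.Properties.AbelianGroup +-abelianGroup using (⁻¹-∙-comm)
  open import Algebra.Properties.Semiring.Mult.TCOptimised semiring
    using (×-homo-+; ×1-homo-*; 1+×) renaming (_×_ to _⋆_)
  open import Relation.Binary.Reasoning.Setoid setoid

  -- The optimised multiple makes `1 ⋆ 1#` reduce to `1#`, so the solver constants 0 and 1 denote
  -- `0#` and `1#` by computation.
  fromℤ : ℤ → Carrier
  fromℤ (+ n)    = n ⋆ 1#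
  fromℤ -[1+ n ] = - (suc n ⋆ 1#)

  fromℤ-neg : ∀ i → fromℤ (ℤ.- i) ≈ - fromℤ i
  fromℤ-neg (+ zero)  = sym -0#≈0#
  fromℤ-neg (+ suc n) = refl
  fromℤ-neg -[1+ n ]  = sym (-‿involutive _)

  fromℤ-⊖ : ∀ m n → fromℤ (m ℤ.⊖ n) ≈ m ⋆ 1# - n ⋆ 1#
  fromℤ-⊖ m zero = sym (trans (+-congˡ -0#≈0#) (+-identityʳ _))
  fromℤ-⊖ zero (suc n) = sym (+-identityˡ _)
  fromℤ-⊖ (suc m) (suc n) = begin
    fromℤ (suc m ℤ.⊖ suc n)           ≡⟨ ≡.cong fromℤ (ℤ.[1+m]⊖[1+n]≡m⊖n m n) ⟩
    fromℤ (m ℤ.⊖ n)                   ≈⟨ fromℤ-⊖ m n ⟩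
    m ⋆ 1# - n ⋆ 1#                   ≈⟨ +-congʳ (+-identityˡ _) ⟨
    0# + m ⋆ 1# - n ⋆ 1#              ≈⟨ +-congʳ (+-congʳ (-‿inverseʳ 1#)) ⟨
    1# - 1# + m ⋆ 1# - n ⋆ 1#         ≈⟨ +-congʳ (+-assoc _ _ _) ⟩
    1# + (- 1# + m ⋆ 1#) - n ⋆ 1#     ≈⟨ +-congʳ (+-congˡ (+-comm _ _)) ⟩
    1# + (m ⋆ 1# - 1#) - n ⋆ 1#       ≈⟨ +-congʳ (+-assoc _ _ _) ⟨
    1# + m ⋆ 1# - 1# - n ⋆ 1#         ≈⟨ +-assoc _ _ _ ⟩
    1# + m ⋆ 1# + (- 1# - n ⋆ 1#)     ≈⟨ +-congˡ (⁻¹-∙-comm _ _) ⟩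
    1# + m ⋆ 1# - (1# + n ⋆ 1#)       ≈⟨ +-cong (1+× m 1#) (-‿cong (1+× n 1#)) ⟨
    suc m ⋆ 1# - suc n ⋆ 1#           ∎

  fromℤ-+ : ∀ i j → fromℤ (i ℤ.+ j) ≈ fromℤ i + fromℤ j
  fromℤ-+ (+ m) (+ n) = ×-homo-+ 1# m n
  fromℤ-+ (+ m) -[1+ n ] = fromℤ-⊖ m (suc n)
  fromℤ-+ -[1+ m ] (+ n) = trans (fromℤ-⊖ n (suc m)) (+-comm _ _)
  fromℤ-+ -[1+ m ] -[1+ n ] = begin
    - (suc (suc (m ℕ.+ n)) ⋆ 1#)   ≡⟨ ≡.cong (λ k → - (k ⋆ 1#)) (ℕ.+-suc (suc m) n) ⟨
    - ((suc m ℕ.+ suc n) ⋆ 1#)     ≈⟨ -‿cong (×-homo-+ 1# (suc m) (suc n)) ⟩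
    - (suc m ⋆ 1# + suc n ⋆ 1#)    ≈⟨ ⁻¹-∙-comm _ _ ⟨
    - (suc m ⋆ 1#) - suc n ⋆ 1#    ∎

  fromℤ-*⁺ : ∀ m j → fromℤ (+ m ℤ.* j) ≈ m ⋆ 1# * fromℤ j
  fromℤ-*⁺ m (+ n) = begin
    fromℤ (+ m ℤ.* + n)   ≡⟨ ≡.cong fromℤ (ℤ.pos-* m n) ⟨
    (m ℕ.* n) ⋆ 1#        ≈⟨ ×1-homo-* m n ⟩
    m ⋆ 1# * n ⋆ 1#       ∎
  fromℤ-*⁺ m -[1+ n ] = begin
    fromℤ (+ m ℤ.* -[1+ n ])       ≡⟨ ≡.cong fromℤ (ℤ.neg-distribʳ-* (+ m) (+ suc n)) ⟨
    fromℤ (ℤ.- (+ m ℤ.* + suc n))  ≈⟨ fromℤ-neg (+ m ℤ.* + suc n) ⟩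
    - fromℤ (+ m ℤ.* + suc n)      ≈⟨ -‿cong (fromℤ-*⁺ m (+ suc n)) ⟩
    - (m ⋆ 1# * suc n ⋆ 1#)        ≈⟨ -‿distribʳ-* _ _ ⟩
    m ⋆ 1# * - (suc n ⋆ 1#)        ∎

  fromℤ-* : ∀ i j → fromℤ (i ℤ.* j) ≈ fromℤ i * fromℤ j
  fromℤ-* (+ m) j = fromℤ-*⁺ m j
  fromℤ-* -[1+ m ] j = begin
    fromℤ (-[1+ m ] ℤ.* j)         ≡⟨ ≡.cong fromℤ (ℤ.neg-distribˡ-* (+ suc m) j) ⟨
    fromℤ (ℤ.- (+ suc m ℤ.* j))    ≈⟨ fromℤ-neg (+ suc m ℤ.* j) ⟩
    - fromℤ (+ suc m ℤ.* j)        ≈⟨ -‿cong (fromℤ-*⁺ (suc m) j) ⟩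
    - (suc m ⋆ 1# * fromℤ j)       ≈⟨ -‿distribˡ-* _ _ ⟩
    - (suc m ⋆ 1#) * fromℤ j       ∎

  ℤ-rawRing : RawRing 0ℓ 0ℓ
  ℤ-rawRing = record
    { Carrier = ℤ ; _≈_ = _≡_ ; _+_ = ℤ._+_ ; _*_ = ℤ._*_ ; -_ = ℤ.-_
    ; 0# = + 0 ; 1# = + 1 }

  fromℤ-homomorphism : ℤ-rawRing -Raw-AlmostCommutative⟶ fromCommutativeRing R
  fromℤ-homomorphism = record
    { ⟦_⟧ = fromℤ ; +-homo = fromℤ-+ ; *-homo = fromℤ-* ; -‿homo = fromℤ-neg
    ; 0-homo = refl ; 1-homo = refl }

  _≟ℤ_ : ∀ i j → Maybe (fromℤ i ≈ fromℤ j)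
  i ≟ℤ j = map (λ eq → reflexive (≡.cong fromℤ eq)) (dec⇒maybe (i ℤ.≟ j))

  open import Algebra.Solver.Ring ℤ-rawRing (fromCommutativeRing R) fromℤ-homomorphism _≟ℤ_
    public using (solve; con; _:=_; _:+_; _:*_; _:-_; :-_; _:^_)

-- Gaussian binomials

module QNumbers (R : CommutativeRing 0ℓ 0ℓ) (q : CommutativeRing.Carrier R) where

  open CommutativeRing R hiding (zero)
  open import Algebra.Properties.Semiring.Exp semiring using (_^_; ^-homo-*)
  open IntegerCoefficients R using (solve; con; _:=_; _:+_; _:*_; _:-_; :-_)
  open import Relation.Binary.Reasoning.Setoid setoid

  Σ< : ℕ → (ℕ → Carrier) → Carrier
  Σ< zero    f = 0#
  Σ< (suc n) f = f 0 + Σ< n (λ k → f (suc k))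

  [_] : ℕ → Carrier
  [ zero ]  = 0#
  [ suc n ] = 1# + q * [ n ]

  [_]! : ℕ → Carrier
  [ zero ]!  = 1#
  [ suc n ]! = [ suc n ] * [ n ]!

  binom : ℕ → ℕ → Carrier
  binom zero    zero    = 1#
  binom zero    (suc k) = 0#
  binom (suc n) zero    = 1#
  binom (suc n) (suc k) = binom n k + q ^ suc k * binom n (suc k)

  -- The substitute for division: every q-factorial can be cancelled, so identities between Gaussian
  -- binomials may be checked after clearing denominators.
  Regular : Set
  Regular = ∀ n {x y} → [ suc n ] * x ≈ [ suc n ] * y → x ≈ y

  IsInverse : Carrier → Set
  IsInverse p = p * q ≈ 1#

  inverse-cancel : ∀ {p} → IsInverse p → ∀ a b → q ^ a * p ^ b ≈ q ^ suc a * p ^ suc b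
  inverse-cancel {p} p*q≈1 a b = begin
    q ^ a * p ^ b               ≈⟨ *-identityˡ _ ⟨
    1# * (q ^ a * p ^ b)        ≈⟨ *-congʳ p*q≈1 ⟨
    p * q * (q ^ a * p ^ b)
      ≈⟨ solve 4 (λ p q x y → p :* q :* (x :* y) := q :* x :* (p :* y)) refl p q _ _ ⟩
    q ^ suc a * p ^ suc b       ∎

  Σ<-cong : ∀ n {f g : ℕ → Carrier} → (∀ k → k ℕ.< n → f k ≈ g k) → Σ< n f ≈ Σ< n g
  Σ<-cong zero    f≈g = refl
  Σ<-cong (suc n) f≈g = +-cong (f≈g 0 (s≤s z≤n)) (Σ<-cong n (λ k k<n → f≈g (suc k) (s≤s k<n)))

  Σ<-zero : ∀ n {f : ℕ → Carrier} → (∀ k → k ℕ.< n → f k ≈ 0#) → Σ< n f ≈ 0#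
  Σ<-zero zero    f≈0 = refl
  Σ<-zero (suc n) f≈0 =
    trans (+-cong (f≈0 0 (s≤s z≤n)) (Σ<-zero n (λ k k<n → f≈0 (suc k) (s≤s k<n)))) (+-identityˡ _)

  Σ<-+ : ∀ n (f g : ℕ → Carrier) → Σ< n (λ k → f k + g k) ≈ Σ< n f + Σ< n g
  Σ<-+ zero    f g = sym (+-identityˡ _)
  Σ<-+ (suc n) f g = trans (+-congˡ (Σ<-+ n _ _))
    (solve 4 (λ a b s t → a :+ b :+ (s :+ t) := a :+ s :+ (b :+ t)) refl _ _ _ _)

  Σ<-* : ∀ n a (f : ℕ → Carrier) → Σ< n (λ k → a * f k) ≈ a * Σ< n f
  Σ<-* zero    a f = sym (zeroʳ a)
  Σ<-* (suc n) a f = trans (+-congˡ (Σ<-* n a _)) (sym (distribˡ a _ _))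

  Σ<-snoc : ∀ n (f : ℕ → Carrier) → Σ< (suc n) f ≈ Σ< n f + f n
  Σ<-snoc zero    f = +-comm _ _
  Σ<-snoc (suc n) f = trans (+-congˡ (Σ<-snoc n _)) (sym (+-assoc _ _ _))

  0*ˡ : ∀ {x y} → x ≈ 0# → x * y ≈ 0#
  0*ˡ x≈0 = trans (*-congʳ x≈0) (zeroˡ _)

  0*ʳ : ∀ {x y} → y ≈ 0# → x * y ≈ 0#
  0*ʳ y≈0 = trans (*-congˡ y≈0) (zeroʳ _)

  ^-cong : ∀ {m n} → m ≡ n → q ^ m ≈ q ^ n
  ^-cong eq = reflexive (≡.cong (q ^_) eq)

  [1+] : ∀ n → [ suc n ] ≈ [ n ] + q ^ n
  [1+] zero    = solve 1 (λ q → con (+ 1) :+ q :* con (+ 0) := con (+ 0) :+ con (+ 1)) refl q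
  [1+] (suc n) = trans (+-congˡ (*-congˡ ([1+] n)))
    (solve 3 (λ q a b → con (+ 1) :+ q :* (a :+ b) := con (+ 1) :+ q :* a :+ q :* b) refl q _ _)

  [+] : ∀ m n → [ m ℕ.+ n ] ≈ [ m ] + q ^ m * [ n ]
  [+] zero    n = sym (trans (+-identityˡ _) (*-identityˡ _))
  [+] (suc m) n = trans (+-congˡ (*-congˡ ([+] m n)))
    (solve 4 (λ q a b c → con (+ 1) :+ q :* (a :+ b :* c) := con (+ 1) :+ q :* a :+ q :* b :* c)
      refl q _ _ _)

  -- Eliminating powers of q in favour of q-integers turns mixed identities into polynomial ones in
  -- q and independent variables, which the ring solver decides.
  ^≈1-[] : ∀ n → q ^ n ≈ 1# - (1# - q) * [ n ]
  ^≈1-[] zero    = solve 1 (λ q → con (+ 1) := con (+ 1) :- (con (+ 1) :- q) :* con (+ 0)) refl q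
  ^≈1-[] (suc n) = trans (*-congˡ (^≈1-[] n))
    (solve 2 (λ q a → q :* (con (+ 1) :- (con (+ 1) :- q) :* a)
                   := con (+ 1) :- (con (+ 1) :- q) :* (con (+ 1) :+ q :* a)) refl q _)

  binom-cong : ∀ {n n′ k k′} → n ≡ n′ → k ≡ k′ → binom n k ≈ binom n′ k′
  binom-cong eq eq′ = reflexive (≡.cong₂ binom eq eq′)

  binom-0 : ∀ n → binom n 0 ≈ 1#
  binom-0 zero    = refl
  binom-0 (suc n) = refl

  binom-< : ∀ {n k} → n ℕ.< k → binom n k ≈ 0#
  binom-< {zero}  (s≤s _)   = refl
  binom-< {suc n} (s≤s n<k) =
    trans (+-cong (binom-< n<k) (trans (*-congˡ (binom-< (ℕ.m≤n⇒m≤1+n n<k))) (zeroʳ _))) (+-identityˡ _)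

  binom-! : ∀ a b → binom (a ℕ.+ b) a * ([ a ]! * [ b ]!) ≈ [ a ℕ.+ b ]!
  binom-! zero    b = trans (*-cong (binom-0 b) (*-identityˡ _)) (*-identityˡ _)
  binom-! (suc a) zero = begin
    (binom (a ℕ.+ 0) a + q ^ suc a * binom (a ℕ.+ 0) (suc a)) * ([ suc a ] * [ a ]! * 1#)
      ≈⟨ *-congʳ (+-congˡ (*-congˡ (binom-< (s≤s (ℕ.≤-reflexive (ℕ.+-identityʳ a)))))) ⟩
    (binom (a ℕ.+ 0) a + q ^ suc a * 0#) * ([ suc a ] * [ a ]! * 1#)
      ≈⟨ solve 4 (λ g e n f → (g :+ e :* con (+ 0)) :* (n :* f :* con (+ 1))
           := n :* (g :* (f :* con (+ 1)))) refl _ _ _ _ ⟩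
    [ suc a ] * (binom (a ℕ.+ 0) a * ([ a ]! * 1#))
      ≈⟨ *-cong (reflexive (≡.cong (λ n → [ suc n ]) (≡.sym (ℕ.+-identityʳ a)))) (binom-! a zero) ⟩
    [ suc (a ℕ.+ 0) ]! ∎
  binom-! (suc a) (suc b) = begin
    (binom (a ℕ.+ suc b) a + q ^ suc a * binom (a ℕ.+ suc b) (suc a))
      * ([ suc a ] * [ a ]! * ([ suc b ] * [ b ]!))
      ≈⟨ *-congʳ (+-congˡ (*-congˡ (binom-cong (ℕ.+-suc a b) ≡.refl))) ⟩
    (binom (a ℕ.+ suc b) a + q ^ suc a * binom (suc a ℕ.+ b) (suc a))
      * ([ suc a ] * [ a ]! * ([ suc b ] * [ b ]!))
      ≈⟨ solve 7 (λ g e h n f m k → (g :+ e :* h) :* (n :* f :* (m :* k))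
           := n :* (g :* (f :* (m :* k))) :+ e :* m :* (h :* (n :* f :* k))) refl _ _ _ _ _ _ _ ⟩
    [ suc a ] * (binom (a ℕ.+ suc b) a * ([ a ]! * [ suc b ]!))
      + q ^ suc a * [ suc b ] * (binom (suc a ℕ.+ b) (suc a) * ([ suc a ]! * [ b ]!))
      ≈⟨ +-cong (*-congˡ (binom-! a (suc b))) (*-congˡ (binom-! (suc a) b)) ⟩
    [ suc a ] * [ a ℕ.+ suc b ]! + q ^ suc a * [ suc b ] * [ suc a ℕ.+ b ]!
      ≈⟨ +-congˡ (*-congˡ (reflexive (≡.cong [_]! (≡.sym (ℕ.+-suc a b))))) ⟩
    [ suc a ] * [ a ℕ.+ suc b ]! + q ^ suc a * [ suc b ] * [ a ℕ.+ suc b ]!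
      ≈⟨ distribʳ _ _ _ ⟨
    ([ suc a ] + q ^ suc a * [ suc b ]) * [ a ℕ.+ suc b ]!
      ≈⟨ *-congʳ ([+] (suc a) (suc b)) ⟨
    [ suc a ℕ.+ suc b ] * [ a ℕ.+ suc b ]! ∎

  -- The form of the q-Chu–Vandermonde identity in which passing from b to b + 1 is the same as
  -- passing from e to e + 1.
  vandermonde : ∀ b c e N → c ℕ.< N →
    Σ< N (λ g → q ^ (g ℕ.* (e ℕ.+ g)) * (binom (c ℕ.+ e) (e ℕ.+ g) * binom b g))
      ≈ binom (b ℕ.+ (c ℕ.+ e)) (b ℕ.+ e)
  vandermonde zero c e (suc N) _ = begin
    q ^ 0 * (binom (c ℕ.+ e) (e ℕ.+ 0) * 1#)
      + Σ< N (λ g → q ^ (suc g ℕ.* (e ℕ.+ suc g)) * (binom (c ℕ.+ e) (e ℕ.+ suc g) * 0#))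
      ≈⟨ +-congˡ (Σ<-zero N (λ k _ → trans (*-congˡ (zeroʳ _)) (zeroʳ _))) ⟩
    1# * (binom (c ℕ.+ e) (e ℕ.+ 0) * 1#) + 0#
      ≈⟨ solve 1 (λ g → con (+ 1) :* (g :* con (+ 1)) :+ con (+ 0) := g) refl _ ⟩
    binom (c ℕ.+ e) (e ℕ.+ 0)
      ≈⟨ binom-cong {c ℕ.+ e} ≡.refl (ℕ.+-identityʳ e) ⟩
    binom (c ℕ.+ e) e ∎
  vandermonde (suc b) c e (suc N) c<N = begin
    Σ< (suc N) (λ g → q ^ (g ℕ.* (e ℕ.+ g)) * (binom (c ℕ.+ e) (e ℕ.+ g) * binom (suc b) g))
      ≈⟨ Σ<-cong (suc N) (λ g _ → split g) ⟩
    Σ< (suc N) (λ g → α g + β g)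
      ≈⟨ Σ<-+ (suc N) α β ⟩
    0# + Σ< N γ + Σ< (suc N) β
      ≈⟨ +-congʳ (+-identityˡ _) ⟩
    Σ< N γ + Σ< (suc N) β
      -- The shift of α lost the last index; `γ N` is restored at no cost, being zero by the bound
      -- on c, so that both sums have the same range.
      ≈⟨ +-congʳ (trans (Σ<-snoc N γ) (trans (+-congˡ γN≈0) (+-identityʳ _))) ⟨
    Σ< (suc N) γ + Σ< (suc N) β
      ≈⟨ Σ<-+ (suc N) γ β ⟨
    Σ< (suc N) (λ g → γ g + β g)
      ≈⟨ Σ<-cong (suc N) (λ g _ → merge g) ⟩
    Σ< (suc N) (λ g → q ^ (g ℕ.* (suc e ℕ.+ g)) * (binom (c ℕ.+ suc e) (suc e ℕ.+ g) * binom b g))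
      ≈⟨ vandermonde b c (suc e) (suc N) c<N ⟩
    binom (b ℕ.+ (c ℕ.+ suc e)) (b ℕ.+ suc e)
      ≈⟨ binom-cong (≡.trans (≡.cong (b ℕ.+_) (ℕ.+-suc c e)) (ℕ.+-suc b _)) (ℕ.+-suc b e) ⟩
    binom (suc b ℕ.+ (c ℕ.+ e)) (suc b ℕ.+ e) ∎
    where
    B = binom (c ℕ.+ e)
    β γ α : ℕ → Carrier
    β g = q ^ (g ℕ.* (e ℕ.+ g)) * (B (e ℕ.+ g) * (q ^ g * binom b g))
    γ g = q ^ (suc g ℕ.* (e ℕ.+ suc g)) * (B (e ℕ.+ suc g) * binom b g)
    α zero    = 0#
    α (suc g) = γ g
    split : ∀ g → q ^ (g ℕ.* (e ℕ.+ g)) * (B (e ℕ.+ g) * binom (suc b) g) ≈ α g + β g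
    split zero = sym (trans (+-identityˡ _)
      (*-congˡ (*-congˡ (trans (*-identityˡ _) (binom-0 b)))))
    split (suc g) = solve 4 (λ a x y z → a :* (x :* (y :+ z)) := a :* (x :* y) :+ a :* (x :* z))
      refl _ _ _ _
    γN≈0 : γ N ≈ 0#
    γN≈0 = trans (*-congˡ (trans (*-congʳ (binom-<
      (ℕ.<-≤-trans (ℕ.+-monoˡ-< e c<N) (ℕ.≤-reflexive (ℕ.+-comm (suc N) e))))) (zeroˡ _))) (zeroʳ _)
    -- Pascal's rule split `binom (suc b) g`; it is now read backwards in the other binomial, which
    -- raises e.
    merge : ∀ g → γ g + β g
      ≈ q ^ (g ℕ.* (suc e ℕ.+ g)) * (binom (c ℕ.+ suc e) (suc e ℕ.+ g) * binom b g)
    merge g = begin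
      γ g + β g
        ≈⟨ +-cong (*-cong (trans (^-cong (shift g e)) (^-homo-* q (g ℕ.* (suc e ℕ.+ g)) _))
                          (*-congʳ (binom-cong {c ℕ.+ e} ≡.refl (ℕ.+-suc e g))))
                  (solve 4 (λ a x y z → a :* (x :* (y :* z)) := a :* y :* (x :* z)) refl _ _ _ _) ⟩
      q ^ (g ℕ.* (suc e ℕ.+ g)) * q ^ suc (e ℕ.+ g) * (B (suc (e ℕ.+ g)) * binom b g)
        + q ^ (g ℕ.* (e ℕ.+ g)) * q ^ g * (B (e ℕ.+ g) * binom b g)
        ≈⟨ +-congˡ (*-congʳ (trans (^-cong (shift′ g e)) (^-homo-* q (g ℕ.* (e ℕ.+ g)) g))) ⟨
      q ^ (g ℕ.* (suc e ℕ.+ g)) * q ^ suc (e ℕ.+ g) * (B (suc (e ℕ.+ g)) * binom b g)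
        + q ^ (g ℕ.* (suc e ℕ.+ g)) * (B (e ℕ.+ g) * binom b g)
        ≈⟨ solve 5 (λ x y u v w → x :* y :* (u :* w) :+ x :* (v :* w)
             := x :* ((v :+ y :* u) :* w)) refl _ _ _ _ _ ⟩
      q ^ (g ℕ.* (suc e ℕ.+ g)) * (binom (suc (c ℕ.+ e)) (suc e ℕ.+ g) * binom b g)
        ≈⟨ *-congˡ (*-congʳ (binom-cong (≡.sym (ℕ.+-suc c e)) ≡.refl)) ⟩
      q ^ (g ℕ.* (suc e ℕ.+ g)) * (binom (c ℕ.+ suc e) (suc e ℕ.+ g) * binom b g) ∎
      where
      shift : ∀ g e → suc g ℕ.* (e ℕ.+ suc g) ≡ g ℕ.* (suc e ℕ.+ g) ℕ.+ suc (e ℕ.+ g)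
      shift = solve-∀
      shift′ : ∀ g e → g ℕ.* (suc e ℕ.+ g) ≡ g ℕ.* (e ℕ.+ g) ℕ.+ g
      shift′ = solve-∀

-- Identities of Gaussian binomials obtained by cancelling q-factorials

module Binomials
  (R : CommutativeRing 0ℓ 0ℓ) (q : CommutativeRing.Carrier R)
  (regular : QNumbers.Regular R q)
  where

  open CommutativeRing R hiding (zero)
  open QNumbers R q
  open import Algebra.Properties.Semiring.Exp semiring using (_^_; ^-homo-*)
  open IntegerCoefficients R using (solve; con; _:=_; _:+_; _:*_; _:-_; :-_)
  open import Relation.Binary.Reasoning.Setoid setoid

  !-cancelʳ : ∀ n {x y} → x * [ n ]! ≈ y * [ n ]! → x ≈ y
  !-cancelʳ zero    eq = trans (sym (*-identityʳ _)) (trans eq (*-identityʳ _))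
  !-cancelʳ (suc n) eq = !-cancelʳ n (regular n (trans (swap _) (trans eq (sym (swap _)))))
    where
    swap : ∀ x → [ suc n ] * (x * [ n ]!) ≈ x * [ suc n ]!
    swap x = solve 3 (λ x a b → a :* (x :* b) := x :* (a :* b)) refl _ _ _

  binom-sym : ∀ a b → binom (a ℕ.+ b) a ≈ binom (a ℕ.+ b) b
  binom-sym a b = !-cancelʳ b (!-cancelʳ a (begin
    binom (a ℕ.+ b) a * [ b ]! * [ a ]!     ≈⟨ solve 3 (λ x y z → x :* y :* z := x :* (z :* y)) refl _ _ _ ⟩
    binom (a ℕ.+ b) a * ([ a ]! * [ b ]!)   ≈⟨ binom-! a b ⟩
    [ a ℕ.+ b ]!                            ≡⟨ ≡.cong [_]! (ℕ.+-comm a b) ⟩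
    [ b ℕ.+ a ]!                            ≈⟨ binom-! b a ⟨
    binom (b ℕ.+ a) b * ([ b ]! * [ a ]!)   ≈⟨ *-assoc _ _ _ ⟨
    binom (b ℕ.+ a) b * [ b ]! * [ a ]!     ≈⟨ *-congʳ (*-congʳ (binom-cong (ℕ.+-comm b a) ≡.refl)) ⟩
    binom (a ℕ.+ b) b * [ b ]! * [ a ]!     ∎))

  binom-revision : ∀ a b c →
    binom (a ℕ.+ b ℕ.+ c) (a ℕ.+ b) * binom (a ℕ.+ b) a
      ≈ binom (a ℕ.+ (b ℕ.+ c)) a * binom (b ℕ.+ c) b
  binom-revision a b c = !-cancelʳ a (!-cancelʳ b (!-cancelʳ c (begin
    binom (a ℕ.+ b ℕ.+ c) (a ℕ.+ b) * binom (a ℕ.+ b) a * [ a ]! * [ b ]! * [ c ]!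
      ≈⟨ solve 5 (λ x y u v w → x :* y :* u :* v :* w := x :* (y :* (u :* v) :* w)) refl _ _ _ _ _ ⟩
    binom (a ℕ.+ b ℕ.+ c) (a ℕ.+ b) * (binom (a ℕ.+ b) a * ([ a ]! * [ b ]!) * [ c ]!)
      ≈⟨ *-congˡ (*-congʳ (binom-! a b)) ⟩
    binom (a ℕ.+ b ℕ.+ c) (a ℕ.+ b) * ([ a ℕ.+ b ]! * [ c ]!)
      ≈⟨ binom-! (a ℕ.+ b) c ⟩
    [ a ℕ.+ b ℕ.+ c ]!
      ≡⟨ ≡.cong [_]! (ℕ.+-assoc a b c) ⟩
    [ a ℕ.+ (b ℕ.+ c) ]!
      ≈⟨ binom-! a (b ℕ.+ c) ⟨
    binom (a ℕ.+ (b ℕ.+ c)) a * ([ a ]! * [ b ℕ.+ c ]!)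
      ≈⟨ *-congˡ (*-congˡ (binom-! b c)) ⟨
    binom (a ℕ.+ (b ℕ.+ c)) a * ([ a ]! * (binom (b ℕ.+ c) b * ([ b ]! * [ c ]!)))
      ≈⟨ solve 5 (λ x y u v w → x :* (u :* (y :* (v :* w))) := x :* y :* u :* v :* w) refl _ _ _ _ _ ⟩
    binom (a ℕ.+ (b ℕ.+ c)) a * binom (b ℕ.+ c) b * [ a ]! * [ b ]! * [ c ]! ∎)))

  -- Both sides vanish for g > b, so the identity can be used termwise in a sum whose range exceeds
  -- b.
  binom-revision′ : ∀ y b g →
    binom (y ℕ.+ b) y * binom b g ≈ binom (y ℕ.+ g) y * binom (y ℕ.+ b) (y ℕ.+ g)
  binom-revision′ y b g with ℕ.≤-<-connex g b
  ... | inj₂ b<g = trans (trans (*-congˡ (binom-< b<g)) (zeroʳ _))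
                     (sym (trans (*-congˡ (binom-< (ℕ.+-monoʳ-< y b<g))) (zeroʳ _)))
  ... | inj₁ g≤b with ℕ.m≤n⇒∃[o]m+o≡n g≤b
  ...   | c , ≡.refl =
    sym (trans (*-comm _ _) (trans (*-congʳ (binom-cong (≡.sym (ℕ.+-assoc y g c)) ≡.refl))
      (binom-revision y g c)))

  absorb : ∀ a b → [ suc a ] * binom (a ℕ.+ b) (suc a) ≈ [ b ] * binom (a ℕ.+ b) a
  absorb a zero = trans (trans (*-congˡ (binom-< (s≤s (ℕ.≤-reflexive (ℕ.+-identityʳ a))))) (zeroʳ _))
                    (sym (zeroˡ _))
  absorb a (suc b) = !-cancelʳ a (!-cancelʳ b (begin
    [ suc a ] * binom (a ℕ.+ suc b) (suc a) * [ a ]! * [ b ]!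
      ≈⟨ solve 4 (λ n g x y → n :* g :* x :* y := g :* (n :* x :* y)) refl _ _ _ _ ⟩
    binom (a ℕ.+ suc b) (suc a) * ([ suc a ]! * [ b ]!)
      ≈⟨ *-congʳ (binom-cong (ℕ.+-suc a b) ≡.refl) ⟩
    binom (suc a ℕ.+ b) (suc a) * ([ suc a ]! * [ b ]!)
      ≈⟨ binom-! (suc a) b ⟩
    [ suc a ℕ.+ b ]!
      ≡⟨ ≡.cong [_]! (ℕ.+-suc a b) ⟨
    [ a ℕ.+ suc b ]!
      ≈⟨ binom-! a (suc b) ⟨
    binom (a ℕ.+ suc b) a * ([ a ]! * [ suc b ]!)
      ≈⟨ solve 4 (λ n g x y → g :* (x :* (n :* y)) := n :* g :* x :* y) refl _ _ _ _ ⟩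
    [ suc b ] * binom (a ℕ.+ suc b) a * [ a ]! * [ b ]! ∎))

  absorb-top : ∀ a b → [ suc b ] * binom (a ℕ.+ suc b) a ≈ [ a ℕ.+ suc b ] * binom (a ℕ.+ b) a
  absorb-top a b = !-cancelʳ a (!-cancelʳ b (begin
    [ suc b ] * binom (a ℕ.+ suc b) a * [ a ]! * [ b ]!
      ≈⟨ solve 4 (λ n g x y → n :* g :* x :* y := g :* (x :* (n :* y))) refl _ _ _ _ ⟩
    binom (a ℕ.+ suc b) a * ([ a ]! * [ suc b ]!)
      ≈⟨ binom-! a (suc b) ⟩
    [ a ℕ.+ suc b ]!
      ≡⟨ ≡.cong [_]! (ℕ.+-suc a b) ⟩
    [ suc (a ℕ.+ b) ] * [ a ℕ.+ b ]!
      ≈⟨ *-cong (reflexive (≡.cong [_] (ℕ.+-suc a b))) (binom-! a b) ⟨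
    [ a ℕ.+ suc b ] * (binom (a ℕ.+ b) a * ([ a ]! * [ b ]!))
      ≈⟨ solve 4 (λ n g x y → n :* (g :* (x :* y)) := n :* g :* x :* y) refl _ _ _ _ ⟩
    [ a ℕ.+ suc b ] * binom (a ℕ.+ b) a * [ a ]! * [ b ]! ∎))

  absorb-both : ∀ n a → [ suc n ] * binom n a ≈ [ suc a ] * binom (suc n) (suc a)
  absorb-both n a with ℕ.≤-<-connex a n
  ... | inj₂ n<a = trans (trans (*-congˡ (binom-< n<a)) (zeroʳ _))
                     (sym (trans (*-congˡ (binom-< (s≤s n<a))) (zeroʳ _)))
  ... | inj₁ a≤n with ℕ.m≤n⇒∃[o]m+o≡n a≤n
  ...   | b , ≡.refl = begin
    [ suc (a ℕ.+ b) ] * binom (a ℕ.+ b) a   ≡⟨ ≡.cong (λ n → [ n ] * binom (a ℕ.+ b) a) (ℕ.+-suc a b) ⟨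
    [ a ℕ.+ suc b ] * binom (a ℕ.+ b) a     ≈⟨ absorb-top a b ⟨
    [ suc b ] * binom (a ℕ.+ suc b) a       ≈⟨ absorb a (suc b) ⟨
    [ suc a ] * binom (a ℕ.+ suc b) (suc a) ≈⟨ *-congˡ (binom-cong (ℕ.+-suc a b) ≡.refl) ⟩
    [ suc a ] * binom (suc (a ℕ.+ b)) (suc a) ∎

  -- The mirror image of the defining Pascal rule under `binom-sym`. For k > n the truncated
  -- exponent does no harm, as its binomial is zero.
  pascal′ : ∀ n k → binom (suc n) (suc k) ≈ binom n (suc k) + q ^ (n ∸ k) * binom n k
  pascal′ n k with ℕ.≤-<-connex k n
  ... | inj₂ n<k = trans (binom-< (s≤s n<k)) (sym (trans (+-cong (binom-< (ℕ.m≤n⇒m≤1+n n<k))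
                     (trans (*-congˡ (binom-< n<k)) (zeroʳ _))) (+-identityˡ _)))
  ... | inj₁ k≤n with ℕ.m≤n⇒∃[o]m+o≡n k≤n
  ...   | zero , ≡.refl = begin
    binom (k ℕ.+ 0) k + q ^ suc k * binom (k ℕ.+ 0) (suc k)
      ≈⟨ +-congˡ (*-congˡ over) ⟩
    binom (k ℕ.+ 0) k + q ^ suc k * 0#
      ≈⟨ solve 2 (λ g e → g :+ e :* con (+ 0) := con (+ 0) :+ con (+ 1) :* g) refl _ _ ⟩
    0# + q ^ 0 * binom (k ℕ.+ 0) k
      ≈⟨ +-cong over (*-congʳ (^-cong (ℕ.m+n∸m≡n k 0))) ⟨
    binom (k ℕ.+ 0) (suc k) + q ^ (k ℕ.+ 0 ∸ k) * binom (k ℕ.+ 0) k ∎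
    where
    over : binom (k ℕ.+ 0) (suc k) ≈ 0#
    over = binom-< (s≤s (ℕ.≤-reflexive (ℕ.+-identityʳ k)))
  ...   | suc b , ≡.refl = begin
    binom (suc k ℕ.+ suc b) (suc k)
      ≈⟨ binom-sym (suc k) (suc b) ⟩
    binom (k ℕ.+ suc b) b + q ^ suc b * binom (k ℕ.+ suc b) (suc b)
      ≈⟨ +-cong (trans (binom-cong (ℕ.+-suc k b) ≡.refl) (trans (sym (binom-sym (suc k) b))
                  (binom-cong (≡.sym (ℕ.+-suc k b)) ≡.refl)))
                (*-cong (^-cong (≡.sym (ℕ.m+n∸m≡n k (suc b)))) (sym (binom-sym k (suc b)))) ⟩
    binom (k ℕ.+ suc b) (suc k) + q ^ (k ℕ.+ suc b ∸ k) * binom (k ℕ.+ suc b) k ∎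

  -- The q-Pochhammer symbol (q; q)_g and the distribution of ranks

  poch : ℕ → Carrier
  poch zero    = 1#
  poch (suc g) = poch g * (1# - q ^ suc g)

  absorb-poch : ∀ a b → (1# - q ^ suc a) * binom (a ℕ.+ b) (suc a) ≈ (1# - q ^ b) * binom (a ℕ.+ b) a
  absorb-poch a b = begin
    (1# - q ^ suc a) * binom (a ℕ.+ b) (suc a)      ≈⟨ *-congʳ (+-congˡ (-‿cong (^≈1-[] (suc a)))) ⟩
    (1# - (1# - (1# - q) * [ suc a ])) * binom (a ℕ.+ b) (suc a)
      ≈⟨ solve 3 (λ q n g → (con (+ 1) :- (con (+ 1) :- (con (+ 1) :- q) :* n)) :* g
                         := (con (+ 1) :- q) :* (n :* g)) refl _ _ _ ⟩
    (1# - q) * ([ suc a ] * binom (a ℕ.+ b) (suc a)) ≈⟨ *-congˡ (absorb a b) ⟩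
    (1# - q) * ([ b ] * binom (a ℕ.+ b) a)
      ≈⟨ solve 3 (λ q n g → (con (+ 1) :- (con (+ 1) :- (con (+ 1) :- q) :* n)) :* g
                         := (con (+ 1) :- q) :* (n :* g)) refl _ _ _ ⟨
    (1# - (1# - (1# - q) * [ b ])) * binom (a ℕ.+ b) a ≈⟨ *-congʳ (+-congˡ (-‿cong (^≈1-[] b))) ⟨
    (1# - q ^ b) * binom (a ℕ.+ b) a                ∎

  -- When q⁻¹ is a prime power, the summand is the proportion of matrices of rank g among the
  -- b × c matrices over a field with q⁻¹ elements.
  rank-sum : ∀ b c N → c ℕ.< N →
    Σ< N (λ g → binom b g * binom c g * poch g * q ^ ((b ∸ g) ℕ.* (c ∸ g))) ≈ 1#
  rank-sum b zero (suc N) _ = trans (+-cong (begin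
      binom b 0 * 1# * 1# * q ^ (b ℕ.* 0)
        ≈⟨ *-cong (*-congʳ (*-congʳ (binom-0 b))) (^-cong (ℕ.*-zeroʳ b)) ⟩
      1# * 1# * 1# * 1#
        ≈⟨ solve 0 (con (+ 1) :* con (+ 1) :* con (+ 1) :* con (+ 1) := con (+ 1)) refl ⟩
      1# ∎)
      (Σ<-zero N (λ k _ → trans (*-congʳ (trans (*-congʳ (zeroʳ _)) (zeroˡ _))) (zeroˡ _))))
    (+-identityʳ _)
  rank-sum b (suc c) (suc N) (s≤s c<N) = begin
    Σ< (suc N) (t (suc c))
      ≈⟨ Σ<-cong (suc N) (λ g _ → split g) ⟩
    Σ< (suc N) (λ g → α g + β g)
      ≈⟨ Σ<-+ (suc N) α β ⟩
    0# + Σ< N γ + Σ< (suc N) β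
      ≈⟨ +-cong (+-identityˡ _) (trans (Σ<-snoc N β) (trans (+-congˡ βN≈0) (+-identityʳ _))) ⟩
    Σ< N γ + Σ< N β
      ≈⟨ Σ<-+ N γ β ⟨
    Σ< N (λ g → γ g + β g)
      ≈⟨ Σ<-cong N (λ g _ → merge g) ⟩
    Σ< N (t c)
      ≈⟨ rank-sum b c N c<N ⟩
    1# ∎
    where
    t : ℕ → ℕ → Carrier
    t c g = binom b g * binom c g * poch g * q ^ ((b ∸ g) ℕ.* (c ∸ g))
    α β γ : ℕ → Carrier
    β g = binom b g * binom c g * poch g * q ^ ((b ∸ g) ℕ.* (suc c ∸ g))
    γ g = binom b (suc g) * (q ^ (c ∸ g) * binom c g) * poch (suc g) * q ^ ((b ∸ suc g) ℕ.* (c ∸ g))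
    α zero    = 0#
    α (suc g) = γ g
    split : ∀ g → t (suc c) g ≈ α g + β g
    split zero = sym (trans (+-identityˡ _) (*-congʳ (*-congʳ (*-congˡ (binom-0 c)))))
    split (suc g) = trans (*-congʳ (*-congʳ (*-congˡ (pascal′ c g))))
      (solve 5 (λ u x y v w → u :* (x :+ y) :* v :* w := u :* y :* v :* w :+ u :* x :* v :* w)
        refl _ _ _ _ _)
    βN≈0 : β N ≈ 0#
    βN≈0 = 0*ˡ (0*ˡ (0*ʳ (binom-< c<N)))
    0+0 : ∀ {x y z} → x ≈ 0# → y ≈ 0# → z ≈ 0# → x + y ≈ z
    0+0 x≈0 y≈0 z≈0 = trans (+-cong x≈0 y≈0) (trans (+-identityˡ _) (sym z≈0))
    -- With e = b - g, `absorb-poch` exchanges the new factor 1 - q^(g+1) for 1 - q^e, while β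
    -- carries an extra q^e; the two weights add up to 1.
    merge : ∀ g → γ g + β g ≈ t c g
    merge g with ℕ.≤-<-connex g c | ℕ.≤-<-connex g b
    ... | inj₂ c<g | _ = 0+0
      (0*ˡ (0*ˡ (0*ʳ (0*ʳ (binom-< c<g)))))
      (0*ˡ (0*ˡ (0*ʳ (binom-< c<g))))
      (0*ˡ (0*ˡ (0*ʳ (binom-< c<g))))
    ... | inj₁ _ | inj₂ b<g = 0+0
      (0*ˡ (0*ˡ (0*ˡ (binom-< (ℕ.m≤n⇒m≤1+n b<g)))))
      (0*ˡ (0*ˡ (0*ˡ (binom-< b<g))))
      (0*ˡ (0*ˡ (0*ˡ (binom-< b<g))))
    ... | inj₁ g≤c | inj₁ g≤b with ℕ.m≤n⇒∃[o]m+o≡n g≤b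
    ...   | e , ≡.refl = begin
      binom B (suc g) * (q ^ d * binom c g) * (poch g * (1# - q ^ suc g)) * q ^ ((B ∸ suc g) ℕ.* d)
        + binom B g * binom c g * poch g * q ^ ((B ∸ g) ℕ.* (suc c ∸ g))
        ≈⟨ +-cong (solve 6 (λ h x k p y z → h :* (x :* k) :* (p :* y) :* z := x :* k :* p :* z :* (y :* h))
             refl _ _ _ _ _ _)
             (*-congˡ (^-cong (≡.cong₂ ℕ._*_ (ℕ.m+n∸m≡n g e) (ℕ.+-∸-assoc 1 g≤c)))) ⟩
      q ^ d * binom c g * poch g * q ^ ((B ∸ suc g) ℕ.* d) * ((1# - q ^ suc g) * binom B (suc g))
        + binom B g * binom c g * poch g * q ^ (e ℕ.* suc d)
        ≈⟨ +-cong (*-congˡ (absorb-poch g e))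
             (*-congˡ (trans (^-cong (ℕ.*-suc e d)) (^-homo-* q e (e ℕ.* d)))) ⟩
      q ^ d * binom c g * poch g * q ^ ((B ∸ suc g) ℕ.* d) * ((1# - q ^ e) * binom B g)
        + binom B g * binom c g * poch g * (q ^ e * q ^ (e ℕ.* d))
        ≈⟨ +-congʳ (solve 6 (λ x k p z y h → x :* k :* p :* z :* (y :* h) := y :* (z :* x) :* (h :* k :* p))
             refl _ _ _ _ _ _) ⟩
      (1# - q ^ e) * (q ^ ((B ∸ suc g) ℕ.* d) * q ^ d) * (binom B g * binom c g * poch g)
        + binom B g * binom c g * poch g * (q ^ e * q ^ (e ℕ.* d))
        ≈⟨ +-congʳ (*-congʳ (lower e)) ⟩
      (1# - q ^ e) * q ^ (e ℕ.* d) * (binom B g * binom c g * poch g)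
        + binom B g * binom c g * poch g * (q ^ e * q ^ (e ℕ.* d))
        ≈⟨ solve 3 (λ x y p → (con (+ 1) :- x) :* y :* p :+ p :* (x :* y) := p :* y) refl _ _ _ ⟩
      binom B g * binom c g * poch g * q ^ (e ℕ.* d)
        ≈⟨ *-congˡ (^-cong (≡.cong (ℕ._* d) (ℕ.m+n∸m≡n g e))) ⟨
      binom B g * binom c g * poch g * q ^ ((B ∸ g) ℕ.* d) ∎
      where
      B = g ℕ.+ e
      d = c ∸ g
      -- At e = 0 the truncated subtraction falsifies the equation of exponents, but there the
      -- factor 1 - q^e is zero.
      lower : ∀ e → (1# - q ^ e) * (q ^ ((g ℕ.+ e ∸ suc g) ℕ.* d) * q ^ d) ≈ (1# - q ^ e) * q ^ (e ℕ.* d)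
      lower zero = trans (0*ˡ (-‿inverseʳ _)) (sym (0*ˡ (-‿inverseʳ _)))
      lower (suc e) = *-congˡ (begin
        q ^ ((g ℕ.+ suc e ∸ suc g) ℕ.* d) * q ^ d
          ≈⟨ *-congʳ (^-cong (≡.cong (ℕ._* d) (≡.trans (≡.cong (_∸ suc g) (ℕ.+-suc g e)) (ℕ.m+n∸m≡n g e)))) ⟩
        q ^ (e ℕ.* d) * q ^ d       ≈⟨ *-comm _ _ ⟩
        q ^ d * q ^ (e ℕ.* d)       ≈⟨ ^-homo-* q d (e ℕ.* d) ⟨
        q ^ (suc e ℕ.* d)           ∎)

  -- Expansions of binomials with top 2m + 1 or 2m against pairs of binomials

  binom₋₁ : ℕ → ℕ → Carrier
  binom₋₁ n zero    = 0#
  binom₋₁ n (suc k) = binom n k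

  -- This is `[n - 1 ; k - 1]`, set to zero wherever an index would be negative, so that the
  -- absorption rule below needs no side condition.
  binom₋₁₋₁ : ℕ → ℕ → Carrier
  binom₋₁₋₁ zero    k = 0#
  binom₋₁₋₁ (suc n) k = binom₋₁ n k

  []*binom₋₁₋₁ : ∀ n k → [ n ] * binom₋₁₋₁ n k ≈ [ k ] * binom n k
  []*binom₋₁₋₁ zero    zero    = trans (zeroˡ _) (sym (zeroˡ _))
  []*binom₋₁₋₁ zero    (suc k) = trans (zeroˡ _) (sym (zeroʳ _))
  []*binom₋₁₋₁ (suc n) zero    = trans (zeroʳ _) (sym (zeroˡ _))
  []*binom₋₁₋₁ (suc n) (suc k) = absorb-both n k

  -- Trinomial revision turns φ · [M ; x] into a multiple of B, which Vandermonde splits.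
  expansion : ∀ {φ u v B} (w : ℕ → ℕ) (G : ℕ → Carrier) y b N →
    φ * u ≈ v * B →
    B ≈ Σ< N (λ g → q ^ w g * (G g * binom b g)) →
    φ * (u * binom (y ℕ.+ b) y)
      ≈ Σ< N (λ g → v * (q ^ w g * binom (y ℕ.+ g) y) * (G g * binom (y ℕ.+ b) (y ℕ.+ g)))
  expansion {φ} {u} {v} {B} w G y b N rev sum = begin
    φ * (u * Y)
      ≈⟨ solve 3 (λ a b c → a :* (b :* c) := c :* (a :* b)) refl _ _ _ ⟩
    Y * (φ * u)
      ≈⟨ *-congˡ (trans rev (*-congˡ sum)) ⟩
    Y * (v * Σ< N (λ g → q ^ w g * (G g * binom b g)))
      ≈⟨ *-assoc _ _ _ ⟨
    Y * v * Σ< N (λ g → q ^ w g * (G g * binom b g))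
      ≈⟨ Σ<-* N (Y * v) _ ⟨
    Σ< N (λ g → Y * v * (q ^ w g * (G g * binom b g)))
      ≈⟨ Σ<-cong N (λ g _ → trans
           (solve 5 (λ y v w g b → y :* v :* (w :* (g :* b)) := v :* w :* g :* (y :* b)) refl _ _ _ _ _)
           (trans (*-congˡ (binom-revision′ y b g))
           (solve 5 (λ v w g y b → v :* w :* g :* (y :* b) := v :* (w :* y) :* (g :* b)) refl _ _ _ _ _))) ⟩
    Σ< N (λ g → v * (q ^ w g * binom (y ℕ.+ g) y) * (G g * binom (y ℕ.+ b) (y ℕ.+ g))) ∎
    where Y = binom (y ℕ.+ b) y

  vandermonde′ : ∀ x c b N → c ℕ.< N →
    binom (c ℕ.+ (b ℕ.+ x)) c
      ≈ Σ< N (λ g → q ^ (g ℕ.* (x ℕ.+ g)) * (binom (x ℕ.+ c) (x ℕ.+ g) * binom b g))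
  vandermonde′ x c b N c<N = begin
    binom (c ℕ.+ (b ℕ.+ x)) c          ≈⟨ binom-sym c (b ℕ.+ x) ⟩
    binom (c ℕ.+ (b ℕ.+ x)) (b ℕ.+ x)  ≈⟨ binom-cong (rearrange c b x) ≡.refl ⟩
    binom (b ℕ.+ (c ℕ.+ x)) (b ℕ.+ x)  ≈⟨ vandermonde b c x N c<N ⟨
    Σ< N (λ g → q ^ (g ℕ.* (x ℕ.+ g)) * (binom (c ℕ.+ x) (x ℕ.+ g) * binom b g))
      ≈⟨ Σ<-cong N (λ g _ → *-congˡ (*-congʳ (binom-cong (ℕ.+-comm c x) ≡.refl))) ⟩
    Σ< N (λ g → q ^ (g ℕ.* (x ℕ.+ g)) * (binom (x ℕ.+ c) (x ℕ.+ g) * binom b g)) ∎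
    where
    rearrange : ∀ c b x → c ℕ.+ (b ℕ.+ x) ≡ b ℕ.+ (c ℕ.+ x)
    rearrange = solve-∀

  expand-T : ∀ x c y b N {h} → c ℕ.< N → suc h ≡ b ℕ.+ c ℕ.+ (x ℕ.+ x) →
    binom (suc h) (x ℕ.+ c) * (binom (x ℕ.+ c) x * binom (y ℕ.+ b) y)
      ≈ Σ< N (λ g → binom (suc h) x * (q ^ (g ℕ.* (x ℕ.+ g)) * binom (y ℕ.+ g) y)
                      * (binom (x ℕ.+ c) (x ℕ.+ g) * binom (y ℕ.+ b) (y ℕ.+ g)))
  expand-T x c y b N {h} c<N h≡ = expansion (λ g → g ℕ.* (x ℕ.+ g)) (λ g → binom (x ℕ.+ c) (x ℕ.+ g)) y b N
    (trans (*-congʳ (binom-cong (≡.trans h≡ (e₁ x c b)) ≡.refl))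
      (trans (binom-revision x c (b ℕ.+ x)) (*-congʳ (binom-cong (≡.sym (≡.trans h≡ (e₂ x c b))) ≡.refl))))
    (vandermonde′ x c b N c<N)
    where
    e₁ : ∀ x c b → b ℕ.+ c ℕ.+ (x ℕ.+ x) ≡ x ℕ.+ c ℕ.+ (b ℕ.+ x)
    e₁ = solve-∀
    e₂ : ∀ x c b → b ℕ.+ c ℕ.+ (x ℕ.+ x) ≡ x ℕ.+ (c ℕ.+ (b ℕ.+ x))
    e₂ = solve-∀

  -- For x > 0 the revision is `[h ; x+c-1] [x+c-1 ; x-1] = [h ; x-1] [h-x+1 ; c]`. The last top is
  -- b + c + x, the same as for T, so the same Vandermonde sum leads to unshifted binomials. For x =
  -- 0 everything vanishes.
  expand-X₋₁ : ∀ x c y b N {h} → c ℕ.< N → suc h ≡ b ℕ.+ c ℕ.+ (x ℕ.+ x) →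
    binom₋₁ h (x ℕ.+ c) * (binom₋₁₋₁ (x ℕ.+ c) x * binom (y ℕ.+ b) y)
      ≈ Σ< N (λ g → binom₋₁ h x * (q ^ (g ℕ.* (x ℕ.+ g)) * binom (y ℕ.+ g) y)
                      * (binom (x ℕ.+ c) (x ℕ.+ g) * binom (y ℕ.+ b) (y ℕ.+ g)))
  expand-X₋₁ zero c y b N {h} c<N h≡ = expansion (λ g → g ℕ.* g) (λ g → binom c g) y b N
    (trans (vanish c) (sym (zeroˡ _)))
    (vandermonde′ 0 c b N c<N)
    where
    vanish : ∀ c → binom₋₁ h c * binom₋₁₋₁ c 0 ≈ 0#
    vanish zero    = zeroˡ _
    vanish (suc c) = zeroʳ _
  expand-X₋₁ (suc x) c y b N {h} c<N h≡ = expansion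
    (λ g → g ℕ.* (suc x ℕ.+ g)) (λ g → binom (suc x ℕ.+ c) (suc x ℕ.+ g)) y b N
    (trans (*-congʳ (binom-cong (ℕ.suc-injective (≡.trans h≡ (e₁ x c b))) ≡.refl))
      (trans (binom-revision x c (b ℕ.+ suc x))
        (*-congʳ (binom-cong (≡.sym (ℕ.suc-injective (≡.trans h≡ (e₂ x c b)))) ≡.refl))))
    (vandermonde′ (suc x) c b N c<N)
    where
    e₁ : ∀ x c b → b ℕ.+ c ℕ.+ (suc x ℕ.+ suc x) ≡ suc (x ℕ.+ c ℕ.+ (b ℕ.+ suc x))
    e₁ = solve-∀
    e₂ : ∀ x c b → b ℕ.+ c ℕ.+ (suc x ℕ.+ suc x) ≡ suc (x ℕ.+ (c ℕ.+ (b ℕ.+ suc x)))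
    e₂ = solve-∀

  -- Revision leaves `[h-x ; c]`, whose top b + c + x - 1 is one less than for T. Vandermonde must
  -- therefore be taken at x - 1, and this lowers both entries of one binomial. When x + c = 0 all
  -- lowered binomials are zero while the left side is `binom (y + b) y`, hence the positivity
  -- condition.
  expand-X : ∀ x c y b N {h} → c ℕ.< N → b ℕ.< N → 0 ℕ.< x ℕ.+ c → suc h ≡ b ℕ.+ c ℕ.+ (x ℕ.+ x) →
    binom h (x ℕ.+ c) * (binom (x ℕ.+ c) x * binom (y ℕ.+ b) y)
      ≈ Σ< N (λ g → binom h x * (q ^ (g ℕ.* (x ℕ.+ g ∸ 1)) * binom (y ℕ.+ g) y)
                      * (binom₋₁₋₁ (x ℕ.+ c) (x ℕ.+ g) * binom (y ℕ.+ b) (y ℕ.+ g)))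
  expand-X (suc x) c y b N {h} c<N _ _ h≡ = expansion
    (λ g → g ℕ.* (x ℕ.+ g)) (λ g → binom (x ℕ.+ c) (x ℕ.+ g)) y b N
    (trans (*-congʳ (binom-cong (ℕ.suc-injective (≡.trans h≡ (e₁ x c b))) ≡.refl))
      (trans (binom-revision (suc x) c (b ℕ.+ x))
        (*-congʳ (binom-cong (≡.sym (ℕ.suc-injective (≡.trans h≡ (e₂ x c b)))) ≡.refl))))
    (vandermonde′ x c b N c<N)
    where
    e₁ : ∀ x c b → b ℕ.+ c ℕ.+ (suc x ℕ.+ suc x) ≡ suc (suc x ℕ.+ c ℕ.+ (b ℕ.+ x))
    e₁ = solve-∀
    e₂ : ∀ x c b → b ℕ.+ c ℕ.+ (suc x ℕ.+ suc x) ≡ suc (suc x ℕ.+ (c ℕ.+ (b ℕ.+ x)))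
    e₂ = solve-∀
  -- There is no x - 1 here. The term g = 0 vanishes, and after g is shifted by one the sum is
  -- Vandermonde with b and c in exchanged roles.
  expand-X zero (suc c) y b (suc N) {h} _ b<N _ h≡ = expansion {B = binom h (suc c)}
    (λ g → g ℕ.* (g ∸ 1)) (λ g → binom₋₁ c g) y b (suc N)
    (trans (*-comm _ _) (*-congʳ (sym (binom-0 h))))
    (sym (trans (+-cong (0*ʳ (zeroˡ _)) refl) (trans (+-identityˡ _) (tail b b<N h≡))))
    where
    tail : ∀ b → b ℕ.< suc N → suc h ≡ b ℕ.+ suc c ℕ.+ 0 →
      Σ< N (λ g → q ^ (suc g ℕ.* g) * (binom c g * binom b (suc g))) ≈ binom h (suc c)
    tail zero _ h≡ = trans (Σ<-zero N (λ g _ → 0*ʳ (zeroʳ _)))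
      (sym (binom-< (ℕ.≤-reflexive (≡.trans h≡ (ℕ.+-identityʳ _)))))
    tail (suc b) (s≤s b<N) h≡ = begin
      Σ< N (λ g → q ^ (suc g ℕ.* g) * (binom c g * binom (suc b) (suc g)))
        ≈⟨ Σ<-cong N (λ g _ → *-cong (^-cong (ℕ.*-comm (suc g) g))
             (trans (*-comm _ _) (*-cong (binom-cong (ℕ.+-comm 1 b) ≡.refl) refl))) ⟩
      Σ< N (λ g → q ^ (g ℕ.* suc g) * (binom (b ℕ.+ 1) (suc g) * binom c g))
        ≈⟨ vandermonde c b 1 N b<N ⟩
      binom (c ℕ.+ (b ℕ.+ 1)) (c ℕ.+ 1)
        ≈⟨ binom-cong (ℕ.suc-injective (≡.trans (e c b) (≡.sym h≡))) (ℕ.+-comm c 1) ⟩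
      binom h (suc c) ∎
      where
      e : ∀ c b → suc (c ℕ.+ (b ℕ.+ 1)) ≡ suc b ℕ.+ suc c ℕ.+ 0
      e = solve-∀

  -- With the reflected lower indices this vanishes for k > a without a case distinction.
  ballot′ : ℕ → ℕ → Carrier
  ballot′ a k = binom (2 ℕ.* a) (a ℕ.+ k) - binom (2 ℕ.* a) (suc (a ℕ.+ k))

  ballot′-reflect : ∀ m k → k ℕ.≤ m →
    binom (2 ℕ.* m) (m ∸ k) - binom₋₁ (2 ℕ.* m) (m ∸ k) ≈ ballot′ m k
  ballot′-reflect m k k≤m = +-cong
    (trans (binom-cong (≡.sym 2m≡) ≡.refl) (trans (binom-sym i (m ℕ.+ k)) (binom-cong 2m≡ ≡.refl)))
    (-‿cong (lower-sym i 2m≡))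
    where
    i = m ∸ k
    2m≡ : i ℕ.+ (m ℕ.+ k) ≡ 2 ℕ.* m
    2m≡ = ≡.trans (e i m k)
      (≡.cong (m ℕ.+_) (≡.trans (ℕ.m∸n+n≡m k≤m) (≡.sym (ℕ.+-identityʳ m))))
      where
      e : ∀ i m k → i ℕ.+ (m ℕ.+ k) ≡ m ℕ.+ (i ℕ.+ k)
      e = solve-∀
    lower-sym : ∀ i → i ℕ.+ (m ℕ.+ k) ≡ 2 ℕ.* m → binom₋₁ (2 ℕ.* m) i ≈ binom (2 ℕ.* m) (suc (m ℕ.+ k))
    lower-sym zero    eq = sym (binom-< (s≤s (ℕ.≤-reflexive (≡.sym eq))))
    lower-sym (suc i) eq = trans (binom-cong (≡.sym eq′) ≡.refl)
      (trans (binom-sym i (suc (m ℕ.+ k))) (binom-cong eq′ ≡.refl))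
      where
      eq′ : i ℕ.+ suc (m ℕ.+ k) ≡ 2 ℕ.* m
      eq′ = ≡.trans (ℕ.+-suc i _) eq

data Even : ℕ → Set where
  zero : Even 0
  2+_  : ∀ {n} → Even n → Even (suc (suc n))

-- The lattice spanned by the kernels E

module Divisibility
  (R : CommutativeRing 0ℓ 0ℓ) (q q⁻¹ : CommutativeRing.Carrier R)
  (regular : QNumbers.Regular R q)
  (q⁻¹*q≈1 : QNumbers.IsInverse R q q⁻¹)
  (m n : ℕ)
  where

  open CommutativeRing R hiding (zero)
  open QNumbers R q
  open import Algebra.Properties.Semiring.Exp semiring using (_^_; ^-homo-*; ^-congˡ; ^-assocʳ)
  open import Algebra.Properties.CommutativeSemiring.Exp commutativeSemiring using (^-distrib-*)
  open IntegerCoefficients R using (solve; con; _:=_; _:+_; _:*_; _:-_; :-_)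
  open Binomials R q regular
  open import Relation.Binary.Reasoning.Setoid setoid

  q⁻^*q^≈1 : ∀ k → q⁻¹ ^ k * q ^ k ≈ 1#
  q⁻^*q^≈1 zero    = *-identityˡ _
  q⁻^*q^≈1 (suc k) = begin
    q⁻¹ * q⁻¹ ^ k * (q * q ^ k)  ≈⟨ solve 4 (λ a b c d → a :* b :* (c :* d) := a :* c :* (b :* d)) refl _ _ _ _ ⟩
    q⁻¹ * q * (q⁻¹ ^ k * q ^ k)  ≈⟨ *-cong q⁻¹*q≈1 (q⁻^*q^≈1 k) ⟩
    1# * 1#                      ≈⟨ *-identityˡ _ ⟩
    1#                           ∎

  q⁻^-move : ∀ k {x y} → q ^ k * x ≈ y → x ≈ q⁻¹ ^ k * y
  q⁻^-move k {x} {y} eq = begin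
    x                         ≈⟨ *-identityˡ _ ⟨
    1# * x                    ≈⟨ *-congʳ (q⁻^*q^≈1 k) ⟨
    q⁻¹ ^ k * q ^ k * x       ≈⟨ *-assoc _ _ _ ⟩
    q⁻¹ ^ k * (q ^ k * x)     ≈⟨ *-congˡ eq ⟩
    q⁻¹ ^ k * y               ∎

  -- Each kernel is Γ times a product [m - k ; x] [n + k + 1 ; y], whose factors are indexed by true
  -- and false, so that the operators belonging to m and to n are treated together.  If
  -- x + n = y + m, it is up to a factor independent of k equal to 1 / ([l - k]! [l + k + 1]!), where
  -- l = m - x = n - y.
  size : Bool → ℕ
  size true  = m
  size false = n

  -- The two bottoms add up to m + n + 1, so the denominator of `Γ k` cancels against the numerators
  -- of the two binomials in `B`. On the side of n the larger bottom is taken because n - k would be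
  -- negative for n < k ≤ m.
  M : Bool → ℕ → ℕ
  M true  k = m ∸ k
  M false k = suc (n ℕ.+ k)

  Index : Set
  Index = Bool → ℕ

  _⊞_ : Index → ℕ → Index
  (p ⊞ g) s = p s ℕ.+ g

  Admissible : Index → Set
  Admissible p = p true ℕ.+ n ≡ p false ℕ.+ m

  Γ : ℕ → Carrier
  Γ k = binom (suc (m ℕ.+ n)) (m ∸ k)

  B : Index → ℕ → Carrier
  B p k = binom (M true k) (p true) * binom (M false k) (p false)

  E : Index → ℕ → Carrier
  E p k = Γ k * B p k

  -- Functions are compared for k ≤ m only: beyond, the truncated m ∸ k has no meaning.
  infixl 6 _⊕_
  data Span : (ℕ → Carrier) → Set where
    gen   : ∀ p → Admissible p → Span (E p)
    null  : Span (λ _ → 0#)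
    _⊕_   : ∀ {F G} → Span F → Span G → Span (λ k → F k + G k)
    scale : ∀ a {F} → Span F → Span (λ k → a * F k)
    resp  : ∀ {F G} → (∀ k → k ℕ.≤ m → F k ≈ G k) → Span F → Span G

  spanΣ : ∀ N {F : ℕ → ℕ → Carrier} → (∀ g → Span (F g)) → Span (λ k → Σ< N (λ g → F g k))
  spanΣ zero    F∈ = null
  spanΣ (suc N) F∈ = F∈ 0 ⊕ spanΣ N (λ g → F∈ (suc g))

  ⊞-admissible : ∀ p g → Admissible p → Admissible (p ⊞ g)
  ⊞-admissible p g adm = ≡.trans (swap _ g n) (≡.trans (≡.cong (ℕ._+ g) adm) (≡.sym (swap _ g m)))
    where
    swap : ∀ a b c → a ℕ.+ b ℕ.+ c ≡ a ℕ.+ c ℕ.+ b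
    swap = solve-∀

  -- A bound for the ranges of all expansions, abstract so that Σ< N does not unfold.
  abstract
    N : ℕ
    N = suc (suc (m ℕ.+ n))

    <N : ∀ {d} → d ℕ.≤ suc (m ℕ.+ n) → d ℕ.< N
    <N = s≤s

  -- Coordinates on the support of a kernel: `d true` is l - k and `d false` is l + k + 1, so that
  -- subtractions become sums. `2size` expresses that the two add up to 2l + 1, which is what
  -- Vandermonde requires.
  record Cell (p : Index) (k : ℕ) : Set where
    field
      d       : Bool → ℕ
      M≡      : ∀ s → M s k ≡ p s ℕ.+ d s
      2size   : ∀ s → suc (2 ℕ.* size s) ≡ d (not s) ℕ.+ d s ℕ.+ (p s ℕ.+ p s)
      d<      : ∀ s → d s ℕ.< N
      d-false : d false ≡ d true ℕ.+ suc (k ℕ.+ k)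
      top     : m ∸ p true ≡ k ℕ.+ d true

  cell : ∀ p k → Admissible p → k ℕ.≤ m → Cell p k ⊎ M true k ℕ.< p true
  cell p k adm k≤m with ℕ.≤-<-connex (p true) (m ∸ k)
  ... | inj₂ M<x = inj₂ M<x
  ... | inj₁ x≤M with ℕ.m≤n⇒∃[o]m+o≡n x≤M
  ...   | c , x+c≡M = inj₁ record
    { d = d ; M≡ = M≡ ; 2size = 2size ; d< = d< ; d-false = ≡.refl
    ; top = ≡.trans (≡.cong (_∸ x) (≡.trans m≡ (e₀ k x c))) (ℕ.m+n∸m≡n x _) }
    where
    x = p true
    y = p false
    d : Bool → ℕ
    d true  = c
    d false = c ℕ.+ suc (k ℕ.+ k)
    m≡ : m ≡ k ℕ.+ (x ℕ.+ c)
    m≡ = ≡.trans (≡.sym (ℕ.m+[n∸m]≡n k≤m)) (≡.cong (k ℕ.+_) (≡.sym x+c≡M))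
    e₀ : ∀ k x c → k ℕ.+ (x ℕ.+ c) ≡ x ℕ.+ (k ℕ.+ c)
    e₀ = solve-∀
    n≡ : n ≡ y ℕ.+ (k ℕ.+ c)
    n≡ = ℕ.+-cancelˡ-≡ x _ _ (≡.trans adm (≡.trans (≡.cong (y ℕ.+_) m≡) (e y k x c)))
      where
      e : ∀ y k x c → y ℕ.+ (k ℕ.+ (x ℕ.+ c)) ≡ x ℕ.+ (y ℕ.+ (k ℕ.+ c))
      e = solve-∀
    M≡ : ∀ s → M s k ≡ p s ℕ.+ d s
    M≡ true  = ≡.sym x+c≡M
    M≡ false = ≡.trans (≡.cong (λ n → suc (n ℕ.+ k)) n≡) (e y k c)
      where
      e : ∀ y k c → suc (y ℕ.+ (k ℕ.+ c) ℕ.+ k) ≡ y ℕ.+ (c ℕ.+ suc (k ℕ.+ k))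
      e = solve-∀
    2size : ∀ s → suc (2 ℕ.* size s) ≡ d (not s) ℕ.+ d s ℕ.+ (p s ℕ.+ p s)
    2size true = ≡.trans (≡.cong (λ m → suc (2 ℕ.* m)) m≡) (e x k c)
      where
      e : ∀ x k c → suc (2 ℕ.* (k ℕ.+ (x ℕ.+ c))) ≡ c ℕ.+ suc (k ℕ.+ k) ℕ.+ c ℕ.+ (x ℕ.+ x)
      e = solve-∀
    2size false = ≡.trans (≡.cong (λ n → suc (2 ℕ.* n)) n≡) (e y k c)
      where
      e : ∀ y k c → suc (2 ℕ.* (y ℕ.+ (k ℕ.+ c))) ≡ c ℕ.+ (c ℕ.+ suc (k ℕ.+ k)) ℕ.+ (y ℕ.+ y)
      e = solve-∀
    d< : ∀ s → d s ℕ.< N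
    d< true = <N (ℕ.m≤n⇒m≤1+n (ℕ.≤-trans
      (ℕ.≤-trans (ℕ.m≤n+m c (k ℕ.+ x)) (ℕ.≤-reflexive (≡.trans (ℕ.+-assoc k x c) (≡.sym m≡))))
      (ℕ.m≤m+n m n)))
    d< false = <N (ℕ.≤-trans (ℕ.m≤n+m _ y) (ℕ.≤-trans (ℕ.≤-reflexive (≡.sym (M≡ false)))
      (s≤s (ℕ.≤-trans (ℕ.≤-reflexive (ℕ.+-comm n k)) (ℕ.+-monoˡ-≤ n k≤m)))))

  B-side : ∀ s p k → B p k ≈ binom (M s k) (p s) * binom (M (not s) k) (p (not s))
  B-side true  p k = refl
  B-side false p k = *-comm _ _

  B-vanish : ∀ p k → M true k ℕ.< p true → B p k ≈ 0#
  B-vanish p k M<x = 0*ˡ (binom-< M<x)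

  ⊞-vanish : ∀ p k → M true k ℕ.< p true → ∀ g → B (p ⊞ g) k ≈ 0#
  ⊞-vanish p k M<x g = B-vanish (p ⊞ g) k (ℕ.<-≤-trans M<x (ℕ.m≤m+n _ g))

  -- An expansion proved separately at each k gives membership in the span because `coef` cannot
  -- depend on k. Off the cells both sides are zero.
  expand-span : ∀ {U : ℕ → Carrier} {H : ℕ → ℕ → Carrier} p → Admissible p →
    (coef : ℕ → Carrier) →
    (∀ g → Span (λ k → Γ k * H g k)) →
    (∀ k → M true k ℕ.< p true → U k ≈ 0#) →
    (∀ k → M true k ℕ.< p true → ∀ g → H g k ≈ 0#) →
    (∀ k → Cell p k → U k ≈ Σ< N (λ g → coef g * H g k)) →
    Span (λ k → Γ k * U k)
  expand-span {U} {H} p adm coef H∈ U≈0 H≈0 expand =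
    resp pointwise (spanΣ N (λ g → scale (coef g) (H∈ g)))
    where
    expand′ : ∀ k → k ℕ.≤ m → U k ≈ Σ< N (λ g → coef g * H g k)
    expand′ k k≤m with cell p k adm k≤m
    ... | inj₁ c = expand k c
    ... | inj₂ M<x = trans (U≈0 k M<x) (sym (Σ<-zero N (λ g _ → 0*ʳ (H≈0 k M<x g))))
    pointwise : ∀ k → k ℕ.≤ m → Σ< N (λ g → coef g * (Γ k * H g k)) ≈ Γ k * U k
    pointwise k k≤m = begin
      Σ< N (λ g → coef g * (Γ k * H g k))
        ≈⟨ Σ<-cong N (λ g _ → solve 3 (λ a b c → a :* (b :* c) := b :* (a :* c)) refl _ _ _) ⟩
      Σ< N (λ g → Γ k * (coef g * H g k))
        ≈⟨ Σ<-* N (Γ k) (λ g → coef g * H g k) ⟩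
      Γ k * Σ< N (λ g → coef g * H g k)
        ≈⟨ *-congˡ (expand′ k k≤m) ⟨
      Γ k * U k ∎

  expand-E : ∀ {φ : ℕ → Carrier} p → Admissible p → (coef : ℕ → Carrier) →
    (∀ k → Cell p k → φ k * B p k ≈ Σ< N (λ g → coef g * B (p ⊞ g) k)) →
    Span (λ k → φ k * E p k)
  expand-E p adm coef expand =
    resp (λ k _ → solve 3 (λ a b c → a :* (b :* c) := b :* (a :* c)) refl _ _ _)
      (expand-span p adm coef (λ g → gen (p ⊞ g) (⊞-admissible p g adm))
        (λ k M<x → 0*ʳ (B-vanish p k M<x)) (λ k → ⊞-vanish p k) expand)

  Preserves : (ℕ → Carrier) → Set
  Preserves φ = ∀ {F} → Span F → Span (λ k → φ k * F k)

  preserves-gen : ∀ {φ} → (∀ p → Admissible p → Span (λ k → φ k * E p k)) → Preserves φ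
  preserves-gen φE∈ (gen p adm) = φE∈ p adm
  preserves-gen φE∈ null = resp (λ k _ → sym (zeroʳ _)) null
  preserves-gen φE∈ (F∈ ⊕ G∈) =
    resp (λ k _ → sym (distribˡ _ _ _)) (preserves-gen φE∈ F∈ ⊕ preserves-gen φE∈ G∈)
  preserves-gen φE∈ (scale a F∈) =
    resp (λ k _ → solve 3 (λ a b c → a :* (b :* c) := b :* (a :* c)) refl _ _ _)
      (scale a (preserves-gen φE∈ F∈))
  preserves-gen φE∈ (resp F≈G F∈) =
    resp (λ k k≤m → *-congˡ (F≈G k k≤m)) (preserves-gen φE∈ F∈)

  preserves-resp : ∀ {φ ψ} → (∀ k → k ℕ.≤ m → φ k ≈ ψ k) → Preserves φ → Preserves ψ
  preserves-resp φ≈ψ φ-pres F∈ = resp (λ k k≤m → *-congʳ (φ≈ψ k k≤m)) (φ-pres F∈)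

  preserves-const : ∀ a → Preserves (λ _ → a)
  preserves-const a = scale a

  preserves-+ : ∀ {φ ψ} → Preserves φ → Preserves ψ → Preserves (λ k → φ k + ψ k)
  preserves-+ φ-pres ψ-pres F∈ = resp (λ k _ → sym (distribʳ _ _ _)) (φ-pres F∈ ⊕ ψ-pres F∈)

  preserves-* : ∀ {φ ψ} → Preserves φ → Preserves ψ → Preserves (λ k → φ k * ψ k)
  preserves-* φ-pres ψ-pres F∈ = resp (λ k _ → sym (*-assoc _ _ _)) (φ-pres (ψ-pres F∈))

  preserves-^ : ∀ {φ} j → Preserves φ → Preserves (λ k → φ k ^ j)
  preserves-^ zero    φ-pres = preserves-const 1#
  preserves-^ (suc j) φ-pres = preserves-* φ-pres (preserves-^ j φ-pres)

  -- Multipliers made of T, X and X₋₁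

  T X X₋₁ : Bool → ℕ → Carrier
  T   s k = binom (suc (2 ℕ.* size s)) (M s k)
  X   s k = binom (2 ℕ.* size s) (M s k)
  X₋₁ s k = binom₋₁ (2 ℕ.* size s) (M s k)

  T-preserves : ∀ s → Preserves (T s)
  T-preserves s = preserves-gen λ p adm →
    expand-E p adm
      (λ g → binom (suc (2 ℕ.* size s)) (p s)
               * (q ^ (g ℕ.* (p s ℕ.+ g)) * binom (p (not s) ℕ.+ g) (p (not s))))
      λ k c → let open Cell c in begin
        T s k * B p k
          ≈⟨ *-congˡ (B-side s p k) ⟩
        T s k * (binom (M s k) (p s) * binom (M (not s) k) (p (not s)))
          ≡⟨ ≡.cong₂ (λ a b → binom (suc (2 ℕ.* size s)) a * (binom a (p s) * binom b (p (not s))))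
               (M≡ s) (M≡ (not s)) ⟩
        binom (suc (2 ℕ.* size s)) (p s ℕ.+ d s)
          * (binom (p s ℕ.+ d s) (p s) * binom (p (not s) ℕ.+ d (not s)) (p (not s)))
          ≈⟨ expand-T (p s) (d s) (p (not s)) (d (not s)) N (d< s) (2size s) ⟩
        Σ< N (λ g → binom (suc (2 ℕ.* size s)) (p s)
               * (q ^ (g ℕ.* (p s ℕ.+ g)) * binom (p (not s) ℕ.+ g) (p (not s)))
               * (binom (p s ℕ.+ d s) (p s ℕ.+ g)
                    * binom (p (not s) ℕ.+ d (not s)) (p (not s) ℕ.+ g)))
          ≈⟨ Σ<-cong N (λ g _ → *-congˡ (sym (trans (B-side s (p ⊞ g) k)
               (*-cong (binom-cong (M≡ s) ≡.refl) (binom-cong (M≡ (not s)) ≡.refl))))) ⟩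
        Σ< N (λ g → binom (suc (2 ℕ.* size s)) (p s)
               * (q ^ (g ℕ.* (p s ℕ.+ g)) * binom (p (not s) ℕ.+ g) (p (not s)))
               * B (p ⊞ g) k) ∎

  -- X sends kernels to combinations of the shifted kernels Γ · B₋, and X₋₁ sends these back;
  -- neither of the two factors preserves the span on its own.
  B₋ : Bool → Index → ℕ → Carrier
  B₋ s p k = binom₋₁₋₁ (M s k) (p s) * binom (M (not s) k) (p (not s))

  X-coef : Bool → Index → ℕ → Carrier
  X-coef s p g = binom (2 ℕ.* size s) (p s)
    * (q ^ (g ℕ.* (p s ℕ.+ g ∸ 1)) * binom (p (not s) ℕ.+ g) (p (not s)))

  X-expand : ∀ s p k → Cell p k → 0 ℕ.< M s k →
    X s k * B p k ≈ Σ< N (λ g → X-coef s p g * B₋ s (p ⊞ g) k)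
  X-expand s p k c 0<M = let open Cell c in begin
    X s k * B p k
      ≈⟨ *-congˡ (B-side s p k) ⟩
    X s k * (binom (M s k) (p s) * binom (M (not s) k) (p (not s)))
      ≡⟨ ≡.cong₂ (λ a b → binom (2 ℕ.* size s) a * (binom a (p s) * binom b (p (not s))))
           (M≡ s) (M≡ (not s)) ⟩
    binom (2 ℕ.* size s) (p s ℕ.+ d s)
      * (binom (p s ℕ.+ d s) (p s) * binom (p (not s) ℕ.+ d (not s)) (p (not s)))
      ≈⟨ expand-X (p s) (d s) (p (not s)) (d (not s)) N (d< s) (d< (not s))
           (≡.subst (0 ℕ.<_) (M≡ s) 0<M) (2size s) ⟩
    Σ< N (λ g → X-coef s p g
           * (binom₋₁₋₁ (p s ℕ.+ d s) (p s ℕ.+ g)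
                * binom (p (not s) ℕ.+ d (not s)) (p (not s) ℕ.+ g)))
      ≈⟨ Σ<-cong N (λ g _ → *-congˡ (sym (*-cong
           (reflexive (≡.cong (λ a → binom₋₁₋₁ a (p s ℕ.+ g)) (M≡ s))) (binom-cong (M≡ (not s)) ≡.refl)))) ⟩
    Σ< N (λ g → X-coef s p g * B₋ s (p ⊞ g) k) ∎

  -- Absorption: the factor [M] undoes the lowering of both entries, which is why [M] X is a
  -- multiplier.
  []B₋ : ∀ s p k → [ M s k ] * B₋ s p k ≈ [ p s ] * B p k
  []B₋ s p k = trans (sym (*-assoc _ _ _)) (trans (*-congʳ ([]*binom₋₁₋₁ (M s k) (p s)))
    (trans (*-assoc _ _ _) (*-congˡ (sym (B-side s p k)))))

  [M]X-preserves : ∀ s → Preserves (λ k → [ M s k ] * X s k)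
  [M]X-preserves s = preserves-gen λ p adm →
    expand-E p adm (λ g → X-coef s p g * [ p s ℕ.+ g ]) λ k c → expand p k c (M s k) ≡.refl
    where
    expand : ∀ p k → Cell p k → ∀ a → M s k ≡ a → [ M s k ] * X s k * B p k
      ≈ Σ< N (λ g → X-coef s p g * [ p s ℕ.+ g ] * B (p ⊞ g) k)
    expand p k c zero M≡0 = trans (*-congʳ (0*ˡ [M]≈0)) (trans (zeroˡ _) (sym (Σ<-zero N λ g _ →
      trans (*-assoc _ _ _) (0*ʳ (trans (sym ([]B₋ s (p ⊞ g) k)) (0*ˡ [M]≈0))))))
      where
      [M]≈0 : [ M s k ] ≈ 0#
      [M]≈0 = reflexive (≡.cong [_] M≡0)
    expand p k c (suc a) M≡1+ = begin
      [ M s k ] * X s k * B p k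
        ≈⟨ *-assoc _ _ _ ⟩
      [ M s k ] * (X s k * B p k)
        ≈⟨ *-congˡ (X-expand s p k c (≡.subst (0 ℕ.<_) (≡.sym M≡1+) ℕ.z<s)) ⟩
      [ M s k ] * Σ< N (λ g → X-coef s p g * B₋ s (p ⊞ g) k)
        ≈⟨ Σ<-* N [ M s k ] (λ g → X-coef s p g * B₋ s (p ⊞ g) k) ⟨
      Σ< N (λ g → [ M s k ] * (X-coef s p g * B₋ s (p ⊞ g) k))
        ≈⟨ Σ<-cong N (λ g _ → trans (solve 3 (λ a b c → a :* (b :* c) := b :* (a :* c)) refl _ _ _)
             (trans (*-congˡ ([]B₋ s (p ⊞ g) k)) (sym (*-assoc _ _ _)))) ⟩
      Σ< N (λ g → X-coef s p g * [ p s ℕ.+ g ] * B (p ⊞ g) k) ∎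

  B₋-vanish : ∀ s p k → M true k ℕ.< p true → B₋ s p k ≈ 0#
  B₋-vanish true  p k M<x = 0*ˡ (vanish (m ∸ k) (p true) M<x)
    where
    vanish : ∀ a x → a ℕ.< x → binom₋₁₋₁ a x ≈ 0#
    vanish zero    x       _         = refl
    vanish (suc a) (suc x) (s≤s a<x) = binom-< a<x
  B₋-vanish false p k M<x = 0*ʳ (binom-< M<x)

  X₋₁B₋∈ : ∀ s p → Admissible p → Span (λ k → Γ k * (X₋₁ s k * B₋ s p k))
  X₋₁B₋∈ s p adm = expand-span p adm
    (λ g → binom₋₁ (2 ℕ.* size s) (p s)
             * (q ^ (g ℕ.* (p s ℕ.+ g)) * binom (p (not s) ℕ.+ g) (p (not s))))
    (λ g → gen (p ⊞ g) (⊞-admissible p g adm))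
    (λ k M<x → 0*ʳ (B₋-vanish s p k M<x)) (λ k → ⊞-vanish p k)
    λ k c → let open Cell c in begin
      X₋₁ s k * B₋ s p k
        ≡⟨ ≡.cong₂ (λ a b → binom₋₁ (2 ℕ.* size s) a * (binom₋₁₋₁ a (p s) * binom b (p (not s))))
             (M≡ s) (M≡ (not s)) ⟩
      binom₋₁ (2 ℕ.* size s) (p s ℕ.+ d s)
        * (binom₋₁₋₁ (p s ℕ.+ d s) (p s) * binom (p (not s) ℕ.+ d (not s)) (p (not s)))
        ≈⟨ expand-X₋₁ (p s) (d s) (p (not s)) (d (not s)) N (d< s) (2size s) ⟩
      Σ< N (λ g → binom₋₁ (2 ℕ.* size s) (p s)
             * (q ^ (g ℕ.* (p s ℕ.+ g)) * binom (p (not s) ℕ.+ g) (p (not s)))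
             * (binom (p s ℕ.+ d s) (p s ℕ.+ g)
                  * binom (p (not s) ℕ.+ d (not s)) (p (not s) ℕ.+ g)))
        ≈⟨ Σ<-cong N (λ g _ → *-congˡ (sym (trans (B-side s (p ⊞ g) k)
             (*-cong (binom-cong (M≡ s) ≡.refl) (binom-cong (M≡ (not s)) ≡.refl))))) ⟩
      Σ< N (λ g → binom₋₁ (2 ℕ.* size s) (p s)
             * (q ^ (g ℕ.* (p s ℕ.+ g)) * binom (p (not s) ℕ.+ g) (p (not s)))
             * B (p ⊞ g) k) ∎

  X₋₁X-preserves : ∀ s → Preserves (λ k → X₋₁ s k * X s k)
  X₋₁X-preserves s = preserves-gen λ p adm →
    resp (λ k _ → solve 4 (λ a b c d → a :* (b :* (c :* d)) := b :* c :* (a :* d)) refl _ _ _ _)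
      (expand-span p adm (X-coef s p) (λ g → X₋₁B₋∈ s (p ⊞ g) (⊞-admissible p g adm))
        (λ k M<x → 0*ʳ (0*ʳ (B-vanish p k M<x)))
        (λ k M<x g → 0*ʳ (B₋-vanish s (p ⊞ g) k (ℕ.<-≤-trans M<x (ℕ.m≤m+n _ g))))
        λ k c → expand p k c (M s k) ≡.refl)
    where
    expand : ∀ p k → Cell p k → ∀ a → M s k ≡ a → X₋₁ s k * (X s k * B p k)
      ≈ Σ< N (λ g → X-coef s p g * (X₋₁ s k * B₋ s (p ⊞ g) k))
    -- Again M = 0 is outside `X-expand`; now `X₋₁`, whose lower index would be -1, is the factor
    -- that vanishes.
    expand p k c zero M≡0 = trans (0*ˡ X₋₁≈0) (sym (Σ<-zero N λ g _ → 0*ʳ (0*ˡ X₋₁≈0)))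
      where
      X₋₁≈0 : X₋₁ s k ≈ 0#
      X₋₁≈0 = reflexive (≡.cong (binom₋₁ (2 ℕ.* size s)) M≡0)
    expand p k c (suc a) M≡1+ = begin
      X₋₁ s k * (X s k * B p k)
        ≈⟨ *-congˡ (X-expand s p k c (≡.subst (0 ℕ.<_) (≡.sym M≡1+) ℕ.z<s)) ⟩
      X₋₁ s k * Σ< N (λ g → X-coef s p g * B₋ s (p ⊞ g) k)
        ≈⟨ Σ<-* N (X₋₁ s k) (λ g → X-coef s p g * B₋ s (p ⊞ g) k) ⟨
      Σ< N (λ g → X₋₁ s k * (X-coef s p g * B₋ s (p ⊞ g) k))
        ≈⟨ Σ<-cong N (λ g _ → solve 3 (λ a b c → a :* (b :* c) := b :* (a :* c)) refl _ _ _) ⟩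
      Σ< N (λ g → X-coef s p g * (X₋₁ s k * B₋ s (p ⊞ g) k)) ∎

  -- Multipliers that are polynomials in ν

  -- ν is the q-analogue of k (k + 1). Both w and S² are polynomials in it with constant
  -- coefficients, the latter generalising (2k + 1)² = 1 + 4 k (k + 1), so only ν has to be shown to
  -- act on the span.
  S w ν : ℕ → Carrier
  S k = q⁻¹ ^ k * [ suc (k ℕ.+ k) ]
  w k = q⁻¹ ^ k + q ^ suc k
  ν k = q⁻¹ ^ k * ([ k ] * [ suc k ])

  [1+2k] : ∀ k → [ suc (k ℕ.+ k) ] ≈ 1# + q * ([ k ] + q ^ k * [ k ])
  [1+2k] k = +-congˡ (*-congˡ ([+] k k))

  w≈ : ∀ k → w k ≈ 1# + q + (1# - q) * (1# - q) * ν k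
  w≈ k = begin
    a + q * u                                ≈⟨ +-congˡ (*-congˡ (*-identityˡ u)) ⟨
    a + q * (1# * u)                         ≈⟨ +-congˡ (*-congˡ (*-congʳ au≈1)) ⟨
    a + q * (a * u * u)
      ≈⟨ solve 3 (λ a q u → a :+ q :* (a :* u :* u) := a :* (con (+ 1) :+ q :* (u :* u))) refl a q u ⟩
    a * (1# + q * (u * u))                   ≈⟨ *-congˡ (+-congˡ (*-congˡ (*-cong (^≈1-[] k) (^≈1-[] k)))) ⟩
    a * (1# + q * ((1# - (1# - q) * U) * (1# - (1# - q) * U)))
      ≈⟨ solve 3 (λ a q U → let i = con (+ 1); v = i :- (i :- q) :* U in
           a :* (i :+ q :* (v :* v))
             := (i :+ q) :* (a :* v) :+ (i :- q) :* (i :- q) :* (a :* (U :* (i :+ q :* U)))) refl a q U ⟩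
    (1# + q) * (a * (1# - (1# - q) * U)) + (1# - q) * (1# - q) * ν k
      ≈⟨ +-congʳ (*-congˡ (*-congˡ (^≈1-[] k))) ⟨
    (1# + q) * (a * u) + (1# - q) * (1# - q) * ν k
      ≈⟨ +-congʳ (trans (*-congˡ au≈1) (*-identityʳ _)) ⟩
    1# + q + (1# - q) * (1# - q) * ν k       ∎
    where
    a = q⁻¹ ^ k
    u = q ^ k
    U = [ k ]
    au≈1 : a * u ≈ 1#
    au≈1 = q⁻^*q^≈1 k

  S²≈ : ∀ k → S k * S k ≈ 1# + (1# + 1#) * (1# + q) * ν k + (1# - q) * (1# - q) * (ν k * ν k)
  S²≈ k = begin
    S k * S k
      ≈⟨ *-cong (*-congˡ S′) (*-congˡ S′) ⟩
    a * (1# + q * (U + v * U)) * (a * (1# + q * (U + v * U)))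
      ≈⟨ solve 3 (λ a q U → let i = con (+ 1); v = i :- (i :- q) :* U; n = a :* (U :* (i :+ q :* U)) in
           a :* (i :+ q :* (U :+ v :* U)) :* (a :* (i :+ q :* (U :+ v :* U)))
             := a :* v :* (a :* v) :+ (i :+ i) :* (i :+ q) :* (a :* v) :* n
                  :+ (i :- q) :* (i :- q) :* (n :* n)) refl a q U ⟩
    a * v * (a * v) + (1# + 1#) * (1# + q) * (a * v) * ν k + (1# - q) * (1# - q) * (ν k * ν k)
      ≈⟨ +-congʳ (+-cong (trans (*-cong av≈1 av≈1) (*-identityˡ _))
           (*-congʳ (trans (*-congˡ av≈1) (*-identityʳ _)))) ⟩
    1# + (1# + 1#) * (1# + q) * ν k + (1# - q) * (1# - q) * (ν k * ν k) ∎
    where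
    a = q⁻¹ ^ k
    U = [ k ]
    v = 1# - (1# - q) * U
    S′ : [ suc (k ℕ.+ k) ] ≈ 1# + q * (U + v * U)
    S′ = trans ([1+2k] k) (+-congˡ (*-congˡ (+-congˡ (*-congʳ (^≈1-[] k)))))
    av≈1 : a * v ≈ 1#
    av≈1 = trans (*-congˡ (sym (^≈1-[] k))) (q⁻^*q^≈1 k)

  [c+1+2k] : ∀ c k → [ c ℕ.+ suc (k ℕ.+ k) ] ≈ [ c ] + q ^ c * (1# + q * ([ k ] + q ^ k * [ k ]))
  [c+1+2k] c k = trans ([+] c (suc (k ℕ.+ k))) (+-congˡ (*-congˡ ([1+2k] k)))

  -- With l = k + c, the q-analogue of l (l + 1) - k (k + 1) = (l - k) (l + k + 1).
  ν-shift : ∀ k c → ν (k ℕ.+ c) ≈ ν k + q⁻¹ ^ (k ℕ.+ c) * ([ c ] * [ c ℕ.+ suc (k ℕ.+ k) ])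
  ν-shift k c = begin
    q⁻¹ ^ (k ℕ.+ c) * ([ k ℕ.+ c ] * [ suc (k ℕ.+ c) ])
      ≈⟨ *-cong (^-homo-* q⁻¹ k c) (*-cong k+c (+-congˡ (*-congˡ k+c))) ⟩
    a * b * ((U + u * V) * (1# + q * (U + u * V)))
      ≈⟨ solve 5 (λ a b q U V → let i = con (+ 1); u = i :- (i :- q) :* U; v = i :- (i :- q) :* V in
           a :* b :* ((U :+ u :* V) :* (i :+ q :* (U :+ u :* V)))
             := (b :* v) :* (a :* (U :* (i :+ q :* U)))
                :+ a :* b :* (V :* (V :+ v :* (i :+ q :* (U :+ u :* U))))) refl a b q U V ⟩
    (b * v) * ν k + a * b * (V * (V + v * (1# + q * (U + u * U))))
      ≈⟨ +-cong (trans (*-congʳ (trans (*-congˡ (sym (^≈1-[] c))) (q⁻^*q^≈1 c))) (*-identityˡ _))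
           (*-cong (sym (^-homo-* q⁻¹ k c)) (*-congˡ (trans
             (+-congˡ (*-cong (sym (^≈1-[] c)) (+-congˡ (*-congˡ (+-congˡ (*-congʳ (sym (^≈1-[] k))))))))
             (sym ([c+1+2k] c k))))) ⟩
    ν k + q⁻¹ ^ (k ℕ.+ c) * (V * [ c ℕ.+ suc (k ℕ.+ k) ]) ∎
    where
    a = q⁻¹ ^ k
    b = q⁻¹ ^ c
    U = [ k ]
    V = [ c ]
    u = 1# - (1# - q) * U
    v = 1# - (1# - q) * V
    k+c : [ k ℕ.+ c ] ≈ U + u * V
    k+c = trans ([+] k c) (+-congˡ (*-congʳ (^≈1-[] k)))

  B-⊞1 : ∀ p k → (c : Cell p k) → let open Cell c in
    [ d true ] * [ d false ] * B p k ≈ [ suc (p true) ] * [ suc (p false) ] * B (p ⊞ 1) k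
  B-⊞1 p k c = begin
    [ d true ] * [ d false ] * B p k
      ≈⟨ solve 4 (λ a b c d → a :* b :* (c :* d) := a :* c :* (b :* d)) refl _ _ _ _ ⟩
    [ d true ] * binom (M true k) (p true) * ([ d false ] * binom (M false k) (p false))
      ≈⟨ *-cong (raise true) (raise false) ⟩
    [ suc (p true) ] * binom (M true k) (p true ℕ.+ 1) * ([ suc (p false) ] * binom (M false k) (p false ℕ.+ 1))
      ≈⟨ solve 4 (λ a b c d → a :* b :* (c :* d) := a :* c :* (b :* d)) refl _ _ _ _ ⟩
    [ suc (p true) ] * [ suc (p false) ] * B (p ⊞ 1) k ∎
    where
    open Cell c
    raise : ∀ s → [ d s ] * binom (M s k) (p s) ≈ [ suc (p s) ] * binom (M s k) (p s ℕ.+ 1)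
    raise s = trans (*-congˡ (binom-cong (M≡ s) ≡.refl)) (trans (sym (absorb (p s) (d s)))
      (*-congˡ (binom-cong (≡.sym (M≡ s)) (ℕ.+-comm 1 (p s)))))

  -- Write ν(k) as ν(l) minus the difference in `ν-shift`. The first is a constant; the second
  -- contains [l-k] [l+k+1], which by `B-⊞1` turns `E p` into a constant multiple of `E (p ⊞ 1)`.
  ν-preserves : Preserves ν
  ν-preserves = preserves-gen λ p adm → resp (pointwise p adm)
    (scale (ν (m ∸ p true)) (gen p adm)
      ⊕ scale (- (q⁻¹ ^ (m ∸ p true) * ([ suc (p true) ] * [ suc (p false) ])))
          (gen (p ⊞ 1) (⊞-admissible p 1 adm)))
    where
    pointwise : ∀ p → Admissible p → ∀ k → k ℕ.≤ m →
      ν (m ∸ p true) * E p k + - (q⁻¹ ^ (m ∸ p true) * ([ suc (p true) ] * [ suc (p false) ])) * E (p ⊞ 1) k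
        ≈ ν k * E p k
    pointwise p adm k k≤m with cell p k adm k≤m
    ... | inj₂ M<x = trans (+-cong (0*ʳ (0*ʳ (B-vanish p k M<x))) (0*ʳ (0*ʳ (⊞-vanish p k M<x 1))))
                       (trans (+-identityˡ _) (sym (0*ʳ (0*ʳ (B-vanish p k M<x)))))
    ... | inj₁ c = begin
      ν l * E p k + - (q⁻¹ ^ l * ([ suc (p true) ] * [ suc (p false) ])) * E (p ⊞ 1) k
        ≈⟨ +-congˡ (solve 4 (λ a b g e → :- (a :* b) :* (g :* e) := :- (a :* g :* (b :* e))) refl _ _ _ _) ⟩
      ν l * E p k - q⁻¹ ^ l * Γ k * ([ suc (p true) ] * [ suc (p false) ] * B (p ⊞ 1) k)
        ≈⟨ +-cong (*-congʳ (reflexive (≡.cong ν top)))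
             (-‿cong (*-cong (*-congʳ (reflexive (≡.cong (q⁻¹ ^_) top))) (sym (B-⊞1 p k c)))) ⟩
      ν (k ℕ.+ d true) * E p k - q⁻¹ ^ (k ℕ.+ d true) * Γ k * ([ d true ] * [ d false ] * B p k)
        ≈⟨ +-congʳ (*-congʳ (ν-shift k (d true))) ⟩
      (ν k + q⁻¹ ^ (k ℕ.+ d true) * ([ d true ] * [ d true ℕ.+ suc (k ℕ.+ k) ])) * E p k
        - q⁻¹ ^ (k ℕ.+ d true) * Γ k * ([ d true ] * [ d false ] * B p k)
        ≈⟨ +-congʳ (*-congʳ (+-congˡ (*-congˡ (*-congˡ (reflexive (≡.cong [_] (≡.sym d-false))))))) ⟩
      (ν k + q⁻¹ ^ (k ℕ.+ d true) * ([ d true ] * [ d false ])) * E p k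
        - q⁻¹ ^ (k ℕ.+ d true) * Γ k * ([ d true ] * [ d false ] * B p k)
        ≈⟨ solve 6 (λ n a c d g b → (n :+ a :* (c :* d)) :* (g :* b) :- a :* g :* (c :* d :* b)
             := n :* (g :* b)) refl _ _ _ _ _ _ ⟩
      ν k * E p k ∎
      where
      open Cell c
      l = m ∸ p true

  S²-preserves : Preserves (λ k → S k * S k)
  S²-preserves = preserves-resp (λ k _ → sym (S²≈ k))
    (preserves-+ (preserves-+ (preserves-const 1#) (preserves-* (preserves-const _) ν-preserves))
      (preserves-* (preserves-const _) (preserves-* ν-preserves ν-preserves)))

  -- The squares of ballot numbers, and S times a ballot number

  -- The product (1 + q^(m-k)) (1 + q^(m+k+1)), or the same with n, multiplied out; in this form it
  -- is visibly a polynomial in ν and has a meaning also for k > n.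
  κ : Bool → ℕ → Carrier
  κ s k = 1# + q ^ suc (2 ℕ.* size s) + q ^ size s * w k

  κ-preserves : ∀ s → Preserves (κ s)
  κ-preserves s = preserves-+ (preserves-const (1# + q ^ suc (2 ℕ.* size s)))
    (preserves-* (preserves-const (q ^ size s)) (preserves-resp (λ k _ → sym (w≈ k))
      (preserves-+ (preserves-const (1# + q)) (preserves-* (preserves-const _) ν-preserves))))

  -- The sign depends on the side: the bottom n + k + 1 is the reflection of n - k, which exchanges
  -- X with X₋₁.
  A : Bool → ℕ → Carrier
  A true  k = X true k - X₋₁ true k
  A false k = X₋₁ false k - X false k

  -- For k ≤ size s the bottoms M s k and f are size s - k and size s + k + 1 in some order; on the
  -- side false with k > n there is no such f, but all of T, X and X₋₁ vanish.
  record Strip (s : Bool) (k : ℕ) : Set where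
    field
      f   : ℕ
      M+f : M s k ℕ.+ f ≡ suc (2 ℕ.* size s)
      q^w : q ^ size s * w k ≈ q ^ M s k + q ^ f
      gap : q ^ size s * S k * A s k ≈ ([ f ] - [ M s k ]) * (X s k - X₋₁ s k)

  q^*w : ∀ k h → q ^ (k ℕ.+ h) * w k ≈ q ^ h + q ^ (h ℕ.+ suc (k ℕ.+ k))
  q^*w k h = begin
    q ^ (k ℕ.+ h) * (q⁻¹ ^ k + q ^ suc k)
      ≈⟨ *-congʳ (^-homo-* q k h) ⟩
    q ^ k * q ^ h * (q⁻¹ ^ k + q ^ suc k)
      ≈⟨ solve 4 (λ u v a b → u :* v :* (a :+ b) := a :* u :* v :+ v :* (b :* u)) refl _ _ _ _ ⟩
    q⁻¹ ^ k * q ^ k * q ^ h + q ^ h * (q ^ suc k * q ^ k)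
      ≈⟨ +-cong (trans (*-congʳ (q⁻^*q^≈1 k)) (*-identityˡ _))
           (trans (*-congˡ (sym (^-homo-* q (suc k) k))) (sym (^-homo-* q h (suc (k ℕ.+ k))))) ⟩
    q ^ h + q ^ (h ℕ.+ suc (k ℕ.+ k)) ∎

  q^*S : ∀ k h → q ^ (k ℕ.+ h) * S k ≈ [ h ℕ.+ suc (k ℕ.+ k) ] - [ h ]
  q^*S k h = begin
    q ^ (k ℕ.+ h) * (q⁻¹ ^ k * [ suc (k ℕ.+ k) ])
      ≈⟨ *-congʳ (^-homo-* q k h) ⟩
    q ^ k * q ^ h * (q⁻¹ ^ k * [ suc (k ℕ.+ k) ])
      ≈⟨ solve 4 (λ u v a b → u :* v :* (a :* b) := a :* u :* (v :* b)) refl _ _ _ _ ⟩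
    q⁻¹ ^ k * q ^ k * (q ^ h * [ suc (k ℕ.+ k) ])
      ≈⟨ *-congʳ (q⁻^*q^≈1 k) ⟩
    1# * (q ^ h * [ suc (k ℕ.+ k) ])
      ≈⟨ solve 2 (λ a h → con (+ 1) :* a := h :+ a :- h) refl _ [ h ] ⟩
    [ h ] + q ^ h * [ suc (k ℕ.+ k) ] - [ h ]
      ≈⟨ +-congʳ ([+] h (suc (k ℕ.+ k))) ⟨
    [ h ℕ.+ suc (k ℕ.+ k) ] - [ h ] ∎

  strip : ∀ s k → k ℕ.≤ m → Strip s k ⊎ (T s k ≈ 0# × X s k ≈ 0# × X₋₁ s k ≈ 0#)
  strip true k k≤m = inj₁ record
    { f = h ℕ.+ suc (k ℕ.+ k)
    ; M+f = ≡.trans (e k h) (≡.cong (λ m → suc (2 ℕ.* m)) k+h≡m)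
    ; q^w = trans (*-congʳ (^-cong (≡.sym k+h≡m))) (q^*w k h)
    ; gap = *-congʳ (trans (*-congʳ (^-cong (≡.sym k+h≡m))) (q^*S k h)) }
    where
    h = m ∸ k
    k+h≡m : k ℕ.+ h ≡ m
    k+h≡m = ℕ.m+[n∸m]≡n k≤m
    e : ∀ k h → h ℕ.+ (h ℕ.+ suc (k ℕ.+ k)) ≡ suc (2 ℕ.* (k ℕ.+ h))
    e = solve-∀
  strip false k k≤m with ℕ.≤-<-connex k n
  ... | inj₂ n<k = inj₂ (binom-< (s≤s 2n<n+k) , binom-< (ℕ.m≤n⇒m≤1+n 2n<n+k) , binom-< 2n<n+k)
    where
    2n<n+k : 2 ℕ.* n ℕ.< n ℕ.+ k
    2n<n+k = ℕ.≤-<-trans (ℕ.≤-reflexive (≡.cong (n ℕ.+_) (ℕ.+-identityʳ n))) (ℕ.+-monoʳ-< n n<k)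
  ... | inj₁ k≤n = inj₁ record
    { f = h
    ; M+f = ≡.trans (≡.cong (λ n → suc (n ℕ.+ k) ℕ.+ h) (≡.sym k+h≡n))
        (≡.trans (e k h) (≡.cong (λ n → suc (2 ℕ.* n)) k+h≡n))
    ; q^w = trans (*-congʳ (^-cong (≡.sym k+h≡n))) (trans (q^*w k h) (trans (+-comm _ _) (+-congʳ (^-cong M≡))))
    ; gap = trans (*-congʳ (trans (*-congʳ (^-cong (≡.sym k+h≡n))) (trans (q^*S k h)
              (+-congʳ (reflexive (≡.cong [_] M≡))))))
              (solve 4 (λ a b c d → (a :- b) :* (c :- d) := (b :- a) :* (d :- c)) refl _ _ _ _) }
    where
    h = n ∸ k
    k+h≡n : k ℕ.+ h ≡ n
    k+h≡n = ℕ.m+[n∸m]≡n k≤n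
    e : ∀ k h → suc (k ℕ.+ h ℕ.+ k) ℕ.+ h ≡ suc (2 ℕ.* (k ℕ.+ h))
    e = solve-∀
    M≡ : h ℕ.+ suc (k ℕ.+ k) ≡ suc (n ℕ.+ k)
    M≡ = ≡.trans (e′ k h) (≡.cong (λ n → suc (n ℕ.+ k)) k+h≡n)
      where
      e′ : ∀ k h → h ℕ.+ suc (k ℕ.+ k) ≡ suc (k ℕ.+ h ℕ.+ k)
      e′ = solve-∀

  pascal-lower : ∀ h e → binom (suc h) e ≈ binom₋₁ h e + q ^ e * binom h e
  pascal-lower h zero    = sym (trans (+-identityˡ _) (trans (*-identityˡ _) (binom-0 h)))
  pascal-lower h (suc e) = refl

  pascal-upper : ∀ h e f → e ℕ.+ f ≡ suc h → binom (suc h) e ≈ binom h e + q ^ f * binom₋₁ h e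
  pascal-upper h zero    f e+f≡ = sym (trans (+-cong (binom-0 h) (zeroʳ _)) (+-identityʳ _))
  pascal-upper h (suc e) f e+f≡ = trans (pascal′ h e) (+-congˡ (*-congʳ (^-cong
    (≡.trans (≡.cong (_∸ e) (≡.sym (ℕ.suc-injective e+f≡))) (ℕ.m+n∸m≡n e f)))))

  absorb-lower : ∀ h e f → e ℕ.+ f ≡ suc h → [ e ] * binom h e ≈ [ f ] * binom₋₁ h e
  absorb-lower h zero    f e+f≡ = trans (zeroˡ _) (sym (zeroʳ _))
  absorb-lower h (suc e) f e+f≡ with ℕ.suc-injective e+f≡
  ... | ≡.refl = absorb e f

  difference : ∀ {t x y u v} → t ≈ y + u * x → t ≈ x + v * y → x - y ≈ u * x - v * y
  difference {t} {x} {y} {u} {v} t≈ t≈′ = begin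
    x - y                   ≈⟨ solve 3 (λ x y z → x :- y := x :+ z :- z :- y) refl x y (v * y) ⟩
    x + v * y - v * y - y   ≈⟨ +-congʳ (+-congʳ (trans (sym t≈′) t≈)) ⟩
    y + u * x - v * y - y   ≈⟨ solve 3 (λ y a b → y :+ a :- b :- y := a :- b) refl y (u * x) (v * y) ⟩
    u * x - v * y           ∎

  -- Here t, x, y are T, X, X₋₁, and u, v are the powers of q in the two Pascal rules. Equating the
  -- rules gives x - y = u x - v y; with one factor rewritten so, the rest is a polynomial identity.
  square-difference : ∀ {t x y u v} → t ≈ y + u * x → t ≈ x + v * y →
    (x - y) * (x - y) ≈ t * t - (1# + u) * (1# + v) * (y * x)
  square-difference {t} {x} {y} {u} {v} t≈ t≈′ = begin
    (x - y) * (x - y)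
      ≈⟨ *-congˡ (difference t≈ t≈′) ⟩
    (x - y) * (u * x - v * y)
      ≈⟨ solve 4 (λ x y u v → (x :- y) :* (u :* x :- v :* y)
           := (y :+ u :* x) :* (x :+ v :* y) :- (con (+ 1) :+ u) :* (con (+ 1) :+ v) :* (y :* x)) refl x y u v ⟩
    (y + u * x) * (x + v * y) - (1# + u) * (1# + v) * (y * x)
      ≈⟨ +-congʳ (*-cong t≈ t≈′) ⟨
    t * t - (1# + u) * (1# + v) * (y * x) ∎

  -- The same substitution for x - y, where U and V stand for [M] and [f]. Absorption, U x = V y, is
  -- used in both directions to form the factor U + u V, which is [M + f] = [2m + 1] or [2n + 1].
  gap-difference : ∀ {t x y u v U V} → t ≈ y + u * x → t ≈ x + v * y → U * x ≈ V * y →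
    (V - U) * (x - y) ≈ (U + u * V) * t - (1# + u) * (1# + v) * (U * x)
  gap-difference {t} {x} {y} {u} {v} {U} {V} t≈ t≈′ Ux≈Vy = begin
    (V - U) * (x - y)
      ≈⟨ *-congˡ (difference t≈ t≈′) ⟩
    (V - U) * (u * x - v * y)
      ≈⟨ solve 6 (λ x y u v U V → (V :- U) :* (u :* x :- v :* y)
           := u :* V :* x :- v :* (V :* y) :- u :* U :* x :+ v :* U :* y) refl x y u v U V ⟩
    u * V * x - v * (V * y) - u * U * x + v * U * y
      ≈⟨ +-congʳ (+-congʳ (+-congˡ (-‿cong (*-congˡ (sym Ux≈Vy))))) ⟩
    u * V * x - v * (U * x) - u * U * x + v * U * y
      ≈⟨ solve 6 (λ x y u v U V → u :* V :* x :- v :* (U :* x) :- u :* U :* x :+ v :* U :* y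
           := U :* x :+ U :* v :* y :+ u :* V :* x :+ u :* v :* (U :* x)
                :- (con (+ 1) :+ u) :* (con (+ 1) :+ v) :* (U :* x)) refl x y u v U V ⟩
    U * x + U * v * y + u * V * x + u * v * (U * x) - (1# + u) * (1# + v) * (U * x)
      ≈⟨ +-congʳ (+-congˡ (*-congˡ Ux≈Vy)) ⟩
    U * x + U * v * y + u * V * x + u * v * (V * y) - (1# + u) * (1# + v) * (U * x)
      ≈⟨ +-congʳ (solve 6 (λ x y u v U V → U :* x :+ U :* v :* y :+ u :* V :* x :+ u :* v :* (V :* y)
           := (U :+ u :* V) :* (x :+ v :* y)) refl x y u v U V) ⟩
    (U + u * V) * (x + v * y) - (1# + u) * (1# + v) * (U * x)
      ≈⟨ +-congʳ (*-congˡ t≈′) ⟨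
    (U + u * V) * t - (1# + u) * (1# + v) * (U * x) ∎

  module _ {s k} (σ : Strip s k) where
    open Strip σ

    κ≈ : κ s k ≈ (1# + q ^ M s k) * (1# + q ^ f)
    κ≈ = trans (+-cong (+-congˡ (trans (^-cong (≡.sym M+f)) (^-homo-* q (M s k) f))) q^w)
      (solve 2 (λ u v → con (+ 1) :+ u :* v :+ (u :+ v) := (con (+ 1) :+ u) :* (con (+ 1) :+ v)) refl _ _)

    lower : T s k ≈ X₋₁ s k + q ^ M s k * X s k
    lower = pascal-lower _ (M s k)

    upper : T s k ≈ X s k + q ^ f * X₋₁ s k
    upper = pascal-upper _ (M s k) f M+f

    strip-square : (X s k - X₋₁ s k) * (X s k - X₋₁ s k) ≈ T s k * T s k - κ s k * (X₋₁ s k * X s k)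
    strip-square = trans (square-difference lower upper) (+-congˡ (-‿cong (*-congʳ (sym κ≈))))

    strip-gap : q ^ size s * S k * A s k
      ≈ [ suc (2 ℕ.* size s) ] * T s k - κ s k * ([ M s k ] * X s k)
    strip-gap = trans gap (trans (gap-difference lower upper (absorb-lower _ (M s k) f M+f))
      (+-cong (*-congʳ (trans (sym ([+] (M s k) f)) (reflexive (≡.cong [_] M+f))))
        (-‿cong (*-congʳ (sym κ≈)))))

  A²≈ : ∀ s k → k ℕ.≤ m → A s k * A s k ≈ T s k * T s k - κ s k * (X₋₁ s k * X s k)
  A²≈ s k k≤m = trans (unsigned s) (difference² (strip s k k≤m))
    where
    unsigned : ∀ s → A s k * A s k ≈ (X s k - X₋₁ s k) * (X s k - X₋₁ s k)
    unsigned true  = refl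
    unsigned false = solve 2 (λ a b → (a :- b) :* (a :- b) := (b :- a) :* (b :- a)) refl _ _
    difference² : Strip s k ⊎ (T s k ≈ 0# × X s k ≈ 0# × X₋₁ s k ≈ 0#) →
      (X s k - X₋₁ s k) * (X s k - X₋₁ s k) ≈ T s k * T s k - κ s k * (X₋₁ s k * X s k)
    difference² (inj₁ σ) = strip-square σ
    difference² (inj₂ (T≈0 , X≈0 , X₋₁≈0)) = begin
      (X s k - X₋₁ s k) * (X s k - X₋₁ s k)  ≈⟨ *-cong x-y≈0 x-y≈0 ⟩
      (0# - 0#) * (0# - 0#)
        ≈⟨ solve 1 (λ a → let o = con (+ 0) in (o :- o) :* (o :- o) := o :* o :- a :* (o :* o)) refl (κ s k) ⟩
      0# * 0# - κ s k * (0# * 0#)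
        ≈⟨ +-cong (*-cong T≈0 T≈0) (-‿cong (*-congˡ (*-cong X₋₁≈0 X≈0))) ⟨
      T s k * T s k - κ s k * (X₋₁ s k * X s k) ∎
      where
      x-y≈0 : X s k - X₋₁ s k ≈ 0# - 0#
      x-y≈0 = +-cong X≈0 (-‿cong X₋₁≈0)

  q^SA≈ : ∀ s k → k ℕ.≤ m → q ^ size s * (S k * A s k)
    ≈ [ suc (2 ℕ.* size s) ] * T s k - κ s k * ([ M s k ] * X s k)
  q^SA≈ s k k≤m with strip s k k≤m
  ... | inj₁ σ = trans (sym (*-assoc _ _ _)) (strip-gap σ)
  ... | inj₂ (T≈0 , X≈0 , X₋₁≈0) = trans (0*ʳ (0*ʳ (A≈0 s X≈0 X₋₁≈0))) (sym (trans
    (+-cong (0*ʳ T≈0) (-‿cong (0*ʳ (0*ʳ X≈0)))) (-‿inverseʳ 0#)))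
    where
    A≈0 : ∀ s → X s k ≈ 0# → X₋₁ s k ≈ 0# → A s k ≈ 0#
    A≈0 true  X≈0 X₋₁≈0 = trans (+-cong X≈0 (-‿cong X₋₁≈0)) (-‿inverseʳ 0#)
    A≈0 false X≈0 X₋₁≈0 = trans (+-cong X₋₁≈0 (-‿cong X≈0)) (-‿inverseʳ 0#)

  preserves-neg : ∀ {φ} → Preserves φ → Preserves (λ k → - φ k)
  preserves-neg {φ} φ-pres = preserves-resp {φ = λ k → - 1# * φ k}
    (λ k _ → solve 1 (λ a → :- con (+ 1) :* a := :- a) refl (φ k))
    (preserves-* (preserves-const (- 1#)) φ-pres)

  A²-preserves : ∀ s → Preserves (λ k → A s k * A s k)
  A²-preserves s = preserves-resp (λ k k≤m → sym (A²≈ s k k≤m))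
    (preserves-+ (preserves-* (T-preserves s) (T-preserves s))
      (preserves-neg (preserves-* (κ-preserves s) (X₋₁X-preserves s))))

  SA-preserves : ∀ s → Preserves (λ k → S k * A s k)
  SA-preserves s = preserves-resp (λ k k≤m → sym (q⁻^-move (size s) (q^SA≈ s k k≤m)))
    (preserves-* (preserves-const (q⁻¹ ^ size s))
      (preserves-+ (preserves-* (preserves-const [ suc (2 ℕ.* size s) ]) (T-preserves s))
        (preserves-neg (preserves-* (κ-preserves s) ([M]X-preserves s)))))

  -- The multiplier q^(k²+k)

  Q : ℕ → Carrier
  Q k = q ^ (k ℕ.* k ℕ.+ k)

  -- Insert the factor 1 in the form of `rank-sum` for l + k + 1 and l - k. The exponent k² + k +
  -- (l+k+1-g) (l-k-g) equals (l-g)² + (l-g), which is free of k, and the two binomials over g merge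
  -- with the kernel by trinomial revision, raising both indices by g.
  Q-preserves : Preserves Q
  Q-preserves = preserves-gen λ p adm →
    expand-E p adm (coef p) λ k c → expand p k c
    where
    coef : Index → ℕ → Carrier
    coef p g = let i = m ∸ p true ∸ g in
      q ^ (i ℕ.* i ℕ.+ i) * poch g * (binom (p true ℕ.+ g) (p true) * binom (p false ℕ.+ g) (p false))
    expand : ∀ p k → Cell p k → Q k * B p k ≈ Σ< N (λ g → coef p g * B (p ⊞ g) k)
    expand p k c = begin
      Q k * B p k
        ≈⟨ *-identityʳ _ ⟨
      Q k * B p k * 1#
        ≈⟨ *-congˡ (rank-sum b a N (d< true)) ⟨
      Q k * B p k * Σ< N (λ g → binom b g * binom a g * poch g * q ^ ((b ∸ g) ℕ.* (a ∸ g)))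
        ≈⟨ Σ<-* N (Q k * B p k) (λ g → binom b g * binom a g * poch g * q ^ ((b ∸ g) ℕ.* (a ∸ g))) ⟨
      Σ< N (λ g → Q k * B p k * (binom b g * binom a g * poch g * q ^ ((b ∸ g) ℕ.* (a ∸ g))))
        ≈⟨ Σ<-cong N (λ g _ → termwise g) ⟩
      Σ< N (λ g → coef p g * B (p ⊞ g) k) ∎
      where
      open Cell c
      a = d true
      b = d false
      split : ∀ s g → binom (M s k) (p s) * binom (d s) g
        ≈ binom (p s ℕ.+ g) (p s) * binom (M s k) (p s ℕ.+ g)
      split s g = trans (*-congʳ (binom-cong (M≡ s) ≡.refl)) (trans (binom-revision′ (p s) (d s) g)
        (*-congˡ (binom-cong (≡.sym (M≡ s)) ≡.refl)))
      e₁ : ∀ h g k → h ℕ.+ suc (k ℕ.+ k) ℕ.+ g ≡ h ℕ.+ g ℕ.+ suc (k ℕ.+ k)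
      e₁ = solve-∀
      e₂ : ∀ h k → k ℕ.* k ℕ.+ k ℕ.+ (h ℕ.+ suc (k ℕ.+ k)) ℕ.* h ≡ (k ℕ.+ h) ℕ.* (k ℕ.+ h) ℕ.+ (k ℕ.+ h)
      e₂ = solve-∀
      exponent : ∀ g → g ℕ.≤ a → let i = m ∸ p true ∸ g in
        k ℕ.* k ℕ.+ k ℕ.+ (b ∸ g) ℕ.* (a ∸ g) ≡ i ℕ.* i ℕ.+ i
      exponent g g≤a = ≡.trans (≡.cong (λ z → k ℕ.* k ℕ.+ k ℕ.+ z ℕ.* h) b∸g≡)
        (≡.trans (e₂ h k) (≡.cong (λ i → i ℕ.* i ℕ.+ i) (≡.sym i≡)))
        where
        h = a ∸ g
        b∸g≡ : b ∸ g ≡ h ℕ.+ suc (k ℕ.+ k)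
        b∸g≡ = ≡.trans (≡.cong (_∸ g) d-false) (≡.trans
          (≡.cong (λ a → a ℕ.+ suc (k ℕ.+ k) ∸ g) (≡.sym (ℕ.m∸n+n≡m g≤a)))
          (≡.trans (≡.cong (_∸ g) (≡.sym (e₁ h g k))) (ℕ.m+n∸n≡m (h ℕ.+ suc (k ℕ.+ k)) g)))
        i≡ : m ∸ p true ∸ g ≡ k ℕ.+ h
        i≡ = ≡.trans (≡.cong (_∸ g) top) (ℕ.+-∸-assoc k g≤a)
      termwise : ∀ g → Q k * B p k * (binom b g * binom a g * poch g * q ^ ((b ∸ g) ℕ.* (a ∸ g)))
        ≈ coef p g * B (p ⊞ g) k
      termwise g with ℕ.≤-<-connex g a
      ... | inj₂ a<g = trans (0*ʳ (0*ˡ (0*ˡ (0*ʳ (binom-< a<g)))))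
        (sym (0*ʳ (0*ˡ (binom-< (ℕ.≤-<-trans (ℕ.≤-reflexive (M≡ true)) (ℕ.+-monoʳ-< (p true) a<g))))))
      ... | inj₁ g≤a = begin
        Q k * B p k * (binom b g * binom a g * poch g * q ^ ((b ∸ g) ℕ.* (a ∸ g)))
          ≈⟨ solve 7 (λ Q x y β α P z → Q :* (x :* y) :* (β :* α :* P :* z)
               := Q :* z :* P :* (x :* α :* (y :* β))) refl _ _ _ _ _ _ _ ⟩
        Q k * q ^ ((b ∸ g) ℕ.* (a ∸ g)) * poch g
          * (binom (M true k) (p true) * binom a g * (binom (M false k) (p false) * binom b g))
          ≈⟨ *-cong (*-congʳ (trans (sym (^-homo-* q (k ℕ.* k ℕ.+ k) _)) (^-cong (exponent g g≤a))))
               (*-cong (split true g) (split false g)) ⟩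
        q ^ (i ℕ.* i ℕ.+ i) * poch g
          * (binom (p true ℕ.+ g) (p true) * binom (M true k) (p true ℕ.+ g)
               * (binom (p false ℕ.+ g) (p false) * binom (M false k) (p false ℕ.+ g)))
          ≈⟨ solve 5 (λ c x u y v → c :* (x :* u :* (y :* v)) := c :* (x :* y) :* (u :* v)) refl _ _ _ _ _ ⟩
        coef p g * B (p ⊞ g) k ∎
        where i = m ∸ p true ∸ g

  -- Pairing the factors S and A

  W : ℕ → ℕ → ℕ → ℕ → Carrier
  W ρ σ τ k = S k ^ ρ * (A true k ^ σ * A false k ^ τ)

  S-preserves : ∀ {ρ} → Even ρ → Preserves (λ k → S k ^ ρ)
  S-preserves zero = preserves-const 1#
  S-preserves (2+ e) = preserves-resp (λ k _ → *-assoc _ _ _) (preserves-* S²-preserves (S-preserves e))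

  -- The surplus factor S pairs with a leftover ballot number; no product of ballot numbers
  -- of both sizes is ever needed.
  W-preserves : ∀ ρ σ τ → Even (σ ℕ.+ (τ ℕ.+ suc ρ)) → Preserves (W (suc ρ) σ τ)
  W-preserves ρ (suc (suc σ)) τ (2+ e) = preserves-resp
    (λ k _ → solve 4 (λ a s b c → a :* a :* (s :* (b :* c)) := s :* (a :* (a :* b) :* c))
               refl (A true k) (S k ^ suc ρ) (A true k ^ σ) (A false k ^ τ))
    (preserves-* (A²-preserves true) (W-preserves ρ σ τ e))
  W-preserves ρ zero (suc (suc τ)) (2+ e) = preserves-resp
    (λ k _ → solve 4 (λ a s b c → a :* a :* (s :* (b :* c)) := s :* (b :* (a :* (a :* c))))
               refl (A false k) (S k ^ suc ρ) 1# (A false k ^ τ))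
    (preserves-* (A²-preserves false) (W-preserves ρ 0 τ e))
  W-preserves ρ (suc zero) (suc (suc τ)) (2+ e) = preserves-resp
    (λ k _ → solve 4 (λ a s b c → a :* a :* (s :* (b :* c)) := s :* (b :* (a :* (a :* c))))
               refl (A false k) (S k ^ suc ρ) (A true k ^ 1) (A false k ^ τ))
    (preserves-* (A²-preserves false) (W-preserves ρ 1 τ e))
  W-preserves ρ zero zero e = preserves-resp
    (λ k _ → solve 1 (λ s → s := s :* (con (+ 1) :* con (+ 1))) refl (S k ^ suc ρ))
    (S-preserves e)
  W-preserves ρ zero (suc zero) (2+ e) = preserves-resp
    (λ k _ → solve 3 (λ s a t → s :* a :* t := s :* t :* (con (+ 1) :* (a :* con (+ 1))))
               refl (S k) (A false k) (S k ^ ρ))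
    (preserves-* (SA-preserves false) (S-preserves e))
  W-preserves ρ (suc zero) zero (2+ e) = preserves-resp
    (λ k _ → solve 3 (λ s a t → s :* a :* t := s :* t :* (a :* con (+ 1) :* con (+ 1)))
               refl (S k) (A true k) (S k ^ ρ))
    (preserves-* (SA-preserves true) (S-preserves e))
  -- With one ballot number of each size left, parity forces the positive exponent of S to be even,
  -- so there is an S for each of them.
  W-preserves (suc ρ) (suc zero) (suc zero) (2+ (2+ e)) = preserves-resp
    (λ k _ → solve 4 (λ s a b t → s :* a :* (s :* b :* t)
                 := s :* (s :* t) :* (a :* con (+ 1) :* (b :* con (+ 1))))
               refl (S k) (A true k) (A false k) (S k ^ ρ))
    (preserves-* (SA-preserves true) (preserves-* (SA-preserves false) (S-preserves e)))

  -- Telescoping of the plain and the alternating sum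

  infix 4 _∣_
  _∣_ : Carrier → Carrier → Set
  a ∣ x = ∃ λ y → x ≈ a * y

  -- σ k stands for τ (k + 1), but is given separately because at k = N the latter would lie outside
  -- the range in which kernels are meaningful.
  telescope : ∀ N (f τ σ : ℕ → Carrier) → (∀ k → k ℕ.< suc N → f k ≈ τ k - σ k) →
    (∀ k → k ℕ.< N → σ k ≈ τ (suc k)) → σ N ≈ 0# → Σ< (suc N) f ≈ τ 0
  telescope zero f τ σ f≈ _ σ≈0 = trans (+-identityʳ _) (trans (f≈ 0 (s≤s z≤n))
    (trans (+-congˡ (-‿cong σ≈0)) (solve 1 (λ t → t :- con (+ 0) := t) refl (τ 0))))
  telescope (suc N) f τ σ f≈ σ≈ σ≈0 = trans
    (+-cong (trans (f≈ 0 (s≤s z≤n)) (+-congˡ (-‿cong (σ≈ 0 (s≤s z≤n)))))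
      (telescope N (λ k → f (suc k)) (λ k → τ (suc k)) (λ k → σ (suc k))
        (λ k k<N → f≈ (suc k) (s≤s k<N)) (λ k k<N → σ≈ (suc k) (s≤s k<N)) σ≈0))
    (solve 2 (λ a b → a :- b :+ b := a) refl (τ 0) (τ 1))

  h : ℕ
  h = suc (m ℕ.+ n)

  E-vanish : ∀ p k → M true k ℕ.< p true → E p k ≈ 0#
  E-vanish p k M<x = 0*ʳ (B-vanish p k M<x)

  l : Index → ℕ
  l p = m ∸ p true

  -- The ratio of consecutive values of 1 / ([l-k]! [l+k+1]!), cleared of denominators. It is
  -- assembled by absorption in each of the three binomials of a kernel.
  step : ∀ p k → Admissible p → k ℕ.< m →
    [ l p ∸ k ] * E p k ≈ [ l p ℕ.+ suc (suc k) ] * E p (suc k)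
  step p k adm k<m with cell p k adm (ℕ.<⇒≤ k<m)
  ... | inj₂ M<x = trans (0*ʳ (E-vanish p k M<x))
    (sym (0*ʳ (E-vanish p (suc k) (ℕ.≤-<-trans (ℕ.∸-monoʳ-≤ m (ℕ.n≤1+n k)) M<x))))
  ... | inj₁ cl = go (d true) ≡.refl
    where
    open Cell cl
    x = p true
    y = p false
    l∸k : l p ∸ k ≡ d true
    l∸k = ≡.trans (≡.cong (_∸ k) top) (ℕ.m+n∸m≡n k (d true))
    M≡1+ : m ∸ k ≡ suc (m ∸ suc k)
    M≡1+ = ℕ.+-∸-assoc 1 k<m
    go : ∀ c → d true ≡ c → [ l p ∸ k ] * E p k ≈ [ l p ℕ.+ suc (suc k) ] * E p (suc k)
    go zero d≡ = trans (0*ˡ (reflexive (≡.cong [_] (≡.trans l∸k d≡)))) (sym (0*ʳ (E-vanish p (suc k)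
      (ℕ.≤-reflexive (≡.trans (≡.sym M≡1+) (≡.trans (M≡ true)
        (≡.trans (≡.cong (x ℕ.+_) d≡) (ℕ.+-identityʳ x))))))))
    go (suc c) d≡ = begin
      [ l p ∸ k ] * (Γ k * (binom (m ∸ k) x * β))
        ≈⟨ *-cong (reflexive (≡.cong [_] (≡.trans l∸k d≡))) (*-congˡ (*-congʳ (binom-cong M≡′ ≡.refl))) ⟩
      [ suc c ] * (Γ k * (binom (x ℕ.+ suc c) x * β))
        ≈⟨ solve 4 (λ c g a b → c :* (g :* (a :* b)) := g :* (c :* a :* b)) refl _ _ _ _ ⟩
      Γ k * ([ suc c ] * binom (x ℕ.+ suc c) x * β)
        ≈⟨ *-congˡ (*-congʳ (absorb-top x c)) ⟩
      Γ k * ([ x ℕ.+ suc c ] * binom (x ℕ.+ c) x * β)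
        ≈⟨ solve 4 (λ c g a b → g :* (c :* a :* b) := c :* g :* (a :* b)) refl _ _ _ _ ⟩
      [ x ℕ.+ suc c ] * Γ k * (binom (x ℕ.+ c) x * β)
        ≈⟨ *-cong Γ-step (*-congʳ (binom-cong (≡.sym M≡″) ≡.refl)) ⟩
      [ y ℕ.+ suc b ] * Γ (suc k) * (binom (m ∸ suc k) x * β)
        ≈⟨ solve 4 (λ c g a b → c :* g :* (a :* b) := g :* (a :* (c :* b))) refl _ _ _ _ ⟩
      Γ (suc k) * (binom (m ∸ suc k) x * ([ y ℕ.+ suc b ] * β))
        ≈⟨ *-congˡ (*-congˡ (trans (*-congˡ (binom-cong (M≡ false) ≡.refl)) (sym (absorb-top y b)))) ⟩
      Γ (suc k) * (binom (m ∸ suc k) x * ([ suc b ] * binom (y ℕ.+ suc b) y))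
        ≈⟨ *-congˡ (*-congˡ (*-cong (reflexive (≡.cong [_] b≡)) (binom-cong N≡ ≡.refl))) ⟩
      Γ (suc k) * (binom (m ∸ suc k) x * ([ l p ℕ.+ suc (suc k) ] * binom (M false (suc k)) y))
        ≈⟨ solve 4 (λ c g a b → g :* (a :* (c :* b)) := c :* (g :* (a :* b))) refl _ _ _ _ ⟩
      [ l p ℕ.+ suc (suc k) ] * E p (suc k) ∎
      where
      b = d false
      β = binom (M false k) y
      M≡′ : m ∸ k ≡ x ℕ.+ suc c
      M≡′ = ≡.trans (M≡ true) (≡.cong (x ℕ.+_) d≡)
      M≡″ : m ∸ suc k ≡ x ℕ.+ c
      M≡″ = ℕ.suc-injective (≡.trans (≡.sym M≡1+) (≡.trans M≡′ (ℕ.+-suc x c)))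
      b≡ : suc b ≡ l p ℕ.+ suc (suc k)
      b≡ = ≡.trans (≡.cong suc d-false) (≡.trans (e (d true) k) (≡.cong (ℕ._+ suc (suc k)) (≡.sym top)))
        where
        e : ∀ c k → suc (c ℕ.+ suc (k ℕ.+ k)) ≡ k ℕ.+ c ℕ.+ suc (suc k)
        e = solve-∀
      N≡ : y ℕ.+ suc b ≡ suc (n ℕ.+ suc k)
      N≡ = ≡.trans (ℕ.+-suc y b) (≡.trans (≡.cong suc (≡.sym (M≡ false))) (≡.cong suc (≡.sym (ℕ.+-suc n k))))
      h≡ : h ≡ x ℕ.+ c ℕ.+ (y ℕ.+ suc b)
      h≡ = ≡.trans
        (≡.cong (λ m → suc (m ℕ.+ n)) (≡.trans (≡.sym (ℕ.m∸n+n≡m k<m)) (≡.cong (ℕ._+ suc k) M≡″)))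
        (≡.trans (e (x ℕ.+ c) k n) (≡.cong (x ℕ.+ c ℕ.+_) (≡.sym N≡)))
        where
        e : ∀ a k n → suc (a ℕ.+ suc k ℕ.+ n) ≡ a ℕ.+ suc (n ℕ.+ suc k)
        e = solve-∀
      Γ-step : [ x ℕ.+ suc c ] * Γ k ≈ [ y ℕ.+ suc b ] * Γ (suc k)
      Γ-step = begin
        [ x ℕ.+ suc c ] * binom h (m ∸ k)
          ≈⟨ *-cong (reflexive (≡.cong [_] (ℕ.+-suc x c))) (binom-cong h≡ (≡.trans M≡′ (ℕ.+-suc x c))) ⟩
        [ suc (x ℕ.+ c) ] * binom (x ℕ.+ c ℕ.+ (y ℕ.+ suc b)) (suc (x ℕ.+ c))
          ≈⟨ absorb (x ℕ.+ c) (y ℕ.+ suc b) ⟩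
        [ y ℕ.+ suc b ] * binom (x ℕ.+ c ℕ.+ (y ℕ.+ suc b)) (x ℕ.+ c)
          ≈⟨ *-congˡ (binom-cong (≡.sym h≡) (≡.sym M≡″)) ⟩
        [ y ℕ.+ suc b ] * binom h (m ∸ suc k) ∎

  base-divisor : Carrier
  base-divisor = [ h ] * binom (m ℕ.+ n) m

  -- The factor [l+1] reduces [l]! [l+1]! to [l]! [l]!. As x + l = m and y + l = n, what remains of
  -- [m+n+1]! splits into [m+n+1] [m+n ; m] times [m ; x] [n ; y].
  boundary : ∀ p → Admissible p → base-divisor ∣ [ suc (l p) ] * E p 0
  boundary p adm with cell p 0 adm z≤n
  ... | inj₂ M<x = 0# , trans (0*ʳ (E-vanish p 0 M<x)) (sym (zeroʳ _))
  ... | inj₁ cl = binom m x * binom n y , (begin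
    [ suc (l p) ] * (binom h m * (binom m x * binom (suc (n ℕ.+ 0)) y))
      ≈⟨ *-congˡ (*-congˡ (*-congˡ (binom-cong {k = y} (≡.cong suc (ℕ.+-identityʳ n)) ≡.refl))) ⟩
    [ suc (l p) ] * (binom h m * (binom m x * binom (suc n) y))
      ≈⟨ solve 4 (λ c g a b → c :* (g :* (a :* b)) := g :* (a :* (c :* b))) refl _ _ _ _ ⟩
    binom h m * (binom m x * ([ suc (l p) ] * binom (suc n) y))
      ≈⟨ *-congˡ (*-congˡ (*-congˡ (binom-cong 1+n≡ ≡.refl))) ⟩
    binom h m * (binom m x * ([ suc (l p) ] * binom (y ℕ.+ suc (l p)) y))
      ≈⟨ *-congˡ (*-congˡ (absorb-top y (l p))) ⟩
    binom h m * (binom m x * ([ y ℕ.+ suc (l p) ] * binom (y ℕ.+ l p) y))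
      ≈⟨ *-congˡ (*-congˡ (*-cong (reflexive (≡.cong [_] (≡.sym 1+n≡))) (binom-cong (≡.sym n≡) ≡.refl))) ⟩
    binom h m * (binom m x * ([ suc n ] * binom n y))
      ≈⟨ solve 4 (λ c g a b → g :* (a :* (c :* b)) := c :* g :* (a :* b)) refl _ _ _ _ ⟩
    [ suc n ] * binom h m * (binom m x * binom n y)
      ≈⟨ *-congʳ (*-congˡ (binom-cong (≡.sym (ℕ.+-suc m n)) ≡.refl)) ⟩
    [ suc n ] * binom (m ℕ.+ suc n) m * (binom m x * binom n y)
      ≈⟨ *-congʳ (trans (absorb-top m n) (*-congʳ (reflexive (≡.cong [_] (ℕ.+-suc m n))))) ⟩
    base-divisor * (binom m x * binom n y) ∎)
    where
    open Cell cl
    x = p true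
    y = p false
    n≡ : n ≡ y ℕ.+ l p
    n≡ = ℕ.suc-injective (≡.trans (≡.cong suc (≡.sym (ℕ.+-identityʳ n))) (≡.trans (M≡ false)
      (≡.trans (≡.cong (y ℕ.+_) (≡.trans d-false (≡.trans (ℕ.+-comm (d true) 1)
        (≡.cong suc (≡.sym top))))) (ℕ.+-suc y (l p)))))
    1+n≡ : suc n ≡ y ℕ.+ suc (l p)
    1+n≡ = ≡.trans (≡.cong suc n≡) (≡.sym (ℕ.+-suc y (l p)))

  module _ {p k} (c : Cell p k) where
    open Cell c

    cell-l∸k : l p ∸ k ≡ d true
    cell-l∸k = ≡.trans (≡.cong (_∸ k) top) (ℕ.m+n∸m≡n k (d true))

    cell-l+1+k : l p ℕ.+ suc k ≡ d true ℕ.+ suc (k ℕ.+ k)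
    cell-l+1+k = ≡.trans (≡.cong (ℕ._+ suc k) top) (e k (d true))
      where
      e : ∀ k c → k ℕ.+ c ℕ.+ suc k ≡ c ℕ.+ suc (k ℕ.+ k)
      e = solve-∀

  divides-combination : ∀ (ω : ℕ → Carrier) {a} →
    (∀ p → Admissible p → a ∣ Σ< (suc m) (λ k → ω k * E p k)) →
    ∀ {F} → Span F → a ∣ Σ< (suc m) (λ k → ω k * F k)
  divides-combination ω {a} gen∣ (gen p adm) = gen∣ p adm
  divides-combination ω {a} gen∣ null =
    0# , trans (Σ<-zero (suc m) (λ k _ → zeroʳ (ω k))) (sym (zeroʳ _))
  divides-combination ω {a} gen∣ (_⊕_ {F} {G} F∈ G∈)
    with divides-combination ω gen∣ F∈ | divides-combination ω gen∣ G∈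
  ... | x , F≈ | y , G≈ = x + y , (begin
    Σ< (suc m) (λ k → ω k * (F k + G k))
      ≈⟨ Σ<-cong (suc m) (λ k _ → distribˡ (ω k) (F k) (G k)) ⟩
    Σ< (suc m) (λ k → ω k * F k + ω k * G k)
      ≈⟨ Σ<-+ (suc m) (λ k → ω k * F k) (λ k → ω k * G k) ⟩
    Σ< (suc m) (λ k → ω k * F k) + Σ< (suc m) (λ k → ω k * G k)
      ≈⟨ +-cong F≈ G≈ ⟩
    a * x + a * y
      ≈⟨ distribˡ _ _ _ ⟨
    a * (x + y) ∎)
  divides-combination ω {a} gen∣ (scale b {F} F∈) with divides-combination ω gen∣ F∈
  ... | x , F≈ = b * x , (begin
    Σ< (suc m) (λ k → ω k * (b * F k))
      ≈⟨ Σ<-cong (suc m) (λ k _ → solve 3 (λ a b c → a :* (b :* c) := b :* (a :* c)) refl (ω k) b (F k)) ⟩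
    Σ< (suc m) (λ k → b * (ω k * F k))
      ≈⟨ Σ<-* (suc m) b (λ k → ω k * F k) ⟩
    b * Σ< (suc m) (λ k → ω k * F k)
      ≈⟨ *-congˡ F≈ ⟩
    b * (a * x)
      ≈⟨ solve 3 (λ a b c → a :* (b :* c) := b :* (a :* c)) refl b a x ⟩
    a * (b * x) ∎)
  divides-combination ω {a} gen∣ (resp {F} {G} F≈G F∈) with divides-combination ω gen∣ F∈
  ... | x , F≈ = x , trans (Σ<-cong (suc m) (λ k k≤m → *-congˡ {ω k} (sym (F≈G k (ℕ.≤-pred k≤m))))) F≈

  -- Since q^l S(k) = [l+k+1] - [l-k], each term is a difference whose second part is, by `step`,
  -- the first part at k + 1. Only [l+1] E(0) survives.
  plain-sum : ∀ p → Admissible p → base-divisor ∣ Σ< (suc m) (λ k → S k * E p k)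
  plain-sum p adm with boundary p adm
  ... | x , boundary≈ = q⁻¹ ^ l p * x , (begin
    Σ< (suc m) (λ k → S k * E p k)
      ≈⟨ q⁻^-move (l p) (trans (sym (Σ<-* (suc m) (q ^ l p) (λ k → S k * E p k)))
           (telescope m _ (λ k → [ l p ℕ.+ suc k ] * E p k) (λ k → [ l p ∸ k ] * E p k)
             (λ k k≤m → difference′ k (ℕ.≤-pred k≤m)) (λ k k<m → step p k adm k<m)
             (0*ˡ (reflexive (≡.cong [_] (ℕ.m≤n⇒m∸n≡0 (ℕ.m∸n≤m m (p true)))))))) ⟩
    q⁻¹ ^ l p * ([ l p ℕ.+ 1 ] * E p 0)
      ≈⟨ *-congˡ (trans (*-congʳ (reflexive (≡.cong [_] (ℕ.+-comm (l p) 1)))) boundary≈) ⟩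
    q⁻¹ ^ l p * (base-divisor * x)
      ≈⟨ solve 3 (λ a b c → a :* (b :* c) := b :* (a :* c)) refl _ base-divisor _ ⟩
    base-divisor * (q⁻¹ ^ l p * x) ∎)
    where
    difference′ : ∀ k → k ℕ.≤ m →
      q ^ l p * (S k * E p k) ≈ [ l p ℕ.+ suc k ] * E p k - [ l p ∸ k ] * E p k
    difference′ k k≤m with cell p k adm k≤m
    ... | inj₂ M<x = trans (0*ʳ (0*ʳ (E-vanish p k M<x)))
      (sym (trans (+-cong (0*ʳ (E-vanish p k M<x)) (-‿cong (0*ʳ (E-vanish p k M<x)))) (-‿inverseʳ 0#)))
    ... | inj₁ c = begin
      q ^ l p * (S k * E p k)
        ≈⟨ *-assoc _ _ _ ⟨
      q ^ l p * S k * E p k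
        ≈⟨ *-congʳ (trans (*-congʳ (^-cong top)) (q^*S k (d true))) ⟩
      ([ d true ℕ.+ suc (k ℕ.+ k) ] - [ d true ]) * E p k
        ≈⟨ *-congʳ (reflexive (≡.cong₂ (λ a b → [ a ] - [ b ]) (≡.sym (cell-l+1+k c)) (≡.sym (cell-l∸k c)))) ⟩
      ([ l p ℕ.+ suc k ] - [ l p ∸ k ]) * E p k
        ≈⟨ solve 3 (λ a b e → (a :- b) :* e := a :* e :- b :* e) refl _ _ (E p k) ⟩
      [ l p ℕ.+ suc k ] * E p k - [ l p ∸ k ] * E p k ∎
      where open Cell c

  ε ω : ℕ → Carrier
  ε k = (- 1#) ^ k * q ^ choose2 k
  ω k = ε k * [ suc (k ℕ.+ k) ]

  ε-suc : ∀ k → ε (suc k) ≈ - (ε k * q ^ k)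
  ε-suc k = trans (*-congˡ (^-homo-* q k (choose2 k)))
    (solve 3 (λ s a b → :- con (+ 1) :* s :* (a :* b) := :- (s :* b :* a)) refl _ _ _)

  -- From [l] [2k+1] = [k] [l+k+1] + q^k [k+1] [l-k] and the recurrence of ε, the sum telescopes
  -- after multiplication by [l]. The boundary term contains [0], so the sum is zero unless l = 0;
  -- in that case the kernel lives at k = 0 alone.
  alternating-sum : ∀ p → Admissible p → base-divisor ∣ Σ< (suc m) (λ k → ω k * E p k)
  alternating-sum p adm = by-l (l p) ≡.refl
    where
    τ σ : ℕ → Carrier
    τ k = ε k * [ k ] * ([ l p ℕ.+ suc k ] * E p k)
    σ k = - (ε k * q ^ k) * [ suc k ] * ([ l p ∸ k ] * E p k)
    difference′ : ∀ k → k ℕ.≤ m → [ l p ] * (ω k * E p k) ≈ τ k - σ k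
    difference′ k k≤m with cell p k adm k≤m
    ... | inj₂ M<x = trans (0*ʳ (0*ʳ (E-vanish p k M<x))) (sym (trans
      (+-cong (0*ʳ (0*ʳ (E-vanish p k M<x))) (-‿cong (0*ʳ (0*ʳ (E-vanish p k M<x))))) (-‿inverseʳ 0#)))
    ... | inj₁ cl = begin
      [ l p ] * (e * [ suc (k ℕ.+ k) ] * E p k)
        ≈⟨ *-cong (trans (reflexive (≡.cong [_] top)) (trans ([+] k c) (+-congˡ (*-congʳ (^≈1-[] k)))))
             (*-congʳ (*-congˡ (trans ([1+2k] k) (+-congˡ (*-congˡ (+-congˡ (*-congʳ (^≈1-[] k)))))))) ⟩
      (U + u * V) * (e * (1# + q * (U + u * U)) * E p k)
        ≈⟨ solve 5 (λ e q U V E → let i = con (+ 1); u = i :- (i :- q) :* U; v = i :- (i :- q) :* V in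
             (U :+ u :* V) :* (e :* (i :+ q :* (U :+ u :* U)) :* E)
               := e :* U :* ((V :+ v :* (i :+ q :* (U :+ u :* U))) :* E)
                    :- :- (e :* u) :* (i :+ q :* U) :* (V :* E)) refl e q U V (E p k) ⟩
      e * U * ((V + v * (1# + q * (U + u * U))) * E p k) - - (e * u) * (1# + q * U) * (V * E p k)
        ≈⟨ +-cong (*-congˡ (*-congʳ (trans
               (+-congˡ (*-cong (sym (^≈1-[] c)) (+-congˡ (*-congˡ (+-congˡ (*-congʳ (sym (^≈1-[] k))))))))
               (trans (sym ([c+1+2k] c k)) (reflexive (≡.cong [_] (≡.sym (cell-l+1+k cl))))))))
             (-‿cong (*-cong (*-congʳ (-‿cong (*-congˡ (sym (^≈1-[] k)))))
               (*-congʳ (reflexive (≡.cong [_] (≡.sym (cell-l∸k cl))))))) ⟩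
      τ k - σ k ∎
      where
      open Cell cl
      c = d true
      e = ε k
      U = [ k ]
      V = [ c ]
      u = 1# - (1# - q) * U
      v = 1# - (1# - q) * V
    sum≈0 : [ l p ] * Σ< (suc m) (λ k → ω k * E p k) ≈ 0#
    sum≈0 = begin
      [ l p ] * Σ< (suc m) (λ k → ω k * E p k)
        ≈⟨ Σ<-* (suc m) [ l p ] (λ k → ω k * E p k) ⟨
      Σ< (suc m) (λ k → [ l p ] * (ω k * E p k))
        ≈⟨ telescope m _ τ σ (λ k k≤m → difference′ k (ℕ.≤-pred k≤m))
             (λ k k<m → *-cong (*-congʳ (sym (ε-suc k))) (step p k adm k<m))
             (0*ʳ (0*ˡ (reflexive (≡.cong [_] (ℕ.m≤n⇒m∸n≡0 (ℕ.m∸n≤m m (p true))))))) ⟩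
      τ 0
        ≈⟨ 0*ˡ (zeroʳ _) ⟩
      0# ∎
    by-l : ∀ l′ → l p ≡ l′ → base-divisor ∣ Σ< (suc m) (λ k → ω k * E p k)
    by-l (suc l′) l≡ = 0# , trans (regular l′ (trans (*-congʳ (reflexive (≡.cong [_] (≡.sym l≡))))
      (trans sum≈0 (sym (zeroʳ _))))) (sym (zeroʳ _))
    by-l zero l≡ with boundary p adm
    ... | x , boundary≈ = x , (begin
      ω 0 * E p 0 + Σ< m (λ k → ω (suc k) * E p (suc k))
        ≈⟨ +-congˡ (Σ<-zero m (λ k k<m → 0*ʳ (vanish k k<m))) ⟩
      ω 0 * E p 0 + 0#
        ≈⟨ solve 2 (λ e q → let i = con (+ 1); o = con (+ 0) in
             i :* i :* (i :+ q :* o) :* e :+ o := (i :+ q :* o) :* e) refl (E p 0) q ⟩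
      [ 1 ] * E p 0
        ≈⟨ *-congʳ (reflexive (≡.cong (λ l → [ suc l ]) (≡.sym l≡))) ⟩
      [ suc (l p) ] * E p 0
        ≈⟨ boundary≈ ⟩
      base-divisor * x ∎)
      where
      vanish : ∀ k → k ℕ.< m → E p (suc k) ≈ 0#
      vanish k k<m with cell p (suc k) adm k<m
      ... | inj₂ M<x = E-vanish p (suc k) M<x
      ... | inj₁ c with ≡.trans (≡.sym l≡) (Cell.top c)
      ...   | ()

  -- One ballot number of each size as an element of the lattice

  β : ℕ → Carrier
  β k = binom h (suc (m ℕ.+ k))

  vandermonde-edge : ∀ x y b c → x ≡ 0 ⊎ y ≡ 0 → c ℕ.< N → b ℕ.< N →
    binom (b ℕ.+ (c ℕ.+ (x ℕ.+ y))) (b ℕ.+ x)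
      ≈ Σ< N (λ g → q ^ (g ℕ.* (x ℕ.+ y ℕ.+ g)) * (binom (x ℕ.+ c) (x ℕ.+ g) * binom (y ℕ.+ b) (y ℕ.+ g)))
  vandermonde-edge x y b c (inj₂ ≡.refl) c<N _ = begin
    binom (b ℕ.+ (c ℕ.+ (x ℕ.+ 0))) (b ℕ.+ x)
      ≈⟨ binom-cong (≡.cong (λ x → b ℕ.+ (c ℕ.+ x)) (ℕ.+-identityʳ x)) ≡.refl ⟩
    binom (b ℕ.+ (c ℕ.+ x)) (b ℕ.+ x)
      ≈⟨ vandermonde b c x N c<N ⟨
    Σ< N (λ g → q ^ (g ℕ.* (x ℕ.+ g)) * (binom (c ℕ.+ x) (x ℕ.+ g) * binom b g))
      ≈⟨ Σ<-cong N (λ g _ → *-cong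
           (^-cong (≡.cong (λ x → g ℕ.* (x ℕ.+ g)) (≡.sym (ℕ.+-identityʳ x))))
           (*-congʳ (binom-cong (ℕ.+-comm c x) ≡.refl))) ⟩
    Σ< N (λ g → q ^ (g ℕ.* (x ℕ.+ 0 ℕ.+ g)) * (binom (x ℕ.+ c) (x ℕ.+ g) * binom b g)) ∎
  vandermonde-edge x y b c (inj₁ ≡.refl) _ b<N = begin
    binom (b ℕ.+ (c ℕ.+ y)) (b ℕ.+ 0)
      ≈⟨ binom-cong {b ℕ.+ (c ℕ.+ y)} ≡.refl (ℕ.+-identityʳ b) ⟩
    binom (b ℕ.+ (c ℕ.+ y)) b
      ≈⟨ binom-sym b (c ℕ.+ y) ⟩
    binom (b ℕ.+ (c ℕ.+ y)) (c ℕ.+ y)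
      ≈⟨ binom-cong (e b c y) ≡.refl ⟩
    binom (c ℕ.+ (b ℕ.+ y)) (c ℕ.+ y)
      ≈⟨ vandermonde c b y N b<N ⟨
    Σ< N (λ g → q ^ (g ℕ.* (y ℕ.+ g)) * (binom (b ℕ.+ y) (y ℕ.+ g) * binom c g))
      ≈⟨ Σ<-cong N (λ g _ → *-congˡ (trans (*-comm _ _) (*-congˡ (binom-cong (ℕ.+-comm b y) ≡.refl)))) ⟩
    Σ< N (λ g → q ^ (g ℕ.* (y ℕ.+ g)) * (binom c g * binom (y ℕ.+ b) (y ℕ.+ g))) ∎
    where
    e : ∀ b c y → b ℕ.+ (c ℕ.+ y) ≡ c ℕ.+ (b ℕ.+ y)
    e = solve-∀

  -- The starting index is the one with l = min(m, n), where x or y is zero. One binomial then has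
  -- lower index g itself, so `β k`, which is [m+n+1 ; n-k] for k ≤ n, is a plain Vandermonde sum
  -- whose coefficients are powers of q.
  Γβ∈-from : ∀ p → Admissible p → p true ≡ 0 ⊎ p false ≡ 0 → Span (λ k → Γ k * β k)
  Γβ∈-from p adm x≡0⊎y≡0 =
    expand-span p adm (λ g → q ^ (g ℕ.* (x ℕ.+ y ℕ.+ g)))
      (λ g → gen (p ⊞ g) (⊞-admissible p g adm)) β-vanish (λ k → ⊞-vanish p k) (expand x≡0⊎y≡0)
    where
    x = p true
    y = p false
    β-vanish : ∀ k → M true k ℕ.< x → β k ≈ 0#
    β-vanish k M<x = binom-< (s≤s (ℕ.+-monoʳ-< m (ℕ.+-cancelˡ-< x n k (ℕ.≤-<-trans
        (ℕ.≤-reflexive (≡.trans adm (≡.cong (ℕ._+ m) (y≡0 x≡0⊎y≡0))))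
        (ℕ.≤-<-trans (ℕ.m≤n+m∸n m k) (ℕ.<-≤-trans (ℕ.+-monoʳ-< k M<x) (ℕ.≤-reflexive (ℕ.+-comm k x))))))))
      where
      y≡0 : x ≡ 0 ⊎ y ≡ 0 → y ≡ 0
      y≡0 (inj₁ x≡0) with ≡.subst (m ∸ k ℕ.<_) x≡0 M<x
      ... | ()
      y≡0 (inj₂ y≡0) = y≡0
    expand : x ≡ 0 ⊎ y ≡ 0 → ∀ k → Cell p k →
      β k ≈ Σ< N (λ g → q ^ (g ℕ.* (x ℕ.+ y ℕ.+ g)) * B (p ⊞ g) k)
    expand x≡0⊎y≡0 k cl = begin
      binom h (suc (m ℕ.+ k))
        ≈⟨ binom-cong h≡ m+k≡ ⟩
      binom (b ℕ.+ (c ℕ.+ (x ℕ.+ y))) (b ℕ.+ x)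
        ≈⟨ vandermonde-edge x y b c x≡0⊎y≡0 (d< true) (d< false) ⟩
      Σ< N (λ g → q ^ (g ℕ.* (x ℕ.+ y ℕ.+ g)) * (binom (x ℕ.+ c) (x ℕ.+ g) * binom (y ℕ.+ b) (y ℕ.+ g)))
        ≈⟨ Σ<-cong N (λ g _ → *-congˡ (*-cong (binom-cong (≡.sym (M≡ true)) ≡.refl)
             (binom-cong (≡.sym (M≡ false)) ≡.refl))) ⟩
      Σ< N (λ g → q ^ (g ℕ.* (x ℕ.+ y ℕ.+ g)) * B (p ⊞ g) k) ∎
      where
      open Cell cl
      c = d true
      b = d false
      m≡ : m ≡ x ℕ.+ (k ℕ.+ c)
      m≡ = ≡.trans (≡.sym (ℕ.m+[n∸m]≡n (ℕ.≤-trans (ℕ.m≤m+n x c)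
        (ℕ.≤-trans (ℕ.≤-reflexive (≡.sym (M≡ true))) (ℕ.m∸n≤m m k))))) (≡.cong (x ℕ.+_) top)
      m+k≡ : suc (m ℕ.+ k) ≡ b ℕ.+ x
      m+k≡ = ≡.trans (≡.cong (λ m → suc (m ℕ.+ k)) m≡)
        (≡.trans (e x k c) (≡.cong (ℕ._+ x) (≡.sym d-false)))
        where
        e : ∀ x k c → suc (x ℕ.+ (k ℕ.+ c) ℕ.+ k) ≡ c ℕ.+ suc (k ℕ.+ k) ℕ.+ x
        e = solve-∀
      h≡ : h ≡ b ℕ.+ (c ℕ.+ (x ℕ.+ y))
      h≡ = ≡.trans (≡.cong (λ m → suc (m ℕ.+ n)) m≡) (≡.trans (e₁ x k c n)
        (≡.trans (≡.cong (x ℕ.+ c ℕ.+_) (M≡ false)) (e₂ x c y b)))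
        where
        e₁ : ∀ x k c n → suc (x ℕ.+ (k ℕ.+ c) ℕ.+ n) ≡ x ℕ.+ c ℕ.+ suc (n ℕ.+ k)
        e₁ = solve-∀
        e₂ : ∀ x c y b → x ℕ.+ c ℕ.+ (y ℕ.+ b) ≡ b ℕ.+ (c ℕ.+ (x ℕ.+ y))
        e₂ = solve-∀

  Γβ∈ : Span (λ k → Γ k * β k)
  Γβ∈ with ℕ.≤-total m n
  ... | inj₁ m≤n = Γβ∈-from (λ { true → 0 ; false → n ∸ m }) (≡.sym (ℕ.m∸n+n≡m m≤n)) (inj₁ ≡.refl)
  ... | inj₂ n≤m = Γβ∈-from (λ { true → m ∸ n ; false → 0 }) (ℕ.m∸n+n≡m n≤m) (inj₂ ≡.refl)

  A≈ballot′ : ∀ s k → k ℕ.≤ m → A s k ≈ ballot′ (size s) k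
  A≈ballot′ true  k k≤m = ballot′-reflect m k k≤m
  A≈ballot′ false k k≤m = refl

  -- The closed form of the ballot number with denominators cleared, where a = k + e: the bracket
  -- [a+k+1] - [a-k] left by the subtraction is q^a S(k).
  ballot′-! : ∀ k e → ballot′ (k ℕ.+ e) k * ([ e ]! * [ suc (k ℕ.+ e ℕ.+ k) ]!)
    ≈ [ 2 ℕ.* (k ℕ.+ e) ]! * (q ^ (k ℕ.+ e) * S k)
  ballot′-! k e = begin
    (binom 2a f - binom 2a (suc f)) * ([ e ]! * ([ suc f ] * [ f ]!))
      ≈⟨ solve 5 (λ x y e n f → (x :- y) :* (e :* (n :* f))
           := n :* (x :* (f :* e)) :- y :* ((n :* f) :* e)) refl _ _ _ _ _ ⟩
    [ suc f ] * (binom 2a f * ([ f ]! * [ e ]!)) - binom 2a (suc f) * ([ suc f ]! * [ e ]!)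
      ≈⟨ +-cong (*-congˡ full) (-‿cong (lowered e ≡.refl)) ⟩
    [ suc f ] * [ 2a ]! - [ e ] * [ 2a ]!
      ≈⟨ solve 3 (λ a b c → a :* c :- b :* c := c :* (a :- b)) refl _ _ _ ⟩
    [ 2a ]! * ([ suc f ] - [ e ])
      ≈⟨ *-congˡ (trans (q^*S k e) (+-congʳ (reflexive (≡.cong [_] (e₂ k e))))) ⟨
    [ 2a ]! * (q ^ (k ℕ.+ e) * S k) ∎
    where
    2a = 2 ℕ.* (k ℕ.+ e)
    f = k ℕ.+ e ℕ.+ k
    e₁ : ∀ k e → k ℕ.+ e ℕ.+ k ℕ.+ e ≡ 2 ℕ.* (k ℕ.+ e)
    e₁ = solve-∀
    e₂ : ∀ k e → e ℕ.+ suc (k ℕ.+ k) ≡ suc (k ℕ.+ e ℕ.+ k)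
    e₂ = solve-∀
    full : binom 2a f * ([ f ]! * [ e ]!) ≈ [ 2a ]!
    full = trans (*-congʳ (binom-cong (≡.sym (e₁ k e)) ≡.refl))
      (trans (binom-! f e) (reflexive (≡.cong [_]! (e₁ k e))))
    lowered : ∀ e′ → e ≡ e′ → binom 2a (suc f) * ([ suc f ]! * [ e ]!) ≈ [ e ] * [ 2a ]!
    lowered zero ≡.refl = trans (0*ˡ (binom-< (s≤s (ℕ.≤-reflexive (≡.trans (≡.sym (e₁ k 0)) (ℕ.+-identityʳ _))))))
      (sym (zeroˡ _))
    lowered (suc e′) ≡.refl = begin
      binom 2a (suc f) * ([ suc f ]! * ([ suc e′ ] * [ e′ ]!))
        ≈⟨ solve 4 (λ x y n f → x :* (y :* (n :* f)) := n :* (x :* (y :* f))) refl _ _ _ _ ⟩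
      [ suc e′ ] * (binom 2a (suc f) * ([ suc f ]! * [ e′ ]!))
        ≈⟨ *-congˡ (*-congʳ (binom-cong (≡.sym eq) ≡.refl)) ⟩
      [ suc e′ ] * (binom (suc f ℕ.+ e′) (suc f) * ([ suc f ]! * [ e′ ]!))
        ≈⟨ *-congˡ (trans (binom-! (suc f) e′) (reflexive (≡.cong [_]! eq))) ⟩
      [ suc e′ ] * [ 2a ]! ∎
      where
      eq : suc f ℕ.+ e′ ≡ 2a
      eq = ≡.trans (≡.sym (ℕ.+-suc f e′)) (e₁ k (suc e′))

  -- The four factorials in the denominators are paired crosswise: [m-k]! with [n+k+1]! gives Γ, and
  -- [m+k+1]! with [n-k]! gives β. This replaces the tops 2m and 2n by m + n + 1.
  ballots-! : ∀ k → k ℕ.≤ m → [ h ]! * [ h ]! * (ballot′ m k * ballot′ n k)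
    ≈ [ 2 ℕ.* m ]! * [ 2 ℕ.* n ]! * q ^ (m ℕ.+ n) * (S k * S k * (Γ k * β k))
  ballots-! k k≤m with ℕ.≤-<-connex k n
  ... | inj₂ n<k = trans
    (0*ʳ (0*ʳ (trans (+-cong (binom-< 2n<) (-‿cong (binom-< (ℕ.m≤n⇒m≤1+n 2n<)))) (-‿inverseʳ 0#))))
    (sym (0*ʳ (0*ʳ (0*ʳ (binom-< (s≤s (ℕ.+-monoʳ-< m n<k)))))))
    where
    2n< : 2 ℕ.* n ℕ.< n ℕ.+ k
    2n< = ℕ.≤-<-trans (ℕ.≤-reflexive (≡.cong (n ℕ.+_) (ℕ.+-identityʳ n))) (ℕ.+-monoʳ-< n n<k)
  ... | inj₁ k≤n with ℕ.m≤n⇒∃[o]m+o≡n k≤m | ℕ.m≤n⇒∃[o]m+o≡n k≤n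
  ...   | e , k+e≡m | f , k+f≡n = begin
    [ h ]! * [ h ]! * (ballot′ m k * ballot′ n k)
      ≈⟨ *-congʳ (*-cong Γ! β!) ⟨
    Γ k * ([ e ]! * [ suc (n ℕ.+ k) ]!) * (β k * ([ suc (m ℕ.+ k) ]! * [ f ]!))
      * (ballot′ m k * ballot′ n k)
      ≈⟨ solve 8 (λ g e n b m f x y → g :* (e :* n) :* (b :* (m :* f)) :* (x :* y)
           := g :* b :* (x :* (e :* m)) :* (y :* (f :* n))) refl _ _ _ _ _ _ _ _ ⟩
    Γ k * β k * (ballot′ m k * ([ e ]! * [ suc (m ℕ.+ k) ]!))
      * (ballot′ n k * ([ f ]! * [ suc (n ℕ.+ k) ]!))
      ≈⟨ *-cong (*-congˡ (factor k+e≡m)) (factor k+f≡n) ⟩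
    Γ k * β k * ([ 2 ℕ.* m ]! * (q ^ m * S k)) * ([ 2 ℕ.* n ]! * (q ^ n * S k))
      ≈⟨ solve 6 (λ g a x s b y → g :* (a :* (x :* s)) :* (b :* (y :* s))
           := a :* b :* (x :* y) :* (s :* s :* g)) refl _ _ _ _ _ _ ⟩
    [ 2 ℕ.* m ]! * [ 2 ℕ.* n ]! * (q ^ m * q ^ n) * (S k * S k * (Γ k * β k))
      ≈⟨ *-congʳ (*-congˡ (^-homo-* q m n)) ⟨
    [ 2 ℕ.* m ]! * [ 2 ℕ.* n ]! * q ^ (m ℕ.+ n) * (S k * S k * (Γ k * β k)) ∎
    where
    factor : ∀ {a e} → k ℕ.+ e ≡ a →
      ballot′ a k * ([ e ]! * [ suc (a ℕ.+ k) ]!) ≈ [ 2 ℕ.* a ]! * (q ^ a * S k)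
    factor {e = e} ≡.refl = ballot′-! k e
    h≡ : e ℕ.+ suc (n ℕ.+ k) ≡ h
    h≡ = ≡.trans (e₁ e n k) (≡.cong (λ m → suc (m ℕ.+ n)) k+e≡m)
      where
      e₁ : ∀ e n k → e ℕ.+ suc (n ℕ.+ k) ≡ suc (k ℕ.+ e ℕ.+ n)
      e₁ = solve-∀
    h≡′ : suc (m ℕ.+ k) ℕ.+ f ≡ h
    h≡′ = ≡.trans (≡.cong suc (ℕ.+-assoc m k f)) (≡.cong (λ n → suc (m ℕ.+ n)) k+f≡n)
    Γ! : Γ k * ([ e ]! * [ suc (n ℕ.+ k) ]!) ≈ [ h ]!
    Γ! = trans (*-congʳ (binom-cong (≡.sym h≡)
        (≡.trans (≡.cong (_∸ k) (≡.sym k+e≡m)) (ℕ.m+n∸m≡n k e))))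
      (trans (binom-! e (suc (n ℕ.+ k))) (reflexive (≡.cong [_]! h≡)))
    β! : β k * ([ suc (m ℕ.+ k) ]! * [ f ]!) ≈ [ h ]!
    β! = trans (*-congʳ (binom-cong {k = suc (m ℕ.+ k)} (≡.sym h≡′) ≡.refl))
      (trans (binom-! (suc (m ℕ.+ k)) f) (reflexive (≡.cong [_]! h≡′)))

  -- Divisibility of the full sums

  -- Of the two S released by `ballots-!`, one combines with δ to form the weight θ of a sum already
  -- treated; the other raises the exponent r in `W` to r + 1.
  divisibility : ∀ (θ δ : ℕ → Carrier) →
    (∀ k → S k * δ k ≈ θ k) →
    (∀ p → Admissible p → base-divisor ∣ Σ< (suc m) (λ k → θ k * E p k)) →
    ∀ j r s t → Even (s ℕ.+ (t ℕ.+ suc r)) →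
    ∃ λ L → [ h ]
        * Σ< (suc m) (λ k → δ k * Q k ^ j * S k ^ r * ballot′ m k ^ suc s * ballot′ n k ^ suc t)
        * ([ m ℕ.+ n ]! * [ m ]! * [ n ]!)
      ≈ [ 2 ℕ.* m ]! * [ 2 ℕ.* n ]! * L
  divisibility θ δ Sδ≈θ gen∣ j r s t even =
    let L , sum≈ = divides-combination θ gen∣ (preserves-^ j Q-preserves (W-preserves r s t even Γβ∈)) in
    -- Clearing Γ and β takes [h]! twice. One copy is [h] [m+n]!, which uses the prefactor of the
    -- sum; the other is the one cancelled here, returned on the right by `base-divisor` as [h]
    -- [m+n ; m] [m]! [n]!.
    q ^ (m ℕ.+ n) * L , !-cancelʳ h (begin
    [ h ] * Σterm * ([ m ℕ.+ n ]! * [ m ]! * [ n ]!) * [ h ]!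
      ≈⟨ solve 6 (λ h x a b c d → h :* x :* (a :* b :* c) :* d := b :* c :* (h :* a :* d :* x)) refl _ _ _ _ _ _ ⟩
    [ m ]! * [ n ]! * ([ h ]! * [ h ]! * Σterm)
      ≈⟨ *-congˡ (trans (sym (Σ<-* (suc m) _ term))
           (trans (Σ<-cong (suc m) (λ k k≤m → term≈ k (ℕ.≤-pred k≤m)))
           (trans (Σ<-* (suc m) C (λ k → θ k * weighted k)) (*-congˡ sum≈)))) ⟩
    [ m ]! * [ n ]! * (C * (base-divisor * L))
      ≈⟨ solve 8 (λ a b x y z h c l → a :* b :* (x :* y :* z :* (h :* c :* l))
           := x :* y :* (z :* l) :* (h :* (c :* (a :* b)))) refl _ _ _ _ _ _ _ _ ⟩
    [ 2 ℕ.* m ]! * [ 2 ℕ.* n ]! * (q ^ (m ℕ.+ n) * L) * ([ h ] * (binom (m ℕ.+ n) m * ([ m ]! * [ n ]!)))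
      ≈⟨ *-congˡ (*-congˡ (binom-! m n)) ⟩
    [ 2 ℕ.* m ]! * [ 2 ℕ.* n ]! * (q ^ (m ℕ.+ n) * L) * [ h ]! ∎)
    where
    C = [ 2 ℕ.* m ]! * [ 2 ℕ.* n ]! * q ^ (m ℕ.+ n)
    term weighted : ℕ → Carrier
    term k = δ k * Q k ^ j * S k ^ r * ballot′ m k ^ suc s * ballot′ n k ^ suc t
    weighted k = Q k ^ j * (W (suc r) s t k * (Γ k * β k))
    Σterm = Σ< (suc m) term
    term≈ : ∀ k → k ℕ.≤ m → [ h ]! * [ h ]! * term k ≈ C * (θ k * weighted k)
    term≈ k k≤m = begin
      [ h ]! * [ h ]! * term k
        ≈⟨ solve 8 (λ h d Q S a b as bt → h :* h :* (d :* Q :* S :* (a :* as) :* (b :* bt))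
             := h :* h :* (a :* b) :* (d :* Q :* S :* (as :* bt)))
             refl [ h ]! (δ k) (Q k ^ j) (S k ^ r) (ballot′ m k) (ballot′ n k) (ballot′ m k ^ s) (ballot′ n k ^ t) ⟩
      [ h ]! * [ h ]! * (ballot′ m k * ballot′ n k)
        * (δ k * Q k ^ j * S k ^ r * (ballot′ m k ^ s * ballot′ n k ^ t))
        ≈⟨ *-cong (ballots-! k k≤m) (*-congˡ (*-congʳ (^-congˡ s (sym (A≈ballot′ true k k≤m))))) ⟩
      C * (S k * S k * (Γ k * β k)) * (δ k * Q k ^ j * S k ^ r * (A true k ^ s * A false k ^ t))
        ≈⟨ solve 8 (λ C S g d Q Sr as bt → C :* (S :* S :* g) :* (d :* Q :* Sr :* (as :* bt))
             := C :* (S :* d :* (Q :* (S :* Sr :* (as :* bt) :* g))))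
             refl C (S k) (Γ k * β k) (δ k) (Q k ^ j) (S k ^ r) (A true k ^ s) (A false k ^ t) ⟩
      C * (S k * δ k * weighted k)
        ≈⟨ *-congˡ (*-congʳ (Sδ≈θ k)) ⟩
      C * (θ k * weighted k) ∎

  ballots : ℕ → ℕ → ℕ → Carrier → Carrier
  ballots s t k x = x * ballot′ m k ^ suc s * ballot′ n k ^ suc t

  IsModulus′ : Carrier → Set
  IsModulus′ D = D * ([ m ℕ.+ n ]! * [ m ]! * [ n ]!) ≈ [ 2 ℕ.* m ]! * [ 2 ℕ.* n ]!

  modulus-divides : ∀ (θ δ prefactor : ℕ → Carrier) j r s t →
    (∀ k → S k * δ k ≈ θ k) →
    (∀ p → Admissible p → base-divisor ∣ Σ< (suc m) (λ k → θ k * E p k)) →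
    (∀ k → prefactor k ≈ δ k * Q k ^ j * S k ^ r) →
    Even (s ℕ.+ (t ℕ.+ suc r)) →
    ∀ {D} → IsModulus′ D → D ∣ [ h ] * Σ< (suc m) (λ k → ballots s t k (prefactor k))
  modulus-divides θ δ prefactor j r s t Sδ≈θ gen∣ prefactor≈ even {D} D-modulus =
    let L , sum≈ = divisibility θ δ Sδ≈θ gen∣ j r s t even in
    L , trans (*-congˡ (Σ<-cong (suc m) {λ k → ballots s t k (prefactor k)} {term}
      (λ k _ → *-congʳ (*-congʳ (prefactor≈ k)))))
    (!-cancelʳ (m ℕ.+ n) (!-cancelʳ m (!-cancelʳ n (begin
      total * [ m ℕ.+ n ]! * [ m ]! * [ n ]!
        ≈⟨ solve 4 (λ x a b c → x :* a :* b :* c := x :* (a :* b :* c)) refl _ _ _ _ ⟩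
      total * ([ m ℕ.+ n ]! * [ m ]! * [ n ]!)
        ≈⟨ sum≈ ⟩
      [ 2 ℕ.* m ]! * [ 2 ℕ.* n ]! * L
        ≈⟨ *-congʳ D-modulus ⟨
      D * ([ m ℕ.+ n ]! * [ m ]! * [ n ]!) * L
        ≈⟨ solve 5 (λ d l a b c → d :* (a :* b :* c) :* l := d :* l :* a :* b :* c) refl _ _ _ _ _ ⟩
      D * L * [ m ℕ.+ n ]! * [ m ]! * [ n ]! ∎))))
    where
    term : ℕ → Carrier
    term k = ballots s t k (δ k * Q k ^ j * S k ^ r)
    total : Carrier
    total = [ h ] * Σ< (suc m) term

  Q^≈ : ∀ j k → q ^ (j ℕ.* (k ℕ.* k ℕ.+ k)) ≈ Q k ^ j
  Q^≈ j k = trans (^-cong (ℕ.*-comm j (k ℕ.* k ℕ.+ k))) (sym (^-assocʳ q (k ℕ.* k ℕ.+ k) j))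

  S^≈ : ∀ r k → q⁻¹ ^ (r ℕ.* k) * [ suc (k ℕ.+ k) ] ^ r ≈ S k ^ r
  S^≈ r k = trans (*-congʳ (trans (reflexive (≡.cong (q⁻¹ ^_) (ℕ.*-comm r k))) (sym (^-assocʳ q⁻¹ k r))))
    (sym (^-distrib-* (q⁻¹ ^ k) [ suc (k ℕ.+ k) ] r))

  -- The exponent -(r-1) k is split into k, which goes to δ and offsets the q^(-k) of one S, and -r
  -- k, which completes [2k+1]^r to S^r.
  plain-prefactor alternating-prefactor : ℕ → ℕ → ℕ → Carrier
  plain-prefactor j r k = q ^ (j ℕ.* (k ℕ.* k ℕ.+ k)) * q⁻¹ ^ (r ℕ.* k) * [ suc (k ℕ.+ k) ] ^ r
  alternating-prefactor j r k =
    (- 1#) ^ k * (q ^ (choose2 k ℕ.+ j ℕ.* (k ℕ.* k ℕ.+ k) ℕ.+ k) * q⁻¹ ^ (r ℕ.* k)) * [ suc (k ℕ.+ k) ] ^ r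

  modulus-divides-plain : ∀ j r s t → Even (s ℕ.+ (t ℕ.+ suc r)) →
    ∀ {D} → IsModulus′ D → D ∣ [ h ] * Σ< (suc m) (λ k → ballots s t k (plain-prefactor j r k))
  modulus-divides-plain j r s t = modulus-divides S (λ _ → 1#) (plain-prefactor j r) j r s t
    (λ k → *-identityʳ (S k)) plain-sum
    (λ k → trans (*-assoc _ _ _) (*-cong (trans (Q^≈ j k) (sym (*-identityˡ _))) (S^≈ r k)))

  modulus-divides-alternating : ∀ j r s t → Even (s ℕ.+ (t ℕ.+ suc r)) →
    ∀ {D} → IsModulus′ D → D ∣ [ h ] * Σ< (suc m) (λ k → ballots s t k (alternating-prefactor j r k))
  modulus-divides-alternating j r s t =
    modulus-divides ω (λ k → ε k * q ^ k) (alternating-prefactor j r) j r s t S-weight alternating-sum weight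
    where
    S-weight : ∀ k → S k * (ε k * q ^ k) ≈ ω k
    S-weight k = begin
      q⁻¹ ^ k * [ suc (k ℕ.+ k) ] * (ε k * q ^ k)
        ≈⟨ solve 4 (λ i a e u → i :* a :* (e :* u) := i :* u :* (e :* a)) refl _ _ _ _ ⟩
      q⁻¹ ^ k * q ^ k * ω k
        ≈⟨ *-congʳ (q⁻^*q^≈1 k) ⟩
      1# * ω k
        ≈⟨ *-identityˡ _ ⟩
      ω k ∎
    weight : ∀ k → alternating-prefactor j r k ≈ ε k * q ^ k * Q k ^ j * S k ^ r
    weight k = begin
      σ * (q ^ (choose2 k ℕ.+ J ℕ.+ k) * i) * x
        ≈⟨ *-congʳ (*-congˡ (*-congʳ (trans (^-homo-* q (choose2 k ℕ.+ J) k)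
             (*-congʳ (^-homo-* q (choose2 k) J))))) ⟩
      σ * (q ^ choose2 k * q ^ J * q ^ k * i) * x
        ≈⟨ solve 6 (λ σ c J k i x → σ :* (c :* J :* k :* i) :* x := σ :* c :* k :* J :* (i :* x))
             refl σ _ _ _ i x ⟩
      ε k * q ^ k * q ^ J * (i * x)
        ≈⟨ *-cong (*-congˡ (Q^≈ j k)) (S^≈ r k) ⟩
      ε k * q ^ k * Q k ^ j * S k ^ r ∎
      where
      J = j ℕ.* (k ℕ.* k ℕ.+ k)
      σ = (- 1#) ^ k
      i = q⁻¹ ^ (r ℕ.* k)
      x = [ suc (k ℕ.+ k) ] ^ r

-- The ring of Laurent polynomials

coeff : Poly → ℕ → ℤ
coeff p i = coeffP p (+ i)

infix 4 _≋_
-- A record rather than a function type, so that the two polynomials can be recovered from the type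
-- of an equality.
record _≋_ (p r : Poly) : Set where
  constructor coefficientwise
  field at : ∀ i → coeff p i ≡ coeff r i
open _≋_

≋-refl : ∀ {p} → p ≋ p
≋-refl .at i = ≡.refl

≋-sym : ∀ {p r} → p ≋ r → r ≋ p
≋-sym p≋r .at i = ≡.sym (p≋r .at i)

≋-trans : ∀ {p r s} → p ≋ r → r ≋ s → p ≋ s
≋-trans p≋r r≋s .at i = ≡.trans (p≋r .at i) (r≋s .at i)

coeff-+ : ∀ p r i → coeff (p +P r) i ≡ coeff p i ℤ.+ coeff r i
coeff-+ []      r       i       = ≡.sym (ℤ.+-identityˡ _)
coeff-+ (x ∷ p) []      i       = ≡.sym (ℤ.+-identityʳ _)
coeff-+ (x ∷ p) (y ∷ r) zero    = ≡.refl
coeff-+ (x ∷ p) (y ∷ r) (suc i) = coeff-+ p r i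

coeff-scale : ∀ c p i → coeff (scaleP c p) i ≡ c ℤ.* coeff p i
coeff-scale c []      i       = ≡.sym (ℤ.*-zeroʳ c)
coeff-scale c (x ∷ p) zero    = ≡.refl
coeff-scale c (x ∷ p) (suc i) = coeff-scale c p i

coeff-* : ∀ x p r i → coeff ((x ∷ p) *P r) i ≡ x ℤ.* coeff r i ℤ.+ coeff (+ 0 ∷ p *P r) i
coeff-* x p r i = ≡.trans (coeff-+ (scaleP x r) _ i) (≡.cong (ℤ._+ _) (coeff-scale x r i))

+P-cong : ∀ {p p′ r r′} → p ≋ p′ → r ≋ r′ → p +P r ≋ p′ +P r′
+P-cong {p} {p′} {r} {r′} p≋ r≋ .at i = ≡.trans (coeff-+ p r i)
  (≡.trans (≡.cong₂ ℤ._+_ (p≋ .at i) (r≋ .at i)) (≡.sym (coeff-+ p′ r′ i)))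

∷-cong : ∀ {x p r} → p ≋ r → x ∷ p ≋ x ∷ r
∷-cong p≋r .at zero    = ≡.refl
∷-cong p≋r .at (suc i) = p≋r .at i

0∷[] : + 0 ∷ [] ≋ []
0∷[] .at zero    = ≡.refl
0∷[] .at (suc i) = ≡.refl

+P-identityʳ : ∀ p → p +P [] ≋ p
+P-identityʳ p .at i = ≡.trans (coeff-+ p [] i) (ℤ.+-identityʳ _)

scale-0 : ∀ p → scaleP (+ 0) p ≋ []
scale-0 p .at i = coeff-scale (+ 0) p i

scale-1 : ∀ p → scaleP (+ 1) p ≋ p
scale-1 p .at i = ≡.trans (coeff-scale (+ 1) p i) (ℤ.*-identityˡ _)

*P-identityˡ : ∀ p → oneP *P p ≋ p
*P-identityˡ p = ≋-trans (+P-cong (scale-1 p) 0∷[]) (+P-identityʳ p)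

0∷-* : ∀ p r → (+ 0 ∷ p) *P r ≋ + 0 ∷ p *P r
0∷-* p r = +P-cong {r = + 0 ∷ p *P r} (scale-0 r) ≋-refl

*P-congˡ : ∀ p {r r′} → r ≋ r′ → p *P r ≋ p *P r′
*P-congˡ []      r≋ = ≋-refl
*P-congˡ (x ∷ p) {r} {r′} r≋ .at i = ≡.trans (coeff-* x p r i) (≡.trans
  (≡.cong₂ ℤ._+_ (≡.cong (x ℤ.*_) (r≋ .at i)) (∷-cong (*P-congˡ p r≋) .at i)) (≡.sym (coeff-* x p r′ i)))

*P-zeroʳ : ∀ p → p *P [] ≋ []
*P-zeroʳ []      = ≋-refl
*P-zeroʳ (x ∷ p) = ≋-trans (∷-cong (*P-zeroʳ p)) 0∷[]

*P-∷ : ∀ p y r → p *P (y ∷ r) ≋ scaleP y p +P (+ 0 ∷ p *P r)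
*P-∷ []      y r = ≋-sym 0∷[]
*P-∷ (x ∷ p) y r .at zero    = ≡.cong (ℤ._+ + 0) (ℤ.*-comm x y)
*P-∷ (x ∷ p) y r .at (suc i) = begin
  coeff (scaleP x r +P p *P (y ∷ r)) i
    ≡⟨ coeff-+ (scaleP x r) _ i ⟩
  coeff (scaleP x r) i ℤ.+ coeff (p *P (y ∷ r)) i
    ≡⟨ ≡.cong₂ ℤ._+_ (coeff-scale x r i) (≡.trans (*P-∷ p y r .at i) (coeff-+ (scaleP y p) _ i)) ⟩
  x ℤ.* coeff r i ℤ.+ (coeff (scaleP y p) i ℤ.+ coeff (+ 0 ∷ p *P r) i)
    ≡⟨ swap (x ℤ.* coeff r i) (coeff (scaleP y p) i) _ ⟩
  coeff (scaleP y p) i ℤ.+ (x ℤ.* coeff r i ℤ.+ coeff (+ 0 ∷ p *P r) i)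
    ≡⟨ ≡.cong (ℤ._+_ (coeff (scaleP y p) i)) (coeff-* x p r i) ⟨
  coeff (scaleP y p) i ℤ.+ coeff ((x ∷ p) *P r) i
    ≡⟨ coeff-+ (scaleP y p) _ i ⟨
  coeff (scaleP y p +P (x ∷ p) *P r) i ∎
  where
  open ≡.≡-Reasoning
  swap : ∀ a b c → a ℤ.+ (b ℤ.+ c) ≡ b ℤ.+ (a ℤ.+ c)
  swap = ℤSolver.solve-∀

*P-comm : ∀ p r → p *P r ≋ r *P p
*P-comm []      r = ≋-sym (*P-zeroʳ r)
*P-comm (x ∷ p) r = ≋-trans (+P-cong {scaleP x r} ≋-refl (∷-cong (*P-comm p r))) (≋-sym (*P-∷ r x p))

*P-congʳ : ∀ {p p′} r → p ≋ p′ → p *P r ≋ p′ *P r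
*P-congʳ {p} {p′} r p≋ = ≋-trans (*P-comm p r) (≋-trans (*P-congˡ r p≋) (*P-comm r p′))

*P-distribˡ : ∀ p r s → p *P (r +P s) ≋ p *P r +P p *P s
*P-distribˡ []      r s = ≋-refl
*P-distribˡ (x ∷ p) r s .at i = begin
  coeff ((x ∷ p) *P (r +P s)) i
    ≡⟨ coeff-* x p (r +P s) i ⟩
  x ℤ.* coeff (r +P s) i ℤ.+ coeff (+ 0 ∷ p *P (r +P s)) i
    ≡⟨ ≡.cong₂ ℤ._+_ (≡.cong (x ℤ.*_) (coeff-+ r s i))
         (≡.trans (∷-cong (*P-distribˡ p r s) .at i) (coeff-+ (+ 0 ∷ p *P r) (+ 0 ∷ p *P s) i)) ⟩
  x ℤ.* (coeff r i ℤ.+ coeff s i) ℤ.+ (coeff (+ 0 ∷ p *P r) i ℤ.+ coeff (+ 0 ∷ p *P s) i)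
    ≡⟨ rearrange x _ _ _ _ ⟩
  x ℤ.* coeff r i ℤ.+ coeff (+ 0 ∷ p *P r) i ℤ.+ (x ℤ.* coeff s i ℤ.+ coeff (+ 0 ∷ p *P s) i)
    ≡⟨ ≡.cong₂ ℤ._+_ (coeff-* x p r i) (coeff-* x p s i) ⟨
  coeff ((x ∷ p) *P r) i ℤ.+ coeff ((x ∷ p) *P s) i
    ≡⟨ coeff-+ ((x ∷ p) *P r) _ i ⟨
  coeff ((x ∷ p) *P r +P (x ∷ p) *P s) i ∎
  where
  open ≡.≡-Reasoning
  rearrange : ∀ x a b c d → x ℤ.* (a ℤ.+ b) ℤ.+ (c ℤ.+ d) ≡ x ℤ.* a ℤ.+ c ℤ.+ (x ℤ.* b ℤ.+ d)
  rearrange = ℤSolver.solve-∀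

*P-distribʳ : ∀ p r s → (r +P s) *P p ≋ r *P p +P s *P p
*P-distribʳ p r s = ≋-trans (*P-comm (r +P s) p) (≋-trans (*P-distribˡ p r s)
  (+P-cong (*P-comm p r) (*P-comm p s)))

scale-* : ∀ c p r → scaleP c p *P r ≋ scaleP c (p *P r)
scale-* c []      r = ≋-refl
scale-* c (x ∷ p) r .at i = begin
  coeff (scaleP c (x ∷ p) *P r) i
    ≡⟨ coeff-* (c ℤ.* x) (scaleP c p) r i ⟩
  c ℤ.* x ℤ.* coeff r i ℤ.+ coeff (+ 0 ∷ scaleP c p *P r) i
    ≡⟨ ≡.cong₂ ℤ._+_ (ℤ.*-assoc c x _) (tail i) ⟩
  c ℤ.* (x ℤ.* coeff r i) ℤ.+ c ℤ.* coeff (+ 0 ∷ p *P r) i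
    ≡⟨ ℤ.*-distribˡ-+ c _ _ ⟨
  c ℤ.* (x ℤ.* coeff r i ℤ.+ coeff (+ 0 ∷ p *P r) i)
    ≡⟨ ≡.cong (c ℤ.*_) (coeff-* x p r i) ⟨
  c ℤ.* coeff ((x ∷ p) *P r) i
    ≡⟨ coeff-scale c ((x ∷ p) *P r) i ⟨
  coeff (scaleP c ((x ∷ p) *P r)) i ∎
  where
  open ≡.≡-Reasoning
  tail : ∀ i → coeff (+ 0 ∷ scaleP c p *P r) i ≡ c ℤ.* coeff (+ 0 ∷ p *P r) i
  tail zero    = ≡.sym (ℤ.*-zeroʳ c)
  tail (suc i) = ≡.trans (scale-* c p r .at i) (coeff-scale c (p *P r) i)

*P-assoc : ∀ p r s → (p *P r) *P s ≋ p *P (r *P s)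
*P-assoc []      r s = ≋-refl
*P-assoc (x ∷ p) r s = ≋-trans (*P-distribʳ s (scaleP x r) (+ 0 ∷ p *P r))
  (+P-cong (scale-* x r s) (≋-trans (0∷-* (p *P r) s) (∷-cong (*P-assoc p r s))))

shift-cong : ∀ n {p r} → p ≋ r → shiftP n p ≋ shiftP n r
shift-cong zero    p≋r = p≋r
shift-cong (suc n) p≋r = ∷-cong (shift-cong n p≋r)

shift-* : ∀ n p r → shiftP n p *P r ≋ shiftP n (p *P r)
shift-* zero    p r = ≋-refl
shift-* (suc n) p r = ≋-trans (0∷-* (shiftP n p) r) (∷-cong (shift-* n p r))

*-shift : ∀ n p r → p *P shiftP n r ≋ shiftP n (p *P r)
*-shift n p r = ≋-trans (*P-comm p (shiftP n r)) (≋-trans (shift-* n r p) (shift-cong n (*P-comm r p)))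

*P-local : ∀ p {r s} i → (∀ j → j ℕ.≤ i → coeff r j ≡ coeff s j) → coeff (p *P r) i ≡ coeff (p *P s) i
*P-local []      i r≡s = ≡.refl
*P-local (x ∷ p) {r} {s} i r≡s = ≡.trans (coeff-* x p r i) (≡.trans
  (≡.cong₂ ℤ._+_ (≡.cong (x ℤ.*_) (r≡s i ℕ.≤-refl)) (tail i r≡s)) (≡.sym (coeff-* x p s i)))
  where
  tail : ∀ i → (∀ j → j ℕ.≤ i → coeff r j ≡ coeff s j) →
    coeff (+ 0 ∷ p *P r) i ≡ coeff (+ 0 ∷ p *P s) i
  tail zero    r≡s = ≡.refl
  tail (suc i) r≡s = *P-local p i (λ j j≤i → r≡s j (ℕ.m≤n⇒m≤1+n j≤i))

-- Coefficients of p are determined successively, as the multiplier has constant term 1.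
*P-cancelˡ : ∀ u {p r} → (+ 1 ∷ u) *P p ≋ (+ 1 ∷ u) *P r → p ≋ r
*P-cancelˡ u {p} {r} eq .at i = below (suc i) i ℕ.≤-refl
  where
  below : ∀ n j → j ℕ.< n → coeff p j ≡ coeff r j
  below (suc n) j (s≤s j≤n) = ≡.trans (≡.sym (ℤ.*-identityˡ _)) (≡.trans
    (∙-cancelʳ (AbelianGroup.group ℤ.+-0-abelianGroup) (coeff (+ 0 ∷ u *P p) j) _ _
      (≡.trans (≡.sym (coeff-* (+ 1) u p j)) (≡.trans (eq .at j)
      (≡.trans (coeff-* (+ 1) u r j) (≡.cong (ℤ._+_ (+ 1 ℤ.* coeff r j)) (≡.sym (tail j j≤n)))))))
    (ℤ.*-identityˡ _))
    where
    tail : ∀ j → j ℕ.≤ n → coeff (+ 0 ∷ u *P p) j ≡ coeff (+ 0 ∷ u *P r) j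
    tail zero    _   = ≡.refl
    tail (suc j) j<n = *P-local u j (λ i i≤j → below n i (ℕ.≤-<-trans i≤j j<n))

coeffP-neg : ∀ p n → coeffP p -[1+ n ] ≡ + 0
coeffP-neg []      n = ≡.refl
coeffP-neg (x ∷ p) n = ≡.refl

coeffP-cong : ∀ {p r} → p ≋ r → ∀ i → coeffP p i ≡ coeffP r i
coeffP-cong         p≋r (+ i)    = p≋r .at i
coeffP-cong {p} {r} p≋r -[1+ i ] = ≡.trans (coeffP-neg p i) (≡.sym (coeffP-neg r i))

coeffP-+ : ∀ p r i → coeffP (p +P r) i ≡ coeffP p i ℤ.+ coeffP r i
coeffP-+ p r (+ i)    = coeff-+ p r i
coeffP-+ p r -[1+ i ] = ≡.trans (coeffP-neg (p +P r) i)
  (≡.sym (≡.cong₂ ℤ._+_ (coeffP-neg p i) (coeffP-neg r i)))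

coeffP-scale : ∀ c p i → coeffP (scaleP c p) i ≡ c ℤ.* coeffP p i
coeffP-scale c p (+ i)    = coeff-scale c p i
coeffP-scale c p -[1+ i ] = ≡.trans (coeffP-neg (scaleP c p) i)
  (≡.sym (≡.trans (≡.cong (c ℤ.*_) (coeffP-neg p i)) (ℤ.*-zeroʳ c)))

coeffP-shift : ∀ n p i → coeffP (shiftP n p) (i ℤ.+ + n) ≡ coeffP p i
coeffP-shift zero    p i = ≡.cong (coeffP p) (ℤ.+-identityʳ i)
coeffP-shift (suc n) p i = ≡.trans (≡.cong (coeffP (+ 0 ∷ shiftP n p)) (index i (+ n)))
  (≡.trans (cons (shiftP n p) (i ℤ.+ + n)) (coeffP-shift n p i))
  where
  index : ∀ i j → i ℤ.+ (+ 1 ℤ.+ j) ≡ + 1 ℤ.+ (i ℤ.+ j)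
  index = ℤSolver.solve-∀
  cons : ∀ p i → coeffP (+ 0 ∷ p) (+ 1 ℤ.+ i) ≡ coeffP p i
  cons p (+ i)          = ≡.refl
  cons p -[1+ zero ]    = ≡.sym (coeffP-neg p 0)
  cons p -[1+ suc i ]   = ≡.sym (coeffP-neg p (suc i))

-- Laurent polynomials up to equality of coefficients

infix 4 _≋L_
record _≋L_ (x y : LPoly) : Set where
  constructor laurent
  field ≈L : x ≈L y
open _≋L_

≋L-refl : ∀ {x} → x ≋L x
≋L-refl .≈L i = ≡.refl

≋L-sym : ∀ {x y} → x ≋L y → y ≋L x
≋L-sym x≋y .≈L i = ≡.sym (x≋y .≈L i)

≋L-trans : ∀ {x y z} → x ≋L y → y ≋L z → x ≋L z
≋L-trans x≋y y≋z .≈L i = ≡.trans (x≋y .≈L i) (y≋z .≈L i)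

lp-cong : ∀ {a b p r} → a ≡ b → p ≋ r → lp a p ≋L lp b r
lp-cong ≡.refl p≋r .≈L i = coeffP-cong p≋r _

coeffP-shift′ : ∀ n p {i j} → j ≡ i ℤ.+ + n → coeffP (shiftP n p) j ≡ coeffP p i
coeffP-shift′ n p ≡.refl = coeffP-shift n p _

private
  outer : ∀ i a b → i ℤ.+ (a ℤ.+ b) ≡ i ℤ.+ a ℤ.+ b
  outer = ℤSolver.solve-∀

  inner : ∀ i a b → i ℤ.+ (a ℤ.+ b) ≡ i ℤ.+ b ℤ.+ a
  inner = ℤSolver.solve-∀

-- An equation of Laurent polynomials multiplied by q^(a+b); with its converse it reduces
-- compatibility and cancellation to polynomials.
≋L⇒shift : ∀ {a b p r} → lp a p ≋L lp b r → shiftP b p ≋ shiftP a r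
≋L⇒shift {a} {b} {p} {r} eq .at j = ≡.trans (coeffP-shift′ b p (e₁ (+ j) (+ a) (+ b)))
  (≡.trans (eq .≈L i) (≡.sym (coeffP-shift′ a r (e₂ (+ j) (+ a) (+ b)))))
  where
  i = + j ℤ.- + a ℤ.- + b
  e₁ : ∀ j a b → j ≡ j ℤ.- a ℤ.- b ℤ.+ a ℤ.+ b
  e₁ = ℤSolver.solve-∀
  e₂ : ∀ j a b → j ≡ j ℤ.- a ℤ.- b ℤ.+ b ℤ.+ a
  e₂ = ℤSolver.solve-∀

shift⇒≋L : ∀ {a b p r} → shiftP b p ≋ shiftP a r → lp a p ≋L lp b r
shift⇒≋L {a} {b} {p} {r} eq .≈L i = ≡.trans (≡.sym (coeffP-shift b p (i ℤ.+ + a)))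
  (≡.trans (coeffP-cong eq _) (coeffP-shift′ a r (swap i (+ a) (+ b))))
  where
  swap : ∀ i a b → i ℤ.+ a ℤ.+ b ≡ i ℤ.+ b ℤ.+ a
  swap = ℤSolver.solve-∀

coeffL-+ : ∀ x y i → coeffL (x +L y) i ≡ coeffL x i ℤ.+ coeffL y i
coeffL-+ (lp a p) (lp b r) i = ≡.trans (coeffP-+ (shiftP b p) (shiftP a r) _)
  (≡.cong₂ ℤ._+_ (coeffP-shift′ b p (outer i (+ a) (+ b))) (coeffP-shift′ a r (inner i (+ a) (+ b))))

coeffL-neg : ∀ x i → coeffL (-L x) i ≡ ℤ.- coeffL x i
coeffL-neg (lp a p) i = ≡.trans (coeffP-scale (ℤ.- (+ 1)) p _) (ℤ.-1*i≡-i (coeffL (lp a p) i))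

+L-cong : ∀ {x x′ y y′} → x ≋L x′ → y ≋L y′ → x +L y ≋L x′ +L y′
+L-cong {x} {x′} {y} {y′} x≋ y≋ .≈L i = ≡.trans (coeffL-+ x y i)
  (≡.trans (≡.cong₂ ℤ._+_ (x≋ .≈L i) (y≋ .≈L i)) (≡.sym (coeffL-+ x′ y′ i)))

+L-assoc : ∀ x y z → (x +L y) +L z ≋L x +L (y +L z)
+L-assoc x y z .≈L i = begin
  coeffL ((x +L y) +L z) i                       ≡⟨ coeffL-+ (x +L y) z i ⟩
  coeffL (x +L y) i ℤ.+ coeffL z i               ≡⟨ ≡.cong (ℤ._+ _) (coeffL-+ x y i) ⟩
  coeffL x i ℤ.+ coeffL y i ℤ.+ coeffL z i       ≡⟨ ℤ.+-assoc (coeffL x i) _ _ ⟩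
  coeffL x i ℤ.+ (coeffL y i ℤ.+ coeffL z i)     ≡⟨ ≡.cong (ℤ._+_ (coeffL x i)) (coeffL-+ y z i) ⟨
  coeffL x i ℤ.+ coeffL (y +L z) i               ≡⟨ coeffL-+ x (y +L z) i ⟨
  coeffL (x +L (y +L z)) i                       ∎
  where open ≡.≡-Reasoning

+L-comm : ∀ x y → x +L y ≋L y +L x
+L-comm x y .≈L i = ≡.trans (coeffL-+ x y i) (≡.trans (ℤ.+-comm (coeffL x i) _) (≡.sym (coeffL-+ y x i)))

+L-identityˡ : ∀ x → zeroL +L x ≋L x
+L-identityˡ x .≈L i = ≡.trans (coeffL-+ zeroL x i) (ℤ.+-identityˡ _)

-L-cong : ∀ {x y} → x ≋L y → -L x ≋L -L y
-L-cong {x} {y} x≋y .≈L i = ≡.trans (coeffL-neg x i) (≡.trans (≡.cong ℤ.-_ (x≋y .≈L i)) (≡.sym (coeffL-neg y i)))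

-L-inverseˡ : ∀ x → -L x +L x ≋L zeroL
-L-inverseˡ x .≈L i = ≡.trans (coeffL-+ (-L x) x i)
  (≡.trans (≡.cong (ℤ._+ coeffL x i) (coeffL-neg x i)) (ℤ.+-inverseˡ (coeffL x i)))

*L-comm : ∀ x y → x *L y ≋L y *L x
*L-comm (lp a p) (lp b r) = lp-cong (ℕ.+-comm a b) (*P-comm p r)

*L-assoc : ∀ x y z → (x *L y) *L z ≋L x *L (y *L z)
*L-assoc (lp a p) (lp b r) (lp c s) = lp-cong (ℕ.+-assoc a b c) (*P-assoc p r s)

*L-identityˡ : ∀ x → oneL *L x ≋L x
*L-identityˡ (lp a p) = lp-cong ≡.refl (*P-identityˡ p)

*L-congʳ : ∀ {x x′} y → x ≋L x′ → x *L y ≋L x′ *L y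
*L-congʳ {lp a p} {lp a′ p′} (lp b r) x≋x′ = shift⇒≋L (≋-trans
  (≋-sym (shift-* (a′ ℕ.+ b) p r)) (≋-trans (*P-congʳ r shifted) (shift-* (a ℕ.+ b) p′ r)))
  where
  shifted : shiftP (a′ ℕ.+ b) p ≋ shiftP (a ℕ.+ b) p′
  shifted = ≋L⇒shift {a ℕ.+ b} {a′ ℕ.+ b} (laurent λ i → ≡.trans
    (≡.cong (coeffP p) (inner i (+ a) (+ b))) (≡.trans (x≋x′ .≈L (i ℤ.+ + b))
    (≡.cong (coeffP p′) (≡.sym (inner i (+ a′) (+ b))))))

*L-cong : ∀ {x x′ y y′} → x ≋L x′ → y ≋L y′ → x *L y ≋L x′ *L y′
*L-cong {x} {x′} {y} {y′} x≋ y≋ = ≋L-trans (*L-congʳ y x≋)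
  (≋L-trans (*L-comm x′ y) (≋L-trans (*L-congʳ x′ y≋) (*L-comm y′ x′)))

-- The two sides are represented with the different shifts a + b + c and 2a + b + c, so coefficients
-- are compared and not bodies.
*L-distribˡ : ∀ x y z → x *L (y +L z) ≋L x *L y +L x *L z
*L-distribˡ (lp a p) (lp b r) (lp c s) .≈L i = begin
  coeffP (p *P (shiftP c r +P shiftP b s)) I
    ≡⟨ coeffP-cong (≋-trans (*P-distribˡ p (shiftP c r) (shiftP b s))
         (+P-cong (*-shift c p r) (*-shift b p s))) I ⟩
  coeffP (shiftP c (p *P r) +P shiftP b (p *P s)) I
    ≡⟨ coeffP-+ (shiftP c (p *P r)) _ I ⟩
  coeffP (shiftP c (p *P r)) I ℤ.+ coeffP (shiftP b (p *P s)) I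
    ≡⟨ ≡.cong₂ ℤ._+_ (coeffP-shift′ c (p *P r) (e₁ i (+ a) (+ b) (+ c)))
         (coeffP-shift′ b (p *P s) (e₂ i (+ a) (+ b) (+ c))) ⟩
  coeffL (lp a p *L lp b r) i ℤ.+ coeffL (lp a p *L lp c s) i
    ≡⟨ coeffL-+ (lp a p *L lp b r) (lp a p *L lp c s) i ⟨
  coeffL (lp a p *L lp b r +L lp a p *L lp c s) i ∎
  where
  open ≡.≡-Reasoning
  I = i ℤ.+ + (a ℕ.+ (b ℕ.+ c))
  e₁ : ∀ i a b c → i ℤ.+ (a ℤ.+ (b ℤ.+ c)) ≡ i ℤ.+ (a ℤ.+ b) ℤ.+ c
  e₁ = ℤSolver.solve-∀
  e₂ : ∀ i a b c → i ℤ.+ (a ℤ.+ (b ℤ.+ c)) ≡ i ℤ.+ (a ℤ.+ c) ℤ.+ b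
  e₂ = ℤSolver.solve-∀

laurentRing : CommutativeRing 0ℓ 0ℓ
laurentRing = record
  { Carrier = LPoly ; _≈_ = _≋L_ ; _+_ = _+L_ ; _*_ = _*L_ ; -_ = -L_ ; 0# = zeroL ; 1# = oneL
  ; isCommutativeRing = record
    { isRing = record
      { +-isAbelianGroup = record
        { isGroup = record
          { isMonoid = record
            { isSemigroup = record
              { isMagma = record
                { isEquivalence = record { refl = ≋L-refl ; sym = ≋L-sym ; trans = ≋L-trans }
                ; ∙-cong = +L-cong }
              ; assoc = +L-assoc }
            ; identity = +L-identityˡ , λ x → ≋L-trans (+L-comm x zeroL) (+L-identityˡ x) }
          ; inverse = -L-inverseˡ , λ x → ≋L-trans (+L-comm x (-L x)) (-L-inverseˡ x)
          ; ⁻¹-cong = -L-cong }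
        ; comm = +L-comm }
      ; *-cong = *L-cong
      ; *-assoc = *L-assoc
      ; *-identity = *L-identityˡ , λ x → ≋L-trans (*L-comm x oneL) (*L-identityˡ x)
      ; distrib = *L-distribˡ , λ x y z → ≋L-trans (*L-comm (y +L z) x)
          (≋L-trans (*L-distribˡ x y z) (+L-cong (*L-comm x y) (*L-comm x z))) }
    ; *-comm = *L-comm } }

-- The given q-numbers as elements of the abstract setting

open import Data.Nat using (_+_; _≤_; _%_)
open CommutativeRing laurentRing
  using (setoid; semiring; reflexive; *-congˡ; *-cong; +-congˡ; +-cong;
         *-identityʳ; *-identityˡ; *-assoc; -‿cong)
open import Algebra.Properties.Semiring.Exp semiring using (_^_; ^-congˡ)
open import Relation.Binary.Reasoning.Setoid setoid

q q⁻¹ : LPoly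
q   = ⟦ shiftP 1 oneP ⟧
q⁻¹ = lp 1 oneP

open QNumbers laurentRing q

q⁻¹*q≋1 : q⁻¹ *L q ≋L oneL
q⁻¹*q≋1 = shift⇒≋L (*P-identityˡ (shiftP 1 oneP))

qint≋ : ∀ n → qint n ≋L [ n ]
qint≋ zero    = ≋L-refl
qint≋ (suc n) = ≋L-trans (lp-cong ≡.refl cons) (+-congˡ {oneL} (*-congˡ {q} (qint≋ n)))
  where
  cons : replicate (suc n) (+ 1) ≋ oneP +P (shiftP 1 oneP *P replicate n (+ 1))
  cons = ≋-trans head (+P-cong {oneP} ≋-refl (≋-sym (≋-trans (0∷-* oneP _) (∷-cong (*P-identityˡ _)))))
    where
    head : replicate (suc n) (+ 1) ≋ oneP +P (+ 0 ∷ replicate n (+ 1))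
    head ._≋_.at zero    = ≡.refl
    head ._≋_.at (suc i) = ≡.refl

-- As a polynomial, [n+1] has constant term 1; `*P-cancelˡ` therefore applies once negative powers
-- of q are cleared.
regular : Regular
regular n {x@(lp a p)} {y@(lp b r)} eq = shift⇒≋L {a} {b} {p} {r} (*P-cancelˡ (replicate n (+ 1))
  (≋-trans (*-shift b u p) (≋-trans (≋L⇒shift {a} {b} {u *P p} {u *P r} qint-eq) (≋-sym (*-shift a u r)))))
  where
  u = replicate (suc n) (+ 1)
  qint-eq : qint (suc n) *L x ≋L qint (suc n) *L y
  qint-eq = ≋L-trans (*L-congʳ x (qint≋ (suc n))) (≋L-trans eq (≋L-sym (*L-congʳ y (qint≋ (suc n)))))

open Binomials laurentRing q regular

qfact≋ : ∀ n → qfact n ≋L [ n ]!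
qfact≋ zero    = ≋L-refl
qfact≋ (suc n) = *-cong (qint≋ (suc n)) (qfact≋ n)

shift≋ : ∀ k p → ⟦ shiftP k p ⟧ ≋L q ^ k *L ⟦ p ⟧
shift≋ zero    p = ≋L-sym (*-identityˡ ⟦ p ⟧)
shift≋ (suc k) p = ≋L-trans (lp-cong ≡.refl (≋-sym (≋-trans (0∷-* oneP _) (∷-cong (*P-identityˡ _)))))
  (≋L-trans (*-congˡ {q} (shift≋ k p)) (≋L-sym (*-assoc q (q ^ k) ⟦ p ⟧)))

qbinℕ≋ : ∀ n k → ⟦ qbinℕ n k ⟧ ≋L binom n k
qbinℕ≋ zero    zero    = ≋L-refl
qbinℕ≋ zero    (suc k) = ≋L-refl
qbinℕ≋ (suc n) zero    = ≋L-refl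
qbinℕ≋ (suc n) (suc k) = +-cong {⟦ qbinℕ n k ⟧} (qbinℕ≋ n k)
  (≋L-trans (shift≋ (suc k) (qbinℕ n (suc k))) (*-congˡ {q ^ suc k} (qbinℕ≋ n (suc k))))

qpow-+ : ∀ n → qpow (+ n) ≋L q ^ n
qpow-+ n = ≋L-trans (shift≋ n oneP) (*-identityʳ (q ^ n))

qpow-neg : ∀ n → qpow (ℤ.- (+ n)) ≋L q⁻¹ ^ n
qpow-neg zero          = ≋L-refl
qpow-neg (suc zero)    = ≋L-sym (*-identityʳ q⁻¹)
qpow-neg (suc (suc n)) = ≋L-trans (lp-cong ≡.refl (≋-sym (*P-identityˡ oneP))) (*-congˡ {q⁻¹} (qpow-neg (suc n)))

qpow-⊖ : ∀ a b → qpow (a ℤ.⊖ b) ≋L q ^ a *L q⁻¹ ^ b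
qpow-⊖ a       zero    = ≋L-trans (qpow-+ a) (≋L-sym (*-identityʳ (q ^ a)))
qpow-⊖ zero    (suc b) = ≋L-trans (qpow-neg (suc b)) (≋L-sym (*-identityˡ (q⁻¹ ^ suc b)))
qpow-⊖ (suc a) (suc b) = ≋L-trans (reflexive (≡.cong qpow (ℤ.[1+m]⊖[1+n]≡m⊖n a b)))
  (≋L-trans (qpow-⊖ a b) (inverse-cancel q⁻¹*q≋1 a b))

^L≡^ : ∀ x n → x ^L n ≡ x ^ n
^L≡^ x zero    = ≡.refl
^L≡^ x (suc n) = ≡.cong (x *L_) (^L≡^ x n)

^L≋ : ∀ {x y} n → x ≋L y → x ^L n ≋L y ^ n
^L≋ {x} n x≋y = ≋L-trans (reflexive (^L≡^ x n)) (^-congˡ n x≋y)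

sumL≋ : ∀ m f → sumL m f ≋L Σ< (suc m) f
sumL≋ m f = go (suc m) (λ k → k)
  where
  -- The list of indices is generalised from the identity to an arbitrary g, as the tail of the list
  -- is indexed by successors.
  go : ∀ n g → foldr (λ k acc → f k +L acc) zeroL (applyUpTo g n) ≋L Σ< n (λ k → f (g k))
  go zero    g = ≋L-refl
  go (suc n) g = +-congˡ {f (g 0)} (go n (λ k → g (suc k)))

qbin-pred : ∀ a e → qbin a (+ e ℤ.- + 1) ≋L binom₋₁ a e
qbin-pred a zero    = ≋L-refl
qbin-pred a (suc e) = qbinℕ≋ a e

ballot≋ : ∀ n k → ballot n k ≋L ballot′ n k
ballot≋ n k with ℕ.≤-<-connex k n
... | inj₁ k≤n = begin
  ballot n k
    ≡⟨ ≡.cong (λ z → qbin (2 ℕ.* n) z -L qbin (2 ℕ.* n) (z ℤ.- + 1))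
         (≡.trans (ℤ.m-n≡m⊖n n k) (ℤ.⊖-≥ k≤n)) ⟩
  qbin (2 ℕ.* n) (+ (n ∸ k)) -L qbin (2 ℕ.* n) (+ (n ∸ k) ℤ.- + 1)
    ≈⟨ +-cong {⟦ qbinℕ (2 ℕ.* n) (n ∸ k) ⟧}
         (qbinℕ≋ (2 ℕ.* n) (n ∸ k)) (-‿cong (qbin-pred (2 ℕ.* n) (n ∸ k))) ⟩
  binom (2 ℕ.* n) (n ∸ k) -L binom₋₁ (2 ℕ.* n) (n ∸ k)
    ≈⟨ ballot′-reflect n k k≤n ⟩
  ballot′ n k ∎
... | inj₂ n<k with ℕ.m≤n⇒∃[o]m+o≡n n<k
...   | d , ≡.refl = begin
  ballot n k
    ≡⟨ ≡.cong (λ z → qbin (2 ℕ.* n) z -L qbin (2 ℕ.* n) (z ℤ.- + 1))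
         (≡.trans (ℤ.m-n≡m⊖n n k) (≡.trans (ℤ.⊖-< n<k) (≡.cong (λ z → ℤ.- + z)
           (≡.trans (≡.cong (_∸ n) (≡.sym (ℕ.+-suc n d))) (ℕ.m+n∸m≡n n (suc d)))))) ⟩
  zeroL -L zeroL
    ≈⟨ +-cong {zeroL} (≋L-sym (binom-< 2n<)) (-‿cong (≋L-sym (binom-< (ℕ.m≤n⇒m≤1+n 2n<)))) ⟩
  ballot′ n k ∎
  where
  2n< : 2 ℕ.* n ℕ.< n ℕ.+ k
  2n< = ℕ.≤-<-trans (ℕ.≤-reflexive (≡.cong (n ℕ.+_) (ℕ.+-identityʳ n))) (ℕ.+-monoʳ-< n n<k)

odd⇒even : ∀ n → n % 2 ≡ 1 → Even (suc n)
odd⇒even (suc zero)    _   = 2+ zero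
odd⇒even (suc (suc n)) odd = 2+ odd⇒even n odd

-- Both congruences for Laurent polynomials

module _ (m n s t j r : ℕ) where

  open Divisibility laurentRing q q⁻¹ regular q⁻¹*q≋1 m n
    using (ballots; IsModulus′; plain-prefactor; alternating-prefactor;
           modulus-divides-plain; modulus-divides-alternating)

  qint^≋ : ∀ k → qint (2 ℕ.* k + 1) ^L r ≋L [ suc (k + k) ] ^ r
  qint^≋ k = ^L≋ r (≋L-trans (qint≋ (2 ℕ.* k + 1)) (reflexive (≡.cong [_] (e k))))
    where
    e : ∀ k → 2 ℕ.* k + 1 ≡ suc (k + k)
    e = solve-∀

  ballots≋ : ∀ k {x y} → x ≋L y →
    x *L ballot m k ^L suc s *L ballot n k ^L suc t ≋L ballots s t k y
  ballots≋ k x≋y = *L-cong (*L-cong x≋y (^L≋ (suc s) (ballot≋ m k))) (^L≋ (suc t) (ballot≋ n k))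

  term1≋ : ∀ k → term1 m n (suc s) (suc t) j r k ≋L ballots s t k (plain-prefactor j r k)
  term1≋ k = ballots≋ k (*L-cong power (qint^≋ k))
    where
    J = j ℕ.* (k ℕ.* k + k)
    power : qpow (+ J ℤ.- + (r ℕ.* k)) ≋L q ^ J *L q⁻¹ ^ (r ℕ.* k)
    power = ≋L-trans (reflexive (≡.cong qpow (ℤ.m-n≡m⊖n J (r ℕ.* k)))) (qpow-⊖ J (r ℕ.* k))

  term2≋ : ∀ k → term2 m n (suc s) (suc t) j r k ≋L ballots s t k (alternating-prefactor j r k)
  term2≋ k = ballots≋ k (*L-cong (*L-cong (reflexive (^L≡^ (-L oneL) k)) power) (qint^≋ k))
    where
    J = j ℕ.* (k ℕ.* k + k)
    z = + choose2 k ℤ.+ + J ℤ.- (+ r ℤ.- + 1) ℤ.* + k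
    e : ∀ c r k → c ℤ.- (r ℤ.- + 1) ℤ.* k ≡ c ℤ.+ k ℤ.- r ℤ.* k
    e = ℤSolver.solve-∀
    z≡ : z ≡ (choose2 k + J + k) ℤ.⊖ (r ℕ.* k)
    z≡ = ≡.trans (e (+ (choose2 k + J)) (+ r) (+ k))
      (≡.trans (≡.cong (λ y → + (choose2 k + J + k) ℤ.- y) (≡.sym (ℤ.pos-* r k)))
        (ℤ.m-n≡m⊖n (choose2 k + J + k) (r ℕ.* k)))
    power : qpow z ≋L q ^ (choose2 k + J + k) *L q⁻¹ ^ (r ℕ.* k)
    power = ≋L-trans (reflexive (≡.cong qpow z≡)) (qpow-⊖ (choose2 k + J + k) (r ℕ.* k))

  divides-sum : ∀ {f g : ℕ → LPoly} → (∀ k → f k ≋L g k) → ∀ D →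
    (∃ λ L → [ suc (m + n) ] *L Σ< (suc m) g ≋L D *L L) →
    (qint (m + n + 1) *L sumL m f) ≡0mod D
  divides-sum {f} {g} f≋g D (L , sum≋) = L , ≋L-trans {y = [ suc (m + n) ] *L Σ< (suc m) g}
    (*L-cong (≋L-trans (qint≋ (m + n + 1)) (reflexive (≡.cong [_] (ℕ.+-comm (m + n) 1))))
      (≋L-trans (sumL≋ m f) (Σ<-cong (suc m) {f} {g} (λ k _ → f≋g k)))) sum≋ ._≋L_.≈L

  modulus≋ : ∀ D → IsModulus m n D → IsModulus′ D
  modulus≋ D D-modulus = ≋L-trans
    (*L-cong (≋L-refl {D}) (≋L-sym (*L-cong (*L-cong (qfact≋ (m + n)) (qfact≋ m)) (qfact≋ n))))
    (≋L-trans
      (laurent {D *L (qfact (m + n) *L qfact m *L qfact n)} {qfact (2 ℕ.* m) *L qfact (2 ℕ.* n)} D-modulus)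
      (*L-cong (qfact≋ (2 ℕ.* m)) (qfact≋ (2 ℕ.* n))))

  both-divisible : Even (s + (t + suc r)) → ∀ D → IsModulus m n D →
    ((qint (m + n + 1) *L sumL m (term1 m n (suc s) (suc t) j r)) ≡0mod D)
    × ((qint (m + n + 1) *L sumL m (term2 m n (suc s) (suc t) j r)) ≡0mod D)
  both-divisible even D D-modulus =
    divides-sum {g = λ k → ballots s t k (plain-prefactor j r k)} term1≋ D
      (modulus-divides-plain j r s t even {D} (modulus≋ D D-modulus)) ,
    divides-sum {g = λ k → ballots s t k (alternating-prefactor j r k)} term2≋ D
      (modulus-divides-alternating j r s t even {D} (modulus≋ D D-modulus))

theorem1p4 : (m n s t j r : ℕ) → 1 ≤ m → 1 ≤ n → 1 ≤ s → 1 ≤ t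
    → (r + s + t) % 2 ≡ 1 → j ≤ s + t
    → (D : LPoly) → IsModulus m n D
    → ((qint (m + n + 1) *L sumL m (term1 m n s t j r)) ≡0mod D)
    × ((qint (m + n + 1) *L sumL m (term2 m n s t j r)) ≡0mod D)
theorem1p4 m n (suc s) (suc t) j r _ _ _ _ odd _ D D-modulus =
  -- From here s and t are the exponents less one, the missing pair being the one turned into S² Γ
  -- β. Oddness of r + (s+1) + (t+1) becomes evenness of s + t + (r+1) after two successors are
  -- removed.
  both-divisible m n s t j r (strip₂ (≡.subst Even (e r s t) (odd⇒even (r + suc s + suc t) odd))) D D-modulus
  where
  e : ∀ r s t → suc (r + suc s + suc t) ≡ suc (suc (s + (t + suc r)))
  e = solve-∀
  strip₂ : ∀ {a} → Even (suc (suc a)) → Even a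
  strip₂ (2+ even) = even
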